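{- ($\mathtt{mkvar}$ is conservative.) Let $\Gamma\vdash M,N:A$ be terms of $\mathrm{SCI}$ such that $M\cong N$. Then $M\cong_{\mathtt{mk}}N$.
   Context: **The language SCI.** Types: $A::=\mathtt{nat}\mid\mathtt{comm}\mid\mathtt{var}\mid A\multimap A$ (the first three are the base types). Terms: $M::=n\mid M\odot M\mid\mathtt{skip}\mid M;M\mid M:=M\mid\,!M\mid\mathtt{while}\ M\ \mathtt{do}\ M\mid\mathtt{ifzero}\ M\ \mathtt{then}\ M\ \mathtt{else}\ M\mid x\mid\lambda x^A.M\mid MM\mid\mathtt{new}\ x\ \mathtt{in}\ M$, where $n\in\mathbb N$, $x$ is an identifier, and $\odot$ ranges over a fixed collection of arithmetic operations on $\mathbb N$ including $+$ and (truncated) $-$. Terms are taken up to $\alpha$-equivalence ($\lambda x$ and $\mathtt{new}\ x$ bind $x$). A context $\Gamma$ is a list $x_1:A_1,\dots,x_n:A_n$ with distinct identifiers. **Typing** (all judgments must be well-formed, so $\Gamma,\Delta$ have disjoint identifiers in the application rule): $x:A\vdash x:A$; if $\Gamma,x:A\vdash M:B$ then $\Gamma\vdash\lambda x^A.M:A\multimap B$; if $\Gamma\vdash M:A\multimap B$ and $\Delta\vdash N:A$ then $\Gamma,\Delta\vdash MN:B$; weakening (from $\Gamma\vdash M:B$ infer $\Gamma,x:A\vdash M:B$); exchange (permuting $\Gamma$); $\vdash n:\mathtt{nat}$; $\vdash\mathtt{skip}:\mathtt{comm}$; and, with the same $\Gamma$ in all premises and conclusion: $M\odot N:\mathtt{nat}$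 if $M,N:\mathtt{nat}$; $M;N:B$ if $M:\mathtt{comm}$, $N:B$, $B$ a base type; $M:=N:\mathtt{comm}$ if $M:\mathtt{var}$, $N:\mathtt{nat}$; $!M:\mathtt{nat}$ if $M:\mathtt{var}$; $\mathtt{while}\ M\ \mathtt{do}\ N:\mathtt{comm}$ if $M:\mathtt{nat}$, $N:\mathtt{comm}$; $\mathtt{ifzero}\ M\ \mathtt{then}\ N_1\ \mathtt{else}\ N_2:B$ if $M:\mathtt{nat}$, $N_1,N_2:B$, $B$ a base type; and $\Gamma\vdash\mathtt{new}\ x\ \mathtt{in}\ M:B$ if $\Gamma,x:\mathtt{var}\vdash M:B$ with $B\in\{\mathtt{comm},\mathtt{nat}\}$. **Operational semantics.** Judgments $\sigma,M\Downarrow\sigma',V$, where $M,V$ are typed in a context $\Gamma$ of $\mathtt{var}$-typed identifiers, $\sigma,\sigma'$ are stores (functions from the identifiers of $\Gamma$ to $\mathbb N$), and $V$ is a value: a numeral, $\mathtt{skip}$, an identifier, or a $\lambda$-abstraction. $(\sigma\mid x\mapsto n)$ is $\sigma$ updated/extended to send $x$ to $n$. Rules: $\sigma,V\Downarrow\sigma,V$; if $\sigma,M\Downarrow\sigma',\lambda x^A.M'$ and $\sigma',M'[N/x]\Downarrow\sigma'',V$ then $\sigma,MN\Downarrow\sigma'',V$; if $\sigma,M_1\Downarrow\sigma',n_1$ and $\sigma',M_2\Downarrow\sigma'',n_2$ then $\sigma,M_1\odot M_2\Downarrow\sigma'',n_1\odot n_2$; if $\sigma,N\Downarrow\sigma',n$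 and $\sigma',M\Downarrow\sigma'',x$ then $\sigma,M:=N\Downarrow(\sigma''\mid x\mapsto n),\mathtt{skip}$; if $\sigma,M\Downarrow\sigma',x$ then $\sigma,!M\Downarrow\sigma',\sigma'(x)$; if $\sigma,M\Downarrow\sigma',\mathtt{skip}$ and $\sigma',N\Downarrow\sigma'',V$ then $\sigma,M;N\Downarrow\sigma'',V$; if $\sigma,M\Downarrow\sigma',n$ with $n\neq0$ then $\sigma,\mathtt{while}\ M\ \mathtt{do}\ N\Downarrow\sigma',\mathtt{skip}$; if $\sigma,M\Downarrow\sigma',0$, $\sigma',N\Downarrow\sigma'',\mathtt{skip}$ and $\sigma'',\mathtt{while}\ M\ \mathtt{do}\ N\Downarrow\sigma''',\mathtt{skip}$ then $\sigma,\mathtt{while}\ M\ \mathtt{do}\ N\Downarrow\sigma''',\mathtt{skip}$; $\mathtt{ifzero}$ evaluates its guard and then the first branch (guard value $0$) or the second (guard value $\neq0$), threading the store; if $(\sigma\mid x\mapsto0),M\Downarrow(\sigma'\mid x\mapsto n),V$ then $\sigma,\mathtt{new}\ x\ \mathtt{in}\ M\Downarrow\sigma',V$ (with $x$ not in the domain of $\sigma,\sigma'$). For closed terms the empty store is omitted. **Extension.** $\mathrm{SCI}_{\mathtt{mk}}$ is SCI plus: $\Gamma\vdash\mathtt{mkvar}\ M\ N:\mathtt{var}$ if $\Gamma\vdash M:\mathtt{nat}\multimap\mathtt{comm}$ and $\Gamma\vdash N:\mathtt{nat}$; $\mathtt{mkvar}\ M\ N$ is a value (evaluates to itself), and: if $\sigma,N\Downarrow\sigma',n$,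 $\sigma',M\Downarrow\sigma'',\mathtt{mkvar}\ M_1\ M_2$ and $\sigma'',M_1n\Downarrow\sigma''',V$ then $\sigma,M:=N\Downarrow\sigma''',V$; if $\sigma,M\Downarrow\sigma',\mathtt{mkvar}\ M_1\ M_2$ and $\sigma',M_2\Downarrow\sigma'',V$ then $\sigma,!M\Downarrow\sigma'',V$. **Contextual equivalence.** For $L\in\{\mathrm{SCI},\mathrm{SCI}_{\mathtt{mk}}\}$ and terms $\Gamma\vdash M,N:A$ of $L$, $M$ and $N$ are contextually equivalent in $L$ iff for every context (term with a hole, possibly capturing) $C[-]$ of $L$ with $\vdash C[M],C[N]:B$, $B\in\{\mathtt{comm},\mathtt{nat}\}$, and every value $\vdash V:B$: $C[M]\Downarrow V\iff C[N]\Downarrow V$. This relation is written $\cong$ for $\mathrm{SCI}$ and $\cong_{\mathtt{mk}}$ for $\mathrm{SCI}_{\mathtt{mk}}$. -}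

module Defs where

open import Data.Fin.Base using (Fin; zero; suc; _↑ˡ_; _↑ʳ_; lift)
open import Data.Fin.Permutation using (Permutation′; _⟨$⟩ʳ_)
open import Data.Nat.Base using (ℕ; zero; suc; _+_; _∸_)
open import Data.Vec.Base using (Vec; []; _∷_; _++_; lookup; _[_]≔_)
open import Function.Bundles using (_↣_; _⇔_; module Injection)
open import Relation.Binary.PropositionalEquality using (_≡_)

infixr 7 _⊸_

data Ty : Set where
  nat comm var : Ty
  _⊸_ : Ty → Ty → Ty

data Base : Ty → Set where
  nat  : Base nat
  comm : Base comm
  var  : Base var

data Ground : Ty → Set where
  nat  : Ground nat
  comm : Ground comm

data Lang : Set where
  SCI SCImk : Lang

-- A collection of binary operations on ℕ, given as a family indexed by Op.
record Operations : Set₁ where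
  field
    Op      : Set
    ⟦_⟧     : Op → ℕ → ℕ → ℕ
    plus    : Op
    minus   : Op
    ⟦plus⟧  : ∀ m n → ⟦ plus ⟧ m n ≡ m + n
    ⟦minus⟧ : ∀ m n → ⟦ minus ⟧ m n ≡ m ∸ n

module Language (𝒪 : Operations) where
  open Operations 𝒪

  -- Terms with identifiers among Fin n, up to α-equivalence (de Bruijn).
  -- SCI and SCImk share this raw syntax: the language a term belongs to is
  -- recorded by the typing judgment, since mkvar is typable only in SCImk.
  data Tm (n : ℕ) : Set where
    num     : ℕ → Tm n
    op      : Op → Tm n → Tm n → Tm n
    skip    : Tm n
    seq     : Tm n → Tm n → Tm n
    assign  : Tm n → Tm n → Tm n
    deref   : Tm n → Tm n
    while   : Tm n → Tm n → Tm n
    ifzero  : Tm n → Tm n → Tm n → Tm n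
    ident   : Fin n → Tm n
    lam     : Ty → Tm (suc n) → Tm n
    app     : Tm n → Tm n → Tm n
    new     : Tm (suc n) → Tm n
    mkvar   : Tm n → Tm n → Tm n

  rename : ∀ {m n} → (Fin m → Fin n) → Tm m → Tm n
  rename ρ (num k)        = num k
  rename ρ (op o M N)     = op o (rename ρ M) (rename ρ N)
  rename ρ skip           = skip
  rename ρ (seq M N)      = seq (rename ρ M) (rename ρ N)
  rename ρ (assign M N)   = assign (rename ρ M) (rename ρ N)
  rename ρ (deref M)      = deref (rename ρ M)
  rename ρ (while M N)    = while (rename ρ M) (rename ρ N)
  rename ρ (ifzero M N P) = ifzero (rename ρ M) (rename ρ N) (rename ρ P)
  rename ρ (ident x)      = ident (ρ x)
  rename ρ (lam A M)      = lam A (rename (lift 1 ρ) M)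
  rename ρ (app M N)      = app (rename ρ M) (rename ρ N)
  rename ρ (new M)        = new (rename (lift 1 ρ) M)
  rename ρ (mkvar M N)    = mkvar (rename ρ M) (rename ρ N)

  weaken : ∀ {n} → Tm n → Tm (suc n)
  weaken = rename suc

  liftSub : ∀ {m n} → (Fin m → Tm n) → Fin (suc m) → Tm (suc n)
  liftSub s zero    = ident zero
  liftSub s (suc x) = weaken (s x)

  subst : ∀ {m n} → (Fin m → Tm n) → Tm m → Tm n
  subst s (num k)        = num k
  subst s (op o M N)     = op o (subst s M) (subst s N)
  subst s skip           = skip
  subst s (seq M N)      = seq (subst s M) (subst s N)
  subst s (assign M N)   = assign (subst s M) (subst s N)
  subst s (deref M)      = deref (subst s M)
  subst s (while M N)    = while (subst s M) (subst s N)
  subst s (ifzero M N P) = ifzero (subst s M) (subst s N) (subst s P)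
  subst s (ident x)      = s x
  subst s (lam A M)      = lam A (subst (liftSub s) M)
  subst s (app M N)      = app (subst s M) (subst s N)
  subst s (new M)        = new (subst (liftSub s) M)
  subst s (mkvar M N)    = mkvar (subst s M) (subst s N)

  instantiate : ∀ {n} → Tm n → Fin (suc n) → Tm n
  instantiate N zero    = N
  instantiate N (suc x) = ident x

  _[_/0] : ∀ {n} → Tm (suc n) → Tm n → Tm n
  M [ N /0] = subst (instantiate N) M

  infix 4 _⊢[_]_∶_

  -- Contexts grow on the left, index zero being the most recent identifier.
  -- In the application rule _↑ˡ_ and _↑ʳ_ place the identifiers of the two
  -- premises in disjoint parts of the concatenated context.
  data _⊢[_]_∶_ : ∀ {n} → Vec Ty n → Lang → Tm n → Ty → Set where

    ⊢ident : ∀ {L A} → A ∷ [] ⊢[ L ] ident zero ∶ A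

    ⊢lam : ∀ {L n A B} {Γ : Vec Ty n} {M} →
      A ∷ Γ ⊢[ L ] M ∶ B →
      Γ ⊢[ L ] lam A M ∶ A ⊸ B

    ⊢app : ∀ {L m n A B} {Γ : Vec Ty m} {Δ : Vec Ty n} {M N} →
      Γ ⊢[ L ] M ∶ A ⊸ B →
      Δ ⊢[ L ] N ∶ A →
      Γ ++ Δ ⊢[ L ] app (rename (_↑ˡ n) M) (rename (m ↑ʳ_) N) ∶ B

    ⊢weakening : ∀ {L n A B} {Γ : Vec Ty n} {M} →
      Γ ⊢[ L ] M ∶ B →
      A ∷ Γ ⊢[ L ] weaken M ∶ B

    ⊢exchange : ∀ {L n B} {Γ Γ′ : Vec Ty n} {M} (π : Permutation′ n) →
      (∀ x → lookup Γ′ (π ⟨$⟩ʳ x) ≡ lookup Γ x) →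
      Γ ⊢[ L ] M ∶ B →
      Γ′ ⊢[ L ] rename (π ⟨$⟩ʳ_) M ∶ B

    ⊢num : ∀ {L k} → [] ⊢[ L ] num k ∶ nat

    ⊢skip : ∀ {L} → [] ⊢[ L ] skip ∶ comm

    ⊢op : ∀ {L n o} {Γ : Vec Ty n} {M N} →
      Γ ⊢[ L ] M ∶ nat →
      Γ ⊢[ L ] N ∶ nat →
      Γ ⊢[ L ] op o M N ∶ nat

    ⊢seq : ∀ {L n B} {Γ : Vec Ty n} {M N} → Base B →
      Γ ⊢[ L ] M ∶ comm →
      Γ ⊢[ L ] N ∶ B →
      Γ ⊢[ L ] seq M N ∶ B

    ⊢assign : ∀ {L n} {Γ : Vec Ty n} {M N} →
      Γ ⊢[ L ] M ∶ var →
      Γ ⊢[ L ] N ∶ nat →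
      Γ ⊢[ L ] assign M N ∶ comm

    ⊢deref : ∀ {L n} {Γ : Vec Ty n} {M} →
      Γ ⊢[ L ] M ∶ var →
      Γ ⊢[ L ] deref M ∶ nat

    ⊢while : ∀ {L n} {Γ : Vec Ty n} {M N} →
      Γ ⊢[ L ] M ∶ nat →
      Γ ⊢[ L ] N ∶ comm →
      Γ ⊢[ L ] while M N ∶ comm

    ⊢ifzero : ∀ {L n B} {Γ : Vec Ty n} {M N₁ N₂} → Base B →
      Γ ⊢[ L ] M ∶ nat →
      Γ ⊢[ L ] N₁ ∶ B →
      Γ ⊢[ L ] N₂ ∶ B →
      Γ ⊢[ L ] ifzero M N₁ N₂ ∶ B

    ⊢new : ∀ {L n B} {Γ : Vec Ty n} {M} → Ground B →
      var ∷ Γ ⊢[ L ] M ∶ B →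
      Γ ⊢[ L ] new M ∶ B

    ⊢mkvar : ∀ {n} {Γ : Vec Ty n} {M N} →
      Γ ⊢[ SCImk ] M ∶ nat ⊸ comm →
      Γ ⊢[ SCImk ] N ∶ nat →
      Γ ⊢[ SCImk ] mkvar M N ∶ var

  data Value {n : ℕ} : Tm n → Set where
    num   : ∀ {k} → Value (num k)
    skip  : Value skip
    ident : ∀ {x} → Value (ident x)
    lam   : ∀ {A M} → Value (lam A M)
    mkvar : ∀ {M N} → Value (mkvar M N)

  Store : ℕ → Set
  Store n = Vec ℕ n

  infix 4 _∣_⇓_∣_

  -- One evaluation relation serves both languages: the mkvar rules apply only
  -- when a mkvar is reached, which does not happen from a term typed in SCI.
  data _∣_⇓_∣_ : ∀ {n} → Store n → Tm n → Store n → Tm n → Set where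

    ⇓value : ∀ {n} {σ : Store n} {V} → Value V → σ ∣ V ⇓ σ ∣ V

    ⇓app : ∀ {n} {σ σ′ σ″ : Store n} {A M M′ N V} →
      σ ∣ M ⇓ σ′ ∣ lam A M′ →
      σ′ ∣ M′ [ N /0] ⇓ σ″ ∣ V →
      σ ∣ app M N ⇓ σ″ ∣ V

    ⇓op : ∀ {n} {σ σ′ σ″ : Store n} {o M₁ M₂ k₁ k₂} →
      σ ∣ M₁ ⇓ σ′ ∣ num k₁ →
      σ′ ∣ M₂ ⇓ σ″ ∣ num k₂ →
      σ ∣ op o M₁ M₂ ⇓ σ″ ∣ num (⟦ o ⟧ k₁ k₂)

    ⇓assign : ∀ {n} {σ σ′ σ″ : Store n} {M N k x} →
      σ ∣ N ⇓ σ′ ∣ num k →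
      σ′ ∣ M ⇓ σ″ ∣ ident x →
      σ ∣ assign M N ⇓ σ″ [ x ]≔ k ∣ skip

    ⇓deref : ∀ {n} {σ σ′ : Store n} {M x} →
      σ ∣ M ⇓ σ′ ∣ ident x →
      σ ∣ deref M ⇓ σ′ ∣ num (lookup σ′ x)

    ⇓seq : ∀ {n} {σ σ′ σ″ : Store n} {M N V} →
      σ ∣ M ⇓ σ′ ∣ skip →
      σ′ ∣ N ⇓ σ″ ∣ V →
      σ ∣ seq M N ⇓ σ″ ∣ V

    ⇓while-exit : ∀ {n} {σ σ′ : Store n} {M N k} →
      σ ∣ M ⇓ σ′ ∣ num (suc k) →
      σ ∣ while M N ⇓ σ′ ∣ skip

    ⇓while-loop : ∀ {n} {σ σ′ σ″ σ‴ : Store n} {M N} →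
      σ ∣ M ⇓ σ′ ∣ num zero →
      σ′ ∣ N ⇓ σ″ ∣ skip →
      σ″ ∣ while M N ⇓ σ‴ ∣ skip →
      σ ∣ while M N ⇓ σ‴ ∣ skip

    ⇓ifzero-zero : ∀ {n} {σ σ′ σ″ : Store n} {M N₁ N₂ V} →
      σ ∣ M ⇓ σ′ ∣ num zero →
      σ′ ∣ N₁ ⇓ σ″ ∣ V →
      σ ∣ ifzero M N₁ N₂ ⇓ σ″ ∣ V

    ⇓ifzero-suc : ∀ {n} {σ σ′ σ″ : Store n} {M N₁ N₂ k V} →
      σ ∣ M ⇓ σ′ ∣ num (suc k) →
      σ′ ∣ N₂ ⇓ σ″ ∣ V →
      σ ∣ ifzero M N₁ N₂ ⇓ σ″ ∣ V

    -- weaken V: the result does not mention the deallocated identifier.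
    ⇓new : ∀ {n} {σ σ′ : Store n} {M k V} →
      0 ∷ σ ∣ M ⇓ k ∷ σ′ ∣ weaken V →
      σ ∣ new M ⇓ σ′ ∣ V

    ⇓assign-mkvar : ∀ {n} {σ σ′ σ″ σ‴ : Store n} {M N M₁ M₂ k V} →
      σ ∣ N ⇓ σ′ ∣ num k →
      σ′ ∣ M ⇓ σ″ ∣ mkvar M₁ M₂ →
      σ″ ∣ app M₁ (num k) ⇓ σ‴ ∣ V →
      σ ∣ assign M N ⇓ σ‴ ∣ V

    ⇓deref-mkvar : ∀ {n} {σ σ′ σ″ : Store n} {M M₁ M₂ V} →
      σ ∣ M ⇓ σ′ ∣ mkvar M₁ M₂ →
      σ′ ∣ M₂ ⇓ σ″ ∣ V →
      σ ∣ deref M ⇓ σ″ ∣ V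

  _⇓_ : Tm 0 → Tm 0 → Set
  M ⇓ V = [] ∣ M ⇓ [] ∣ V

  -- Ctx n k: one-hole contexts C[-] with identifiers among Fin k, whose hole
  -- receives terms with identifiers among Fin n. In named syntax capture is by
  -- coincidence of names; here the hole records, injectively, which of the
  -- identifiers in scope at the hole each of the n identifiers denotes.
  data Ctx (n : ℕ) : ℕ → Set where
    hole    : ∀ {k} → Fin n ↣ Fin k → Ctx n k
    op₁     : ∀ {k} → Op → Ctx n k → Tm k → Ctx n k
    op₂     : ∀ {k} → Op → Tm k → Ctx n k → Ctx n k
    seq₁    : ∀ {k} → Ctx n k → Tm k → Ctx n k
    seq₂    : ∀ {k} → Tm k → Ctx n k → Ctx n k
    assign₁ : ∀ {k} → Ctx n k → Tm k → Ctx n k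
    assign₂ : ∀ {k} → Tm k → Ctx n k → Ctx n k
    deref₁  : ∀ {k} → Ctx n k → Ctx n k
    while₁  : ∀ {k} → Ctx n k → Tm k → Ctx n k
    while₂  : ∀ {k} → Tm k → Ctx n k → Ctx n k
    ifzero₁ : ∀ {k} → Ctx n k → Tm k → Tm k → Ctx n k
    ifzero₂ : ∀ {k} → Tm k → Ctx n k → Tm k → Ctx n k
    ifzero₃ : ∀ {k} → Tm k → Tm k → Ctx n k → Ctx n k
    lam₁    : ∀ {k} → Ty → Ctx n (suc k) → Ctx n k
    app₁    : ∀ {k} → Ctx n k → Tm k → Ctx n k
    app₂    : ∀ {k} → Tm k → Ctx n k → Ctx n k
    new₁    : ∀ {k} → Ctx n (suc k) → Ctx n k
    mkvar₁  : ∀ {k} → Ctx n k → Tm k → Ctx n k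
    mkvar₂  : ∀ {k} → Tm k → Ctx n k → Ctx n k

  infix 8 _⟨_⟩

  _⟨_⟩ : ∀ {n k} → Ctx n k → Tm n → Tm k
  hole ρ ⟨ M ⟩        = rename (Injection.to ρ) M
  op₁ o C N ⟨ M ⟩     = op o (C ⟨ M ⟩) N
  op₂ o N C ⟨ M ⟩     = op o N (C ⟨ M ⟩)
  seq₁ C N ⟨ M ⟩      = seq (C ⟨ M ⟩) N
  seq₂ N C ⟨ M ⟩      = seq N (C ⟨ M ⟩)
  assign₁ C N ⟨ M ⟩   = assign (C ⟨ M ⟩) N
  assign₂ N C ⟨ M ⟩   = assign N (C ⟨ M ⟩)
  deref₁ C ⟨ M ⟩      = deref (C ⟨ M ⟩)
  while₁ C N ⟨ M ⟩    = while (C ⟨ M ⟩) N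
  while₂ N C ⟨ M ⟩    = while N (C ⟨ M ⟩)
  ifzero₁ C N P ⟨ M ⟩ = ifzero (C ⟨ M ⟩) N P
  ifzero₂ N C P ⟨ M ⟩ = ifzero N (C ⟨ M ⟩) P
  ifzero₃ N P C ⟨ M ⟩ = ifzero N P (C ⟨ M ⟩)
  lam₁ A C ⟨ M ⟩      = lam A (C ⟨ M ⟩)
  app₁ C N ⟨ M ⟩      = app (C ⟨ M ⟩) N
  app₂ N C ⟨ M ⟩      = app N (C ⟨ M ⟩)
  new₁ C ⟨ M ⟩        = new (C ⟨ M ⟩)
  mkvar₁ C N ⟨ M ⟩    = mkvar (C ⟨ M ⟩) N
  mkvar₂ N C ⟨ M ⟩    = mkvar N (C ⟨ M ⟩)

  -- That C is a context of L is enforced by C ⟨ M ⟩ being typable in L.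
  ContextuallyEquivalent : Lang → ∀ {n} → Tm n → Tm n → Set
  ContextuallyEquivalent L {n} M N =
    ∀ (C : Ctx n 0) {B} → Ground B →
    [] ⊢[ L ] C ⟨ M ⟩ ∶ B →
    [] ⊢[ L ] C ⟨ N ⟩ ∶ B →
    ∀ {V} → Value V → [] ⊢[ L ] V ∶ B →
    C ⟨ M ⟩ ⇓ V ⇔ C ⟨ N ⟩ ⇓ V

  infix 4 _≅_ _≅mk_
  infix 5 _⇓_

  _≅_ : ∀ {n} → Tm n → Tm n → Set
  _≅_ = ContextuallyEquivalent SCI

  _≅mk_ : ∀ {n} → Tm n → Tm n → Set
  _≅mk_ = ContextuallyEquivalent SCImk

{-# OPTIONS --safe #-}
-- The mkvar nodes of a context are eliminated one at a time. An SCI term of type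
-- var with side effects can do what mkvar P Q does, except that when evaluated it
-- cannot know whether it is about to be read or written. The accesses made in one
-- given run of C⟨M⟩ form a finite list, so mkvar P Q is replaced by a term that
-- follows this list: it runs P or Q as predicted, returns a cell z, and checks the
-- content of z before the next access. To predict a read it puts the value of Q in
-- z and expects to find it there again; to predict a write of k it puts suc k in z
-- and expects to find k. The only deviation of C⟨N⟩ that passes these checks is to
-- write into z, where a read is predicted, the very value that z holds. But then
-- C⟨N⟩ also passes if z holds another value and the old one is expected, and
-- C⟨M⟩, which does read z there, does not.
module Submission where

open import Defs
open import Data.Bool.Base using (Bool; true; false; not; _∧_)
open import Data.Empty using (⊥)
open import Data.Fin.Base using (Fin; zero; suc; lift; splitAt; _↑ˡ_; _↑ʳ_)
open import Data.Fin.Permutation using (Permutation; _⟨$⟩ʳ_; _⟨$⟩ˡ_; inverseˡ; ↔⇒≡; transpose)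
open import Data.Fin.Properties as Fin using (splitAt-↑ˡ; splitAt-↑ʳ; +↔⊎)
open import Data.List.Base using (List; []; _∷_; drop)
open import Data.Maybe.Base as Maybe using (Maybe; just; nothing)
open import Data.Nat.Base using (ℕ; zero; suc; _+_; _∸_)
open import Data.Nat.Properties
  using (m∸n≡0⇒m≤n; ≤-antisym; n∸n≡0; +-identityʳ; suc-injective; +-cancelʳ-≡; m+n≡0⇒m≡0; m+n≡0⇒n≡0)
open import Data.Nat.Tactic.RingSolver using (solve-∀)
open import Data.Product.Base using (Σ; ∃-syntax; _×_; _,_; proj₁; proj₂)
open import Data.Sum.Base as Sum using (_⊎_; inj₁; inj₂; [_,_]′)
open import Data.Unit.Base using (⊤; tt)
open import Data.Vec.Base using (Vec; []; _∷_; _++_; lookup; tabulate; _[_]≔_)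
open import Data.Vec.Properties
  using (lookup∘update; lookup∘update′; lookup-++ˡ; lookup-++ʳ; lookup∘tabulate)
open import Function.Base using (_∘_)
open import Function.Bundles
  using (_⇔_; mk⇔; module Equivalence; _↣_; mk↣; module Injection; _↔_; mk↔ₛ′; module Inverse)
open import Function.Construct.Composition using (_↣-∘_; _↔-∘_)
open import Function.Construct.Symmetry using (⇔-sym)
open import Relation.Binary.PropositionalEquality
  using (_≡_; _≢_; refl; sym; trans; cong; cong₂) renaming (subst to transport; subst₂ to transport₂)
open import Relation.Nullary.Decidable.Core using (yes; no)

-- Two features of the language shape the gadget. Application is affine, so two gadgets on the same
-- cells could not stand in a function and in its argument: hence one node per round, three new
-- cells in each round, and an induction on the number of `mkvar` in `C ⟨ M ⟩`. Contexts have a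
-- single hole, which may lie inside `P` or inside `Q`, so each of the two occurs exactly once in
-- the gadget; this also makes the number of `mkvar` drop by one.
--
-- A third kind of term mediates between `mkvar` and gadget: the marked term, whose runs consume
-- predictions. Terms with an actual `mkvar` correspond to its honest runs, terms with a gadget to
-- its cheating runs. One relation `Sim` covers both cases, and each case is needed in both
-- directions: honest runs are extracted from evaluations and turned back into them, cheating runs
-- are read off evaluations of instrumented terms and realised by them. All that remains is
-- combinatorics of prediction lists: which runs survive when a single entry is raised by one.

-- The operation `nothing` has no meaning of its own: its applications are the
-- marked mkvar nodes.
withMarks : Operations → Operations
withMarks 𝒪 = record
  { Op      = Maybe Op
  ; ⟦_⟧     = Maybe.maybe′ ⟦_⟧ _+_
  ; plus    = just plus
  ; minus   = just minus
  ; ⟦plus⟧  = ⟦plus⟧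
  ; ⟦minus⟧ = ⟦minus⟧
  }
  where open Operations 𝒪

-- Functoriality of renaming

module Renaming-Laws (𝒪 : Operations) where
  open Language 𝒪

  lift-id : ∀ {n} {f : Fin n → Fin n} → (∀ x → f x ≡ x) → ∀ x → lift 1 f x ≡ x
  lift-id f≗id zero    = refl
  lift-id f≗id (suc x) = cong suc (f≗id x)

  lift-∘ : ∀ {l m n} {f : Fin m → Fin n} {g : Fin l → Fin m} {h : Fin l → Fin n} →
    (∀ x → f (g x) ≡ h x) → ∀ x → lift 1 f (lift 1 g x) ≡ lift 1 h x
  lift-∘ f∘g≗h zero    = refl
  lift-∘ f∘g≗h (suc x) = cong suc (f∘g≗h x)

  rename-id : ∀ {n} {f : Fin n → Fin n} → (∀ x → f x ≡ x) → ∀ t → rename f t ≡ t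
  rename-id i (num k)        = refl
  rename-id i (op o M N)     = cong₂ (op o) (rename-id i M) (rename-id i N)
  rename-id i skip           = refl
  rename-id i (seq M N)      = cong₂ seq (rename-id i M) (rename-id i N)
  rename-id i (assign M N)   = cong₂ assign (rename-id i M) (rename-id i N)
  rename-id i (deref M)      = cong deref (rename-id i M)
  rename-id i (while M N)    = cong₂ while (rename-id i M) (rename-id i N)
  rename-id i (ifzero M N P)
    = cong₂ (λ F → F) (cong₂ ifzero (rename-id i M) (rename-id i N)) (rename-id i P)
  rename-id i (ident x)      = cong ident (i x)
  rename-id i (lam A M)      = cong (lam A) (rename-id (lift-id i) M)
  rename-id i (app M N)      = cong₂ app (rename-id i M) (rename-id i N)
  rename-id i (new M)        = cong new (rename-id (lift-id i) M)
  rename-id i (mkvar M N)    = cong₂ mkvar (rename-id i M) (rename-id i N)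

  rename-∘ : ∀ {l m n} {f : Fin m → Fin n} {g : Fin l → Fin m} {h : Fin l → Fin n} →
    (∀ x → f (g x) ≡ h x) → ∀ t → rename f (rename g t) ≡ rename h t
  rename-∘ i (num k)        = refl
  rename-∘ i (op o M N)     = cong₂ (op o) (rename-∘ i M) (rename-∘ i N)
  rename-∘ i skip           = refl
  rename-∘ i (seq M N)      = cong₂ seq (rename-∘ i M) (rename-∘ i N)
  rename-∘ i (assign M N)   = cong₂ assign (rename-∘ i M) (rename-∘ i N)
  rename-∘ i (deref M)      = cong deref (rename-∘ i M)
  rename-∘ i (while M N)    = cong₂ while (rename-∘ i M) (rename-∘ i N)
  rename-∘ i (ifzero M N P)
    = cong₂ (λ F → F) (cong₂ ifzero (rename-∘ i M) (rename-∘ i N)) (rename-∘ i P)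
  rename-∘ i (ident x)      = cong ident (i x)
  rename-∘ i (lam A M)      = cong (lam A) (rename-∘ (lift-∘ i) M)
  rename-∘ i (app M N)      = cong₂ app (rename-∘ i M) (rename-∘ i N)
  rename-∘ i (new M)        = cong new (rename-∘ (lift-∘ i) M)
  rename-∘ i (mkvar M N)    = cong₂ mkvar (rename-∘ i M) (rename-∘ i N)

module Conservativity (𝒪 : Operations) where
  open Operations 𝒪
  open Language 𝒪
  open Language (withMarks 𝒪)
    using ()
    renaming ( Tm to Tm⁺; Value to Value⁺; rename to rename⁺; subst to subst⁺
             ; liftSub to liftSub⁺; instantiate to instantiate⁺; _[_/0] to _[_/0]⁺
             ; num to num⁺; op to op⁺; skip to skip⁺; seq to seq⁺; assign to assign⁺; deref to deref⁺
             ; while to while⁺; ifzero to ifzero⁺; ident to ident⁺; lam to lam⁺; app to app⁺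
             ; new to new⁺; mkvar to mkvar⁺ )
  open Renaming-Laws 𝒪
  open Renaming-Laws (withMarks 𝒪) using () renaming (rename-id to rename-id⁺)

  -- Runs of marked terms and altered predictions

  pattern marked P Q = op⁺ nothing P Q

  -- Evaluation of a marked term that consumes a list of predictions, one for
  -- the start of each access to a marked mkvar (0: a read, suc k: a write of k)
  -- and one, normally 0, for the end of each access predicted to be a read. An
  -- access predicted to be a read may also be a write of the value that a read
  -- would have returned (⇓cheat), whatever the second prediction is.
  data Run (cheating : Bool) : ∀ {n} →
    List ℕ → Store n → Tm⁺ n → List ℕ → Store n → Tm⁺ n → Set where

    ⇓value : ∀ {n o} {σ : Store n} {V} → Value⁺ V → Run cheating o σ V o σ V

    ⇓marked : ∀ {n o} {σ : Store n} {P Q} →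
      Run cheating o σ (marked P Q) o σ (marked P Q)

    ⇓app : ∀ {n o o′ o″} {σ σ′ σ″ : Store n} {A M M′ N V} →
      Run cheating o σ M o′ σ′ (lam⁺ A M′) →
      Run cheating o′ σ′ (M′ [ N /0]⁺) o″ σ″ V →
      Run cheating o σ (app⁺ M N) o″ σ″ V

    ⇓op : ∀ {n o o′ o″} {σ σ′ σ″ : Store n} {⊙ M₁ M₂ k₁ k₂} →
      Run cheating o σ M₁ o′ σ′ (num⁺ k₁) →
      Run cheating o′ σ′ M₂ o″ σ″ (num⁺ k₂) →
      Run cheating o σ (op⁺ (just ⊙) M₁ M₂) o″ σ″ (num⁺ (⟦ ⊙ ⟧ k₁ k₂))

    ⇓assign : ∀ {n o o′ o″} {σ σ′ σ″ : Store n} {M N k x} →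
      Run cheating o σ N o′ σ′ (num⁺ k) →
      Run cheating o′ σ′ M o″ σ″ (ident⁺ x) →
      Run cheating o σ (assign⁺ M N) o″ (σ″ [ x ]≔ k) skip⁺

    ⇓deref : ∀ {n o o′} {σ σ′ : Store n} {M x} →
      Run cheating o σ M o′ σ′ (ident⁺ x) →
      Run cheating o σ (deref⁺ M) o′ σ′ (num⁺ (lookup σ′ x))

    ⇓seq : ∀ {n o o′ o″} {σ σ′ σ″ : Store n} {M N V} →
      Run cheating o σ M o′ σ′ skip⁺ →
      Run cheating o′ σ′ N o″ σ″ V →
      Run cheating o σ (seq⁺ M N) o″ σ″ V

    ⇓while-exit : ∀ {n o o′} {σ σ′ : Store n} {M N k} →
      Run cheating o σ M o′ σ′ (num⁺ (suc k)) →
      Run cheating o σ (while⁺ M N) o′ σ′ skip⁺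

    ⇓while-loop : ∀ {n o o′ o″ o‴} {σ σ′ σ″ σ‴ : Store n} {M N} →
      Run cheating o σ M o′ σ′ (num⁺ zero) →
      Run cheating o′ σ′ N o″ σ″ skip⁺ →
      Run cheating o″ σ″ (while⁺ M N) o‴ σ‴ skip⁺ →
      Run cheating o σ (while⁺ M N) o‴ σ‴ skip⁺

    ⇓ifzero-zero : ∀ {n o o′ o″} {σ σ′ σ″ : Store n} {M N₁ N₂ V} →
      Run cheating o σ M o′ σ′ (num⁺ zero) →
      Run cheating o′ σ′ N₁ o″ σ″ V →
      Run cheating o σ (ifzero⁺ M N₁ N₂) o″ σ″ V

    ⇓ifzero-suc : ∀ {n o o′ o″} {σ σ′ σ″ : Store n} {M N₁ N₂ k V} →
      Run cheating o σ M o′ σ′ (num⁺ (suc k)) →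
      Run cheating o′ σ′ N₂ o″ σ″ V →
      Run cheating o σ (ifzero⁺ M N₁ N₂) o″ σ″ V

    -- `new` has ground type, so its result is a numeral or `skip`; a rule for each replaces the
    -- weakened result of the original rule.
    ⇓new-num : ∀ {n o o′} {σ σ′ : Store n} {M k j} →
      Run cheating o (0 ∷ σ) M o′ (k ∷ σ′) (num⁺ j) →
      Run cheating o σ (new⁺ M) o′ σ′ (num⁺ j)

    ⇓new-skip : ∀ {n o o′} {σ σ′ : Store n} {M k} →
      Run cheating o (0 ∷ σ) M o′ (k ∷ σ′) skip⁺ →
      Run cheating o σ (new⁺ M) o′ σ′ skip⁺

    ⇓assign-mkvar : ∀ {n o o′ o″ o‴} {σ σ′ σ″ σ‴ : Store n} {M N M₁ M₂ k V} →
      Run cheating o σ N o′ σ′ (num⁺ k) →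
      Run cheating o′ σ′ M o″ σ″ (mkvar⁺ M₁ M₂) →
      Run cheating o″ σ″ (app⁺ M₁ (num⁺ k)) o‴ σ‴ V →
      Run cheating o σ (assign⁺ M N) o‴ σ‴ V

    ⇓deref-mkvar : ∀ {n o o′ o″} {σ σ′ σ″ : Store n} {M M₁ M₂ V} →
      Run cheating o σ M o′ σ′ (mkvar⁺ M₁ M₂) →
      Run cheating o′ σ′ M₂ o″ σ″ V →
      Run cheating o σ (deref⁺ M) o″ σ″ V

    ⇓read : ∀ {n o o′ o″} {σ σ′ σ″ : Store n} {M P Q k} →
      Run cheating o σ M (0 ∷ o′) σ′ (marked P Q) →
      Run cheating o′ σ′ Q (0 ∷ o″) σ″ (num⁺ k) →
      Run cheating o σ (deref⁺ M) o″ σ″ (num⁺ k)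

    ⇓write : ∀ {n o o′ o″ o‴} {σ σ′ σ″ σ‴ : Store n} {M N P Q k} →
      Run cheating o σ N o′ σ′ (num⁺ k) →
      Run cheating o′ σ′ M (suc k ∷ o″) σ″ (marked P Q) →
      Run cheating o″ σ″ (app⁺ P (num⁺ k)) o‴ σ‴ skip⁺ →
      Run cheating o σ (assign⁺ M N) o‴ σ‴ skip⁺

    ⇓cheat : ∀ {n o o′ o″ c o‴} {σ σ′ σ″ σ‴ : Store n} {M N P Q k} →
      cheating ≡ true →
      Run cheating o σ N o′ σ′ (num⁺ k) →
      Run cheating o′ σ′ M (0 ∷ o″) σ″ (marked P Q) →
      Run cheating o″ σ″ Q (c ∷ o‴) σ‴ (num⁺ k) →
      Run cheating o σ (assign⁺ M N) o‴ σ‴ skip⁺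

  -- Entries are raised, never lowered: a prediction of a write thus never becomes 0, which would
  -- allow the write to be replayed as a cheat on a predicted read.
  data Altered : List ℕ → List ℕ → Set where
    here  : ∀ {c o} → Altered (c ∷ o) (suc c ∷ o)
    there : ∀ {c o o′} → Altered o o′ → Altered (c ∷ o) (c ∷ o′)

  -- A run does not inspect the predictions that it leaves over. The change is pushed backwards
  -- through the subderivations, the last one first, and every prediction consumed on the way is put
  -- back in front with `there`.
  reroute : ∀ {n o o′ o″} {σ σ′ : Store n} {t V} →
    Run true o σ t o′ σ′ V → Altered o′ o″ →
    ∃[ o* ] Altered o o* × Run true o* σ t o″ σ′ V
  reroute (⇓value v) a = _ , a , ⇓value v
  reroute ⇓marked a = _ , a , ⇓marked
  reroute (⇓app d e) a with _ , a , e ← reroute e a with _ , a , d ← reroute d a = _ , a , ⇓app d e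
  reroute (⇓op d e) a with _ , a , e ← reroute e a with _ , a , d ← reroute d a = _ , a , ⇓op d e
  reroute (⇓assign d e) a with _ , a , e ← reroute e a
    with _ , a , d ← reroute d a = _ , a , ⇓assign d e
  reroute (⇓deref d) a with _ , a , d ← reroute d a = _ , a , ⇓deref d
  reroute (⇓seq d e) a with _ , a , e ← reroute e a with _ , a , d ← reroute d a = _ , a , ⇓seq d e
  reroute (⇓while-exit d) a with _ , a , d ← reroute d a = _ , a , ⇓while-exit d
  reroute (⇓while-loop d e f) a
    with _ , a , f ← reroute f a with _ , a , e ← reroute e a
      with _ , a , d ← reroute d a = _ , a , ⇓while-loop d e f
  reroute (⇓ifzero-zero d e) a with _ , a , e ← reroute e a
    with _ , a , d ← reroute d a = _ , a , ⇓ifzero-zero d e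
  reroute (⇓ifzero-suc d e) a with _ , a , e ← reroute e a
    with _ , a , d ← reroute d a = _ , a , ⇓ifzero-suc d e
  reroute (⇓new-num d) a with _ , a , d ← reroute d a = _ , a , ⇓new-num d
  reroute (⇓new-skip d) a with _ , a , d ← reroute d a = _ , a , ⇓new-skip d
  reroute (⇓assign-mkvar d e f) a
    with _ , a , f ← reroute f a with _ , a , e ← reroute e a
      with _ , a , d ← reroute d a = _ , a , ⇓assign-mkvar d e f
  reroute (⇓deref-mkvar d e) a with _ , a , e ← reroute e a
    with _ , a , d ← reroute d a = _ , a , ⇓deref-mkvar d e
  reroute (⇓read d e) a
    with _ , a , e ← reroute e (there a) with _ , a , d ← reroute d (there a) = _ , a , ⇓read d e
  reroute (⇓write d e f) a
    with _ , a , f ← reroute f a with _ , a , e ← reroute e (there a)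
      with _ , a , d ← reroute d a = _ , a , ⇓write d e f
  reroute (⇓cheat c d e f) a
    with _ , a , f ← reroute f (there a) with _ , a , e ← reroute e (there a)
      with _ , a , d ← reroute d a
    = _ , a , ⇓cheat c d e f

  -- `⇓cheat` accepts any second prediction, so this entry can be raised, and `reroute` carries the
  -- change back through whatever ran before. A single cheat suffices: further ones may stay, since
  -- the altered run is again allowed to cheat.
  honest-or-altered : ∀ {n o o′} {σ σ′ : Store n} {t V} → Run true o σ t o′ σ′ V →
    Run false o σ t o′ σ′ V ⊎ ∃[ o* ] Altered o o* × Run true o* σ t o′ σ′ V
  honest-or-altered (⇓value v) = inj₁ (⇓value v)
  honest-or-altered ⇓marked = inj₁ ⇓marked
  honest-or-altered (⇓app d e) with honest-or-altered d | honest-or-altered e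
  ... | inj₂ (_ , a , d) | _ = inj₂ (_ , a , ⇓app d e)
  ... | inj₁ _ | inj₂ (_ , a , e) with _ , a , d ← reroute d a = inj₂ (_ , a , ⇓app d e)
  ... | inj₁ d | inj₁ e = inj₁ (⇓app d e)
  honest-or-altered (⇓op d e) with honest-or-altered d | honest-or-altered e
  ... | inj₂ (_ , a , d) | _ = inj₂ (_ , a , ⇓op d e)
  ... | inj₁ _ | inj₂ (_ , a , e) with _ , a , d ← reroute d a = inj₂ (_ , a , ⇓op d e)
  ... | inj₁ d | inj₁ e = inj₁ (⇓op d e)
  honest-or-altered (⇓assign d e) with honest-or-altered d | honest-or-altered e
  ... | inj₂ (_ , a , d) | _ = inj₂ (_ , a , ⇓assign d e)
  ... | inj₁ _ | inj₂ (_ , a , e) with _ , a , d ← reroute d a = inj₂ (_ , a , ⇓assign d e)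
  ... | inj₁ d | inj₁ e = inj₁ (⇓assign d e)
  honest-or-altered (⇓deref d) with honest-or-altered d
  ... | inj₂ (_ , a , d) = inj₂ (_ , a , ⇓deref d)
  ... | inj₁ d = inj₁ (⇓deref d)
  honest-or-altered (⇓seq d e) with honest-or-altered d | honest-or-altered e
  ... | inj₂ (_ , a , d) | _ = inj₂ (_ , a , ⇓seq d e)
  ... | inj₁ _ | inj₂ (_ , a , e) with _ , a , d ← reroute d a = inj₂ (_ , a , ⇓seq d e)
  ... | inj₁ d | inj₁ e = inj₁ (⇓seq d e)
  honest-or-altered (⇓while-exit d) with honest-or-altered d
  ... | inj₂ (_ , a , d) = inj₂ (_ , a , ⇓while-exit d)
  ... | inj₁ d = inj₁ (⇓while-exit d)
  honest-or-altered (⇓while-loop d e f)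
    with honest-or-altered d | honest-or-altered e | honest-or-altered f
  ... | inj₂ (_ , a , d) | _ | _ = inj₂ (_ , a , ⇓while-loop d e f)
  ... | inj₁ _ | inj₂ (_ , a , e) | _ with _ , a , d ← reroute d a = inj₂ (_ , a , ⇓while-loop d e f)
  ... | inj₁ _ | inj₁ _ | inj₂ (_ , a , f)
    with _ , a , e ← reroute e a with _ , a , d ← reroute d a = inj₂ (_ , a , ⇓while-loop d e f)
  ... | inj₁ d | inj₁ e | inj₁ f = inj₁ (⇓while-loop d e f)
  honest-or-altered (⇓ifzero-zero d e) with honest-or-altered d | honest-or-altered e
  ... | inj₂ (_ , a , d) | _ = inj₂ (_ , a , ⇓ifzero-zero d e)
  ... | inj₁ _ | inj₂ (_ , a , e) with _ , a , d ← reroute d a = inj₂ (_ , a , ⇓ifzero-zero d e)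
  ... | inj₁ d | inj₁ e = inj₁ (⇓ifzero-zero d e)
  honest-or-altered (⇓ifzero-suc d e) with honest-or-altered d | honest-or-altered e
  ... | inj₂ (_ , a , d) | _ = inj₂ (_ , a , ⇓ifzero-suc d e)
  ... | inj₁ _ | inj₂ (_ , a , e) with _ , a , d ← reroute d a = inj₂ (_ , a , ⇓ifzero-suc d e)
  ... | inj₁ d | inj₁ e = inj₁ (⇓ifzero-suc d e)
  honest-or-altered (⇓new-num d) with honest-or-altered d
  ... | inj₂ (_ , a , d) = inj₂ (_ , a , ⇓new-num d)
  ... | inj₁ d = inj₁ (⇓new-num d)
  honest-or-altered (⇓new-skip d) with honest-or-altered d
  ... | inj₂ (_ , a , d) = inj₂ (_ , a , ⇓new-skip d)
  ... | inj₁ d = inj₁ (⇓new-skip d)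
  honest-or-altered (⇓assign-mkvar d e f)
    with honest-or-altered d | honest-or-altered e | honest-or-altered f
  ... | inj₂ (_ , a , d) | _ | _ = inj₂ (_ , a , ⇓assign-mkvar d e f)
  ... | inj₁ _ | inj₂ (_ , a , e) | _ with _ , a , d ← reroute d a = inj₂ (_ , a , ⇓assign-mkvar d e f)
  ... | inj₁ _ | inj₁ _ | inj₂ (_ , a , f)
    with _ , a , e ← reroute e a with _ , a , d ← reroute d a = inj₂ (_ , a , ⇓assign-mkvar d e f)
  ... | inj₁ d | inj₁ e | inj₁ f = inj₁ (⇓assign-mkvar d e f)
  honest-or-altered (⇓deref-mkvar d e) with honest-or-altered d | honest-or-altered e
  ... | inj₂ (_ , a , d) | _ = inj₂ (_ , a , ⇓deref-mkvar d e)
  ... | inj₁ _ | inj₂ (_ , a , e) with _ , a , d ← reroute d a = inj₂ (_ , a , ⇓deref-mkvar d e)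
  ... | inj₁ d | inj₁ e = inj₁ (⇓deref-mkvar d e)
  honest-or-altered (⇓read d e) with honest-or-altered d | honest-or-altered e
  ... | inj₂ (_ , a , d) | _ = inj₂ (_ , a , ⇓read d e)
  ... | inj₁ _ | inj₂ (_ , a , e) with _ , a , d ← reroute d (there a) = inj₂ (_ , a , ⇓read d e)
  ... | inj₁ d | inj₁ e = inj₁ (⇓read d e)
  honest-or-altered (⇓write d e f) with honest-or-altered d | honest-or-altered e | honest-or-altered f
  ... | inj₂ (_ , a , d) | _ | _ = inj₂ (_ , a , ⇓write d e f)
  ... | inj₁ _ | inj₂ (_ , a , e) | _ with _ , a , d ← reroute d a = inj₂ (_ , a , ⇓write d e f)
  ... | inj₁ _ | inj₁ _ | inj₂ (_ , a , f)
    with _ , a , e ← reroute e (there a) with _ , a , d ← reroute d a = inj₂ (_ , a , ⇓write d e f)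
  ... | inj₁ d | inj₁ e | inj₁ f = inj₁ (⇓write d e f)
  honest-or-altered (⇓cheat c d e f)
    with _ , a , f ← reroute f here with _ , a , e ← reroute e (there a) with _ , a , d ← reroute d a
    = inj₂ (_ , a , ⇓cheat c d e f)

  -- An honest run cannot use an altered prediction: the change of a 0 turns the
  -- read it predicts into a write, and any other change turns a write into one
  -- of another value.
  honest-deterministic : ∀ {n c o₁ o₁′ o₂ o₂′} {σ σ₁ σ₂ : Store n} {t V₁ V₂} →
    Run false o₁ σ t o₁′ σ₁ V₁ → Run c o₂ σ t o₂′ σ₂ V₂ → Altered o₁ o₂ →
    Altered o₁′ o₂′ × σ₁ ≡ σ₂ × V₁ ≡ V₂
  honest-deterministic (⇓value v) (⇓value w) a = a , refl , refl
  honest-deterministic ⇓marked ⇓marked a = a , refl , refl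
  honest-deterministic (⇓app d e) (⇓app d′ e′) a
    with a , refl , refl ← honest-deterministic d d′ a = honest-deterministic e e′ a
  honest-deterministic (⇓op d e) (⇓op d′ e′) a
    with a , refl , refl ← honest-deterministic d d′ a
    with a , refl , refl ← honest-deterministic e e′ a = a , refl , refl
  honest-deterministic (⇓assign d e) (⇓assign d′ e′) a
    with a , refl , refl ← honest-deterministic d d′ a
    with a , refl , refl ← honest-deterministic e e′ a = a , refl , refl
  honest-deterministic (⇓assign d e) (⇓assign-mkvar d′ e′ f′) a
    with a , refl , refl ← honest-deterministic d d′ a
    with () ← honest-deterministic e e′ a .proj₂ .proj₂
  honest-deterministic (⇓assign d e) (⇓write d′ e′ f′) a
    with a , refl , refl ← honest-deterministic d d′ a
    with () ← honest-deterministic e e′ a .proj₂ .proj₂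
  honest-deterministic (⇓assign d e) (⇓cheat _ d′ e′ f′) a
    with a , refl , refl ← honest-deterministic d d′ a
    with () ← honest-deterministic e e′ a .proj₂ .proj₂
  honest-deterministic (⇓deref d) (⇓deref d′) a
    with a , refl , refl ← honest-deterministic d d′ a = a , refl , refl
  honest-deterministic (⇓deref d) (⇓deref-mkvar d′ e′) a
    with () ← honest-deterministic d d′ a .proj₂ .proj₂
  honest-deterministic (⇓deref d) (⇓read d′ e′) a
    with () ← honest-deterministic d d′ a .proj₂ .proj₂
  honest-deterministic (⇓seq d e) (⇓seq d′ e′) a
    with a , refl , refl ← honest-deterministic d d′ a = honest-deterministic e e′ a
  honest-deterministic (⇓while-exit d) (⇓while-exit d′) a
    with a , refl , refl ← honest-deterministic d d′ a = a , refl , refl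
  honest-deterministic (⇓while-exit d) (⇓while-loop d′ _ _) a
    with () ← honest-deterministic d d′ a .proj₂ .proj₂
  honest-deterministic (⇓while-loop d _ _) (⇓while-exit d′) a
    with () ← honest-deterministic d d′ a .proj₂ .proj₂
  honest-deterministic (⇓while-loop d e f) (⇓while-loop d′ e′ f′) a
    with a , refl , refl ← honest-deterministic d d′ a
    with a , refl , refl ← honest-deterministic e e′ a = honest-deterministic f f′ a
  honest-deterministic (⇓ifzero-zero d e) (⇓ifzero-zero d′ e′) a
    with a , refl , refl ← honest-deterministic d d′ a = honest-deterministic e e′ a
  honest-deterministic (⇓ifzero-zero d e) (⇓ifzero-suc d′ e′) a
    with () ← honest-deterministic d d′ a .proj₂ .proj₂
  honest-deterministic (⇓ifzero-suc d e) (⇓ifzero-zero d′ e′) a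
    with () ← honest-deterministic d d′ a .proj₂ .proj₂
  honest-deterministic (⇓ifzero-suc d e) (⇓ifzero-suc d′ e′) a
    with a , refl , refl ← honest-deterministic d d′ a = honest-deterministic e e′ a
  honest-deterministic (⇓new-num d) (⇓new-num d′) a
    with a , refl , refl ← honest-deterministic d d′ a = a , refl , refl
  honest-deterministic (⇓new-num d) (⇓new-skip d′) a
    with () ← honest-deterministic d d′ a .proj₂ .proj₂
  honest-deterministic (⇓new-skip d) (⇓new-num d′) a
    with () ← honest-deterministic d d′ a .proj₂ .proj₂
  honest-deterministic (⇓new-skip d) (⇓new-skip d′) a
    with a , refl , refl ← honest-deterministic d d′ a = a , refl , refl
  honest-deterministic (⇓assign-mkvar d e f) (⇓assign d′ e′) a
    with a , refl , refl ← honest-deterministic d d′ a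
    with () ← honest-deterministic e e′ a .proj₂ .proj₂
  honest-deterministic (⇓assign-mkvar d e f) (⇓assign-mkvar d′ e′ f′) a
    with a , refl , refl ← honest-deterministic d d′ a
    with a , refl , refl ← honest-deterministic e e′ a = honest-deterministic f f′ a
  honest-deterministic (⇓assign-mkvar d e f) (⇓write d′ e′ f′) a
    with a , refl , refl ← honest-deterministic d d′ a
    with () ← honest-deterministic e e′ a .proj₂ .proj₂
  honest-deterministic (⇓assign-mkvar d e f) (⇓cheat _ d′ e′ f′) a
    with a , refl , refl ← honest-deterministic d d′ a
    with () ← honest-deterministic e e′ a .proj₂ .proj₂
  honest-deterministic (⇓deref-mkvar d e) (⇓deref d′) a
    with () ← honest-deterministic d d′ a .proj₂ .proj₂
  honest-deterministic (⇓deref-mkvar d e) (⇓deref-mkvar d′ e′) a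
    with a , refl , refl ← honest-deterministic d d′ a = honest-deterministic e e′ a
  honest-deterministic (⇓deref-mkvar d e) (⇓read d′ e′) a
    with () ← honest-deterministic d d′ a .proj₂ .proj₂
  honest-deterministic (⇓read d e) (⇓deref d′) a
    with () ← honest-deterministic d d′ a .proj₂ .proj₂
  honest-deterministic (⇓read d e) (⇓deref-mkvar d′ e′) a
    with () ← honest-deterministic d d′ a .proj₂ .proj₂
  honest-deterministic (⇓read d e) (⇓read d′ e′) a
    with there a , refl , refl ← honest-deterministic d d′ a
    with there a , refl , refl ← honest-deterministic e e′ a = a , refl , refl
  honest-deterministic (⇓write d e f) (⇓assign d′ e′) a
    with a , refl , refl ← honest-deterministic d d′ a
    with () ← honest-deterministic e e′ a .proj₂ .proj₂
  honest-deterministic (⇓write d e f) (⇓assign-mkvar d′ e′ f′) a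
    with a , refl , refl ← honest-deterministic d d′ a
    with () ← honest-deterministic e e′ a .proj₂ .proj₂
  honest-deterministic (⇓write d e f) (⇓write d′ e′ f′) a
    with a , refl , refl ← honest-deterministic d d′ a
    -- Both runs write the same `k`, so both heads are `suc k`; `here` would make `suc k` its own
    -- successor.
    with there a , refl , refl ← honest-deterministic e e′ a = honest-deterministic f f′ a
  honest-deterministic (⇓write d e f) (⇓cheat _ d′ e′ f′) a
    with a , refl , refl ← honest-deterministic d d′ a
    with () ← honest-deterministic e e′ a .proj₁

  -- Gadgets and their simulation

  -- `counter` is a position in `predictions`; `expected` records what `content` must hold when the
  -- last access comes to be checked.
  record Device (n : ℕ) : Set where
    constructor device
    field
      predictions              : List ℕ
      counter content expected : Fin n

  open Device

  mapDevice : ∀ {m n} → (Fin m → Fin n) → Device m → Device n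
  mapDevice r (device os g z e) = device os (r g) (r z) (r e)

  !_ : ∀ {n} → Fin n → Tm n
  ! x = deref (ident x)

  -- One of the two truncated differences is 0, so their sum is the distance of the contents, and
  -- the result is 1 if they agree and 0 if not.
  gap : ∀ {n} → Fin n → Fin n → Tm n
  gap z e = op minus (num 1) (op plus (op minus (! z) (! e)) (op minus (! e) (! z)))

  -- while iterates as long as its guard is 0, here as long as z and e differ.
  check : ∀ {n} → Fin n → Fin n → Tm n
  check z e = while (gap z e) skip

  increment : ∀ {n} → Fin n → Tm n
  increment g = assign (ident g) (op plus (num 1) (! g))

  -- Past its end the table diverges, which rules out more accesses than were predicted; the final
  -- `num 0` only gives the loop the type `nat`.
  table : ∀ {n} → List ℕ → Tm n → Tm n
  table []       X = seq (while (num 0) skip) (num 0)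
  table (c ∷ os) X = ifzero X (num c) (table os (op minus X (num 1)))

  -- After arm, a read of z passes the next check only if C is 0, and a write
  -- passes it only if it is a write of the content of w.
  arm : ∀ {n} → Fin n → Fin n → Fin n → Tm n → Tm n
  arm w z e C = seq (check z e) (seq (assign (ident z) (op plus C (! w))) (assign (ident e) (! w)))

  -- The counter moves on before `Q` runs, because `Q` may itself access gadgets and consume
  -- predictions. The second prediction of this access is therefore looked up only after `Q`, and is
  -- passed by the last `increment`.
  readArm : ∀ {n} → Device n → Fin n → Tm n → Tm n
  readArm (device os g z e) w Q =
    seq (increment g) (seq (assign (ident w) Q) (seq (arm w z e (table os (! g))) (increment g)))

  -- Subtracting 1 decodes the prediction `suc k`. The value is copied into `w` since arguments are
  -- passed by name: an argument that consulted the table would be evaluated later, at a counter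
  -- that has moved. The 1 given to `arm` makes `z` differ from `e`, so a read is rejected.
  writeArm : ∀ {n} → Device n → Fin n → Tm n → Tm n
  writeArm (device os g z e) w P =
    seq (assign (ident w) (op minus (table os (! g)) (num 1)))
        (seq (increment g) (seq (app P (! w)) (arm w z e (num 1))))

  access : ∀ {n} → Device n → Fin n → Tm n → Tm n → Tm n
  access d w P Q = ifzero (table (d .predictions) (! d .counter)) (readArm d w Q) (writeArm d w P)

  -- The term that stands for mkvar P Q: being of type var, it cannot know
  -- whether it is about to be read or written and follows the predictions.
  gadget : ∀ {n} → Device n → Tm (suc n) → Tm (suc n) → Tm n
  gadget d P Q = seq (new (access (mapDevice suc d) zero P Q)) (ident (d .content))

  rename-table : ∀ {m n} (r : Fin m → Fin n) os X → rename r (table os X) ≡ table os (rename r X)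
  rename-table r []       X = refl
  rename-table r (c ∷ os) X = cong (ifzero _ _) (rename-table r os _)

  subst-table : ∀ {m n} (s : Fin m → Tm n) os X → subst s (table os X) ≡ table os (subst s X)
  subst-table s []       X = refl
  subst-table s (c ∷ os) X = cong (ifzero _ _) (subst-table s os _)

  rename-gadget : ∀ {m n} (r : Fin m → Fin n) d P Q →
    rename r (gadget d P Q) ≡ gadget (mapDevice r d) (rename (lift 1 r) P) (rename (lift 1 r) Q)
  rename-gadget r (device os g z e) P Q
    rewrite rename-table (lift 1 r) os (! suc g) = refl

  subst-gadget : ∀ {m n} (s : Fin m → Tm n) {os g z e g′ z′ e′} P Q →
    s g ≡ ident g′ → s z ≡ ident z′ → s e ≡ ident e′ →
    subst s (gadget (device os g z e) P Q) ≡
      gadget (device os g′ z′ e′) (subst (liftSub s) P) (subst (liftSub s) Q)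
  subst-gadget s {os} {g} P Q p q r
    rewrite subst-table (liftSub s) os (! suc g) | p | q | r = refl

  -- Worlds and the simulation relation

  -- `n` counts the identifiers of the marked term, `n′` those of the simulating one, which also has
  -- the cells of the device and the private cells of gadgets in progress. `Holds y k` declares `y`
  -- to be such a private cell, with content `k`.
  record World (n n′ : ℕ) : Set₁ where
    field
      embed    : Fin n → Fin n′
      Holds   : Fin n′ → ℕ → Set
      machine : Maybe (Device n′)

  open World

  extend : ∀ {n n′} → World n n′ → World (suc n) (suc n′)
  extend W .embed           = lift 1 (W .embed)
  extend W .Holds zero    k = ⊥
  extend W .Holds (suc y) k = W .Holds y k
  extend W .machine         = Maybe.map (mapDevice suc) (W .machine)

  allocate : ∀ {n n′} → ℕ → World n n′ → World n (suc n′)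
  allocate j W .embed x           = suc (W .embed x)
  allocate j W .Holds zero    k = j ≡ k
  allocate j W .Holds (suc y) k = W .Holds y k
  allocate j W .machine         = Maybe.map (mapDevice suc) (W .machine)

  -- Without a machine, a marked mkvar is simulated by an actual one.
  data Sim {n n′} (W : World n n′) (Γ : Vec Ty n) : Tm⁺ n → Tm n′ → Ty → Set where

    ~num : ∀ {k} → Sim W Γ (num⁺ k) (num k) nat

    -- The argument of `P` is a numeral in the marked run and `! w` in the gadget; being passed by
    -- name, it may be copied to any place in `P`.
    ~held : ∀ {y k} → W .Holds y k → Sim W Γ (num⁺ k) (! y) nat

    ~op : ∀ {o M M′ N N′} →
      Sim W Γ M M′ nat → Sim W Γ N N′ nat → Sim W Γ (op⁺ (just o) M N) (op o M′ N′) nat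

    ~skip : Sim W Γ skip⁺ skip comm

    ~seq : ∀ {M M′ N N′ B} →
      Sim W Γ M M′ comm → Sim W Γ N N′ B → Sim W Γ (seq⁺ M N) (seq M′ N′) B

    ~assign : ∀ {M M′ N N′} →
      Sim W Γ M M′ var → Sim W Γ N N′ nat → Sim W Γ (assign⁺ M N) (assign M′ N′) comm

    ~deref : ∀ {M M′} →
      Sim W Γ M M′ var → Sim W Γ (deref⁺ M) (deref M′) nat

    ~while : ∀ {M M′ N N′} →
      Sim W Γ M M′ nat → Sim W Γ N N′ comm → Sim W Γ (while⁺ M N) (while M′ N′) comm

    ~ifzero : ∀ {M M′ N₁ N₁′ N₂ N₂′ B} →
      Sim W Γ M M′ nat → Sim W Γ N₁ N₁′ B → Sim W Γ N₂ N₂′ B →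
      Sim W Γ (ifzero⁺ M N₁ N₂) (ifzero M′ N₁′ N₂′) B

    ~ident : ∀ {x A} →
      lookup Γ x ≡ A → Sim W Γ (ident⁺ x) (ident (W .embed x)) A

    ~lam : ∀ {A B M M′} →
      Sim (extend W) (A ∷ Γ) M M′ B → Sim W Γ (lam⁺ A M) (lam A M′) (A ⊸ B)

    ~app : ∀ {A B M M′ N N′} →
      Sim W Γ M M′ (A ⊸ B) → Sim W Γ N N′ A → Sim W Γ (app⁺ M N) (app M′ N′) B

    ~new : ∀ {B M M′} → Ground B →
      Sim (extend W) (var ∷ Γ) M M′ B → Sim W Γ (new⁺ M) (new M′) B

    ~mkvar : ∀ {P P′ Q Q′} →
      Sim W Γ P P′ (nat ⊸ comm) → Sim W Γ Q Q′ nat → Sim W Γ (mkvar⁺ P Q) (mkvar P′ Q′) var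

    ~erased : ∀ {P P′ Q Q′} → W .machine ≡ nothing →
      Sim W Γ P P′ (nat ⊸ comm) → Sim W Γ Q Q′ nat → Sim W Γ (marked P Q) (mkvar P′ Q′) var

    -- `P′` and `Q′` lie in the scope of the private cell, whose content is not known before the
    -- gadget runs, hence the quantification over `j`.
    ~gadget : ∀ {P P′ Q Q′ d} → W .machine ≡ just d →
      (∀ j → Sim (allocate j W) Γ P P′ (nat ⊸ comm)) → (∀ j → Sim (allocate j W) Γ Q Q′ nat) →
      Sim W Γ (marked P Q) (gadget d P′ Q′) var

  record Renaming {m m′ n n′} (W : World m m′) (W₁ : World n n′)
    (r : Fin m → Fin n) (r′ : Fin m′ → Fin n′) : Set where
    field
      commutes : ∀ x → W₁ .embed (r x) ≡ r′ (W .embed x)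
      holds    : ∀ {y k} → W .Holds y k → W₁ .Holds (r′ y) k
      machines : W₁ .machine ≡ Maybe.map (mapDevice r′) (W .machine)

  open Renaming

  map-shift : ∀ {m n} (r : Fin m → Fin n) D →
    Maybe.map (mapDevice suc) (Maybe.map (mapDevice r) D) ≡
      Maybe.map (mapDevice (lift 1 r)) (Maybe.map (mapDevice suc) D)
  map-shift r (just _) = refl
  map-shift r nothing  = refl

  extend-renaming : ∀ {m m′ n n′} {W : World m m′} {W₁ : World n n′} {r r′} →
    Renaming W W₁ r r′ → Renaming (extend W) (extend W₁) (lift 1 r) (lift 1 r′)
  extend-renaming R .commutes zero    = refl
  extend-renaming R .commutes (suc x) = cong suc (R .commutes x)
  extend-renaming R .holds {suc y} h  = R .holds h
  extend-renaming {W = W} {r′ = r′} R .machines =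
    trans (cong (Maybe.map _) (R .machines)) (map-shift r′ (W .machine))

  allocate-renaming : ∀ {m m′ n n′} {W : World m m′} {W₁ : World n n′} {r r′} j →
    Renaming W W₁ r r′ → Renaming (allocate j W) (allocate j W₁) r (lift 1 r′)
  allocate-renaming j R .commutes x        = cong suc (R .commutes x)
  allocate-renaming j R .holds {zero}  eq  = eq
  allocate-renaming j R .holds {suc y} h   = R .holds h
  allocate-renaming {W = W} {r′ = r′} j R .machines =
    trans (cong (Maybe.map _) (R .machines)) (map-shift r′ (W .machine))

  Sim-rename : ∀ {m m′ n n′} {W : World m m′} {W₁ : World n n′} {r r′ Γ Γ₁ t t′ A} →
    Renaming W W₁ r r′ → (∀ x → lookup Γ₁ (r x) ≡ lookup Γ x) →
    Sim W Γ t t′ A → Sim W₁ Γ₁ (rename⁺ r t) (rename r′ t′) A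
  Sim-rename R Γr ~num = ~num
  Sim-rename R Γr (~held h) = ~held (R .holds h)
  Sim-rename R Γr (~op p q) = ~op (Sim-rename R Γr p) (Sim-rename R Γr q)
  Sim-rename R Γr ~skip = ~skip
  Sim-rename R Γr (~seq p q) = ~seq (Sim-rename R Γr p) (Sim-rename R Γr q)
  Sim-rename R Γr (~assign p q) = ~assign (Sim-rename R Γr p) (Sim-rename R Γr q)
  Sim-rename R Γr (~deref p) = ~deref (Sim-rename R Γr p)
  Sim-rename R Γr (~while p q) = ~while (Sim-rename R Γr p) (Sim-rename R Γr q)
  Sim-rename R Γr (~ifzero p q s) = ~ifzero (Sim-rename R Γr p) (Sim-rename R Γr q) (Sim-rename R Γr s)
  Sim-rename {W₁ = W₁} {r} {Γ₁ = Γ₁} R Γr (~ident {x = x} refl) =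
    transport (λ y → Sim W₁ Γ₁ (ident⁺ (r x)) (ident y) _) (R .commutes x) (~ident (Γr x))
  Sim-rename R Γr (~lam p) =
    ~lam (Sim-rename (extend-renaming R) (λ { zero → refl ; (suc x) → Γr x }) p)
  Sim-rename R Γr (~app p q) = ~app (Sim-rename R Γr p) (Sim-rename R Γr q)
  Sim-rename R Γr (~new b p) =
    ~new b (Sim-rename (extend-renaming R) (λ { zero → refl ; (suc x) → Γr x }) p)
  Sim-rename R Γr (~mkvar p q) = ~mkvar (Sim-rename R Γr p) (Sim-rename R Γr q)
  Sim-rename R Γr (~erased eq p q) =
    ~erased (trans (R .machines) (cong (Maybe.map _) eq)) (Sim-rename R Γr p) (Sim-rename R Γr q)
  Sim-rename {W₁ = W₁} {r} {r′} {Γ₁ = Γ₁} R Γr (~gadget {P = P} {P′} {Q} {Q′} {d} eq p q) =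
    transport (λ u → Sim W₁ Γ₁ (marked (rename⁺ r P) (rename⁺ r Q)) u var)
      (sym (rename-gadget r′ d P′ Q′))
      (~gadget (trans (R .machines) (cong (Maybe.map _) eq))
        (λ j → Sim-rename (allocate-renaming j R) Γr (p j))
        (λ j → Sim-rename (allocate-renaming j R) Γr (q j)))

  -- A gadget assigns to its cells, so it remains a gadget only under substitutions that send these
  -- cells to identifiers.
  data MapsTo {m n} (s : Fin m → Tm n) : Maybe (Device m) → Maybe (Device n) → Set where
    nothing : MapsTo s nothing nothing
    just    : ∀ {os g z e g′ z′ e′} → s g ≡ ident g′ → s z ≡ ident z′ → s e ≡ ident e′ →
      MapsTo s (just (device os g z e)) (just (device os g′ z′ e′))

  record Substitution {m m′ n n′} (W : World m m′) (Γ : Vec Ty m) (W₁ : World n n′) (Γ₁ : Vec Ty n)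
    (s : Fin m → Tm⁺ n) (s′ : Fin m′ → Tm n′) : Set where
    field
      terms    : ∀ x → Sim W₁ Γ₁ (s x) (s′ (W .embed x)) (lookup Γ x)
      holds    : ∀ {y k} → W .Holds y k → ∃[ y₁ ] s′ y ≡ ident y₁ × W₁ .Holds y₁ k
      machines : MapsTo s′ (W .machine) (W₁ .machine)

  open Substitution

  shift-machines : ∀ {m n} {s : Fin m → Tm n} {D D₁} → MapsTo s D D₁ →
    MapsTo (liftSub s) (Maybe.map (mapDevice suc) D) (Maybe.map (mapDevice suc) D₁)
  shift-machines nothing      = nothing
  shift-machines (just p q r) = just (cong weaken p) (cong weaken q) (cong weaken r)

  shift : ∀ {n n′} {W : World n n′} → Renaming W (extend W) suc suc
  shift .commutes x = refl
  shift .holds h    = h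
  shift .machines   = refl

  allocation : ∀ {n n′ j} {W : World n n′} → Renaming W (allocate j W) (λ x → x) suc
  allocation .commutes x = refl
  allocation .holds h    = h
  allocation .machines   = refl

  extend-substitution : ∀ {m m′ n n′} {W : World m m′} {Γ} {W₁ : World n n′} {Γ₁ s s′ A} →
    Substitution W Γ W₁ Γ₁ s s′ →
    Substitution (extend W) (A ∷ Γ) (extend W₁) (A ∷ Γ₁) (liftSub⁺ s) (liftSub s′)
  extend-substitution S .terms zero    = ~ident refl
  extend-substitution S .terms (suc x) = Sim-rename shift (λ _ → refl) (S .terms x)
  extend-substitution S .holds {suc y} h with y₁ , eq , h₁ ← S .holds h = suc y₁ , cong weaken eq , h₁
  extend-substitution S .machines = shift-machines (S .machines)

  allocate-substitution : ∀ {m m′ n n′} {W : World m m′} {Γ} {W₁ : World n n′} {Γ₁ s s′} j →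
    Substitution W Γ W₁ Γ₁ s s′ →
    Substitution (allocate j W) Γ (allocate j W₁) Γ₁ s (liftSub s′)
  allocate-substitution j S .holds {zero}  eq = zero , refl , eq
  allocate-substitution j S .holds {suc y} h
    with y₁ , eq , h₁ ← S .holds h = suc y₁ , cong weaken eq , h₁
  allocate-substitution j S .machines = shift-machines (S .machines)
  allocate-substitution {W₁ = W₁} {Γ₁} {s} {s′} j S .terms x =
    -- The private cell exists on the simulating side alone, so the marked term undergoes the
    -- identity renaming, which is removed here.
    transport (λ u → Sim (allocate j W₁) Γ₁ u _ _) (rename-id⁺ (λ _ → refl) (s x))
      (Sim-rename allocation (λ _ → refl) (S .terms x))

  Sim-subst : ∀ {m m′ n n′} {W : World m m′} {Γ} {W₁ : World n n′} {Γ₁ s s′ t t′ A} →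
    Substitution W Γ W₁ Γ₁ s s′ → Sim W Γ t t′ A → Sim W₁ Γ₁ (subst⁺ s t) (subst s′ t′) A
  Sim-subst S ~num = ~num
  Sim-subst {W₁ = W₁} {Γ₁} S (~held {k = k} h) with y₁ , eq , h₁ ← S .holds h =
    transport (λ u → Sim W₁ Γ₁ (num⁺ k) (deref u) nat) (sym eq) (~held h₁)
  Sim-subst S (~op p q) = ~op (Sim-subst S p) (Sim-subst S q)
  Sim-subst S ~skip = ~skip
  Sim-subst S (~seq p q) = ~seq (Sim-subst S p) (Sim-subst S q)
  Sim-subst S (~assign p q) = ~assign (Sim-subst S p) (Sim-subst S q)
  Sim-subst S (~deref p) = ~deref (Sim-subst S p)
  Sim-subst S (~while p q) = ~while (Sim-subst S p) (Sim-subst S q)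
  Sim-subst S (~ifzero p q r) = ~ifzero (Sim-subst S p) (Sim-subst S q) (Sim-subst S r)
  Sim-subst S (~ident refl) = S .terms _
  Sim-subst S (~lam p) = ~lam (Sim-subst (extend-substitution S) p)
  Sim-subst S (~app p q) = ~app (Sim-subst S p) (Sim-subst S q)
  Sim-subst S (~new b p) = ~new b (Sim-subst (extend-substitution S) p)
  Sim-subst S (~mkvar p q) = ~mkvar (Sim-subst S p) (Sim-subst S q)
  Sim-subst {W = W} {W₁ = W₁} S (~erased eq p q) with W .machine | W₁ .machine in eq₁ | S .machines
  Sim-subst S (~erased refl p q) | _ | _ | nothing = ~erased eq₁ (Sim-subst S p) (Sim-subst S q)
  Sim-subst {W = W} {W₁ = W₁} {Γ₁} {s} {s′} S (~gadget {P = P} {P′} {Q} {Q′} eq p q)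
    with W .machine | W₁ .machine in eq₁ | S .machines
  Sim-subst {W₁ = W₁} {Γ₁} {s} {s′} S (~gadget {P = P} {P′} {Q} {Q′} refl p q) | _ | _ | just i j k =
    transport (λ u → Sim W₁ Γ₁ (marked (subst⁺ s P) (subst⁺ s Q)) u var)
      (sym (subst-gadget s′ P′ Q′ i j k))
      (~gadget eq₁ (λ l → Sim-subst (allocate-substitution l S) (p l))
                   (λ l → Sim-subst (allocate-substitution l S) (q l)))

  instantiation : ∀ {n n′} {W : World n n′} {Γ A N N′} → Sim W Γ N N′ A →
    Substitution (extend W) (A ∷ Γ) W Γ (instantiate⁺ N) (instantiate N′)
  instantiation p .terms zero    = p
  instantiation p .terms (suc x) = ~ident refl
  instantiation p .holds {suc y} h = y , refl , h
  instantiation {W = W} p .machines with W .machine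
  ... | nothing = nothing
  ... | just _  = just refl refl refl

  Sim-instantiate : ∀ {n n′} {W : World n n′} {Γ A B M M′ N N′} →
    Sim (extend W) (A ∷ Γ) M M′ B → Sim W Γ N N′ A → Sim W Γ (M [ N /0]⁺) (M′ [ N′ /0]) B
  Sim-instantiate p q = Sim-subst (instantiation q) p

  -- Evaluation of the code of the gadget

  infix 4 _∣_↦_∣_

  -- Both directions of the simulation meet the same code: `run` builds evaluations of it, `only`
  -- inverts given ones.
  record _∣_↦_∣_ {n} (s : Store n) (E : Tm n) (s′ : Store n) (V : Tm n) : Set where
    constructor exactly
    field
      run  : s ∣ E ⇓ s′ ∣ V
      only : ∀ {s″ U} → s ∣ E ⇓ s″ ∣ U → s″ ≡ s′ × U ≡ V

  open _∣_↦_∣_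

  ↦num : ∀ {n} {s : Store n} {k} → s ∣ num k ↦ s ∣ num k
  ↦num = exactly (⇓value num) λ { (⇓value num) → refl , refl }

  ↦! : ∀ {n} {s : Store n} x → s ∣ ! x ↦ s ∣ num (lookup s x)
  ↦! x = exactly (⇓deref (⇓value ident))
    λ { (⇓deref (⇓value ident)) → refl , refl ; (⇓deref-mkvar () _) }

  ↦op : ∀ {n} {s s′ s″ : Store n} {o M₁ M₂ k₁ k₂ k} → ⟦ o ⟧ k₁ k₂ ≡ k →
    s ∣ M₁ ↦ s′ ∣ num k₁ → s′ ∣ M₂ ↦ s″ ∣ num k₂ → s ∣ op o M₁ M₂ ↦ s″ ∣ num k
  ↦op refl p q .run = ⇓op (p .run) (q .run)
  ↦op refl p q .only (⇓op d e) with refl , refl ← p .only d with refl , refl ← q .only e = refl , refl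

  ↦assign : ∀ {n} {s s′ : Store n} {x M k} →
    s ∣ M ↦ s′ ∣ num k → s ∣ assign (ident x) M ↦ s′ [ x ]≔ k ∣ skip
  ↦assign p .run = ⇓assign (p .run) (⇓value ident)
  ↦assign p .only (⇓assign d (⇓value ident)) with refl , refl ← p .only d = refl , refl
  ↦assign p .only (⇓assign-mkvar d () _)

  ↦seq : ∀ {n} {s s′ s″ : Store n} {M N V} →
    s ∣ M ↦ s′ ∣ skip → s′ ∣ N ↦ s″ ∣ V → s ∣ seq M N ↦ s″ ∣ V
  ↦seq p q .run = ⇓seq (p .run) (q .run)
  ↦seq p q .only (⇓seq d e) with refl , refl ← p .only d = q .only e

  ↦ifzero-zero : ∀ {n} {s s′ s″ : Store n} {M N₁ N₂ V} →
    s ∣ M ↦ s′ ∣ num 0 → s′ ∣ N₁ ↦ s″ ∣ V → s ∣ ifzero M N₁ N₂ ↦ s″ ∣ V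
  ↦ifzero-zero p q .run = ⇓ifzero-zero (p .run) (q .run)
  ↦ifzero-zero p q .only (⇓ifzero-zero d e) with refl , refl ← p .only d = q .only e
  ↦ifzero-zero p q .only (⇓ifzero-suc d e) with refl , () ← p .only d

  ↦ifzero-suc : ∀ {n} {s s′ s″ : Store n} {M N₁ N₂ V k} →
    s ∣ M ↦ s′ ∣ num (suc k) → s′ ∣ N₂ ↦ s″ ∣ V → s ∣ ifzero M N₁ N₂ ↦ s″ ∣ V
  ↦ifzero-suc p q .run = ⇓ifzero-suc (p .run) (q .run)
  ↦ifzero-suc p q .only (⇓ifzero-suc d e) with refl , refl ← p .only d = q .only e
  ↦ifzero-suc p q .only (⇓ifzero-zero d e) with refl , () ← p .only d

  ↦gap : ∀ {n} {s : Store n} z e →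
    s ∣ gap z e ↦ s ∣ num (1 ∸ ((lookup s z ∸ lookup s e) + (lookup s e ∸ lookup s z)))
  ↦gap z e = ↦op (⟦minus⟧ _ _) ↦num
    (↦op (⟦plus⟧ _ _) (↦op (⟦minus⟧ _ _) (↦! z) (↦! e)) (↦op (⟦minus⟧ _ _) (↦! e) (↦! z)))

  ↦check : ∀ {n} {s : Store n} {z e} → lookup s z ≡ lookup s e → s ∣ check z e ↦ s ∣ skip
  ↦check {s = s} {z} {e} eq = exactly (⇓while-exit (guard .run)) only-skip
    where
    guard : s ∣ gap z e ↦ s ∣ num 1
    guard = transport (λ k → s ∣ gap z e ↦ s ∣ num k)
      (trans (cong (λ k → 1 ∸ ((k ∸ lookup s e) + (lookup s e ∸ k))) eq)
             (cong (λ k → 1 ∸ (k + k)) (n∸n≡0 (lookup s e))))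
      (↦gap z e)
    only-skip : ∀ {s″ U} → s ∣ check z e ⇓ s″ ∣ U → s″ ≡ s × U ≡ skip
    only-skip (⇓while-exit d) with refl , _ ← guard .only d = refl , refl
    only-skip (⇓while-loop d _ _) with _ , () ← guard .only d

  no-gap : ∀ a b {k} → suc k ≡ 1 ∸ ((a ∸ b) + (b ∸ a)) → a ≡ b
  no-gap a b eq with (a ∸ b) + (b ∸ a) in no-difference
  ... | zero =
    ≤-antisym (m∸n≡0⇒m≤n (m+n≡0⇒m≡0 _ no-difference)) (m∸n≡0⇒m≤n (m+n≡0⇒n≡0 (a ∸ b) no-difference))
  no-gap a b () | suc zero
  no-gap a b () | suc (suc _)

  -- Neither guard nor body changes the store, so the guard that ended the loop was evaluated in the
  -- initial store.
  check-passed : ∀ {n} {s s′ : Store n} {z e U} → s ∣ check z e ⇓ s′ ∣ U → lookup s z ≡ lookup s e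
  check-passed {s = s} {z = z} {e} (⇓while-exit d)
    with refl , eq ← ↦gap z e .only d = no-gap (lookup s z) _ (num-injective eq)
    where
    num-injective : ∀ {n j k} → _≡_ {A = Tm n} (num j) (num k) → j ≡ k
    num-injective refl = refl
  check-passed {z = z} {e} (⇓while-loop d (⇓value skip) f)
    with refl , _ ← ↦gap z e .only d = check-passed f

  forever : ∀ {n} {s s′ : Store n} {U} → s ∣ while (num 0) skip ⇓ s′ ∣ U → ⊥
  forever (⇓while-loop _ _ d) = forever d

  ↦table : ∀ {n} {s : Store n} {X m c os′} os → s ∣ X ↦ s ∣ num m → drop m os ≡ c ∷ os′ →
    s ∣ table os X ↦ s ∣ num c
  ↦table {m = zero}  (c ∷ os) p refl = ↦ifzero-zero p ↦num
  ↦table {m = suc m} (c ∷ os) p eq   = ↦ifzero-suc p (↦table os (↦op (⟦minus⟧ _ _) p ↦num) eq)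

  -- Since the table diverges past its end, termination of a lookup yields an entry.
  table-defined : ∀ {n} {s s′ : Store n} {X m U} os → s ∣ X ↦ s ∣ num m →
    s ∣ table os X ⇓ s′ ∣ U → ∃[ c ] ∃[ os′ ] drop m os ≡ c ∷ os′
  table-defined [] p (⇓seq d _) with () ← forever d
  table-defined {m = zero} (c ∷ os) p d = c , os , refl
  table-defined {m = suc m} (c ∷ os) p (⇓ifzero-suc d e)
    with refl , _ ← p .only d = table-defined os (↦op (⟦minus⟧ _ _) p ↦num) e
  table-defined {m = suc m} (c ∷ os) p (⇓ifzero-zero d e) with _ , () ← p .only d

  drop-suc : ∀ m {c : ℕ} {os os′} → drop m os ≡ c ∷ os′ → drop (suc m) os ≡ os′
  drop-suc zero    {os = _ ∷ os} refl = refl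
  drop-suc (suc m) {os = _ ∷ os} eq   = drop-suc m eq

  ↦increment : ∀ {n} {s : Store n} g → s ∣ increment g ↦ s [ g ]≔ suc (lookup s g) ∣ skip
  ↦increment g = ↦assign (↦op (⟦plus⟧ _ _) ↦num (↦! g))

  ↦arm : ∀ {n} {s : Store n} {k z e C c} → lookup s z ≡ lookup s e → k ∷ s ∣ C ↦ k ∷ s ∣ num c →
    k ∷ s ∣ arm zero (suc z) (suc e) C ↦ k ∷ (s [ z ]≔ (c + k)) [ e ]≔ k ∣ skip
  ↦arm eq p = ↦seq (↦check eq) (↦seq (↦assign (↦op (⟦plus⟧ _ _) p (↦! zero))) (↦assign (↦! zero)))

  -- Stores: separation of the cells and state of the device

  -- Cells of different roles are different. One function on cells thus replaces all pairwise
  -- disequalities, and gives the injectivity of `embed` as well.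
  data Role (n : ℕ) : Set where
    source  : Fin n → Role n
    held    : Role n
    reserved : Fin 3 → Role n

  source-injective : ∀ {n} {x y : Fin n} → source x ≡ source y → x ≡ y
  source-injective refl = refl

  role-≢ : ∀ {n n′} (role : Fin n′ → Role n) {x y r₁ r₂} → role x ≡ r₁ → role y ≡ r₂ → r₁ ≢ r₂ → x ≢ y
  role-≢ role p q r₁≢r₂ refl = r₁≢r₂ (trans (sym p) q)

  data Assigned {n n′} (role : Fin n′ → Role n) : Maybe (Device n′) → Set where
    nothing : Assigned role nothing
    just    : ∀ {d} → role (d .counter) ≡ reserved zero → role (d .content) ≡ reserved (suc zero) →
      role (d .expected) ≡ reserved (suc (suc zero)) → Assigned role (just d)

  record Valid {n n′} (W : World n n′) : Set where
    field
      role         : Fin n′ → Role n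
      role-source  : ∀ x → role (W .embed x) ≡ source x
      role-held    : ∀ {y k} → W .Holds y k → role y ≡ held
      role-machine : Assigned role (W .machine)

  open Valid

  shiftRole : ∀ {n} → Role n → Role (suc n)
  shiftRole (source x)   = source (suc x)
  shiftRole held         = held
  shiftRole (reserved i) = reserved i

  extend-valid : ∀ {n n′} {W : World n n′} → Valid W → Valid (extend W)
  extend-valid v .role zero             = source zero
  extend-valid v .role (suc y)          = shiftRole (v .role y)
  extend-valid v .role-source zero      = refl
  extend-valid v .role-source (suc x)   = cong shiftRole (v .role-source x)
  extend-valid v .role-held {suc y} h   = cong shiftRole (v .role-held h)
  extend-valid {W = W} v .role-machine with W .machine | v .role-machine
  ... | nothing | nothing    = nothing
  ... | just _  | just p q r = just (cong shiftRole p) (cong shiftRole q) (cong shiftRole r)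

  allocate-valid : ∀ {n n′ j} {W : World n n′} → Valid W → Valid (allocate j W)
  allocate-valid v .role zero            = held
  allocate-valid v .role (suc y)         = v .role y
  allocate-valid v .role-source x        = v .role-source x
  allocate-valid v .role-held {zero} _   = refl
  allocate-valid v .role-held {suc y} h  = v .role-held h
  allocate-valid {W = W} v .role-machine with W .machine | v .role-machine
  ... | nothing | nothing    = nothing
  ... | just _  | just p q r = just p q r

  record Agree {n n′} (W : World n n′) (σ : Store n) (s : Store n′) : Set where
    field
      at-source : ∀ x → lookup s (W .embed x) ≡ lookup σ x
      at-held   : ∀ {y k} → W .Holds y k → lookup s y ≡ k

  open Agree

  extend-agree : ∀ {n n′} {W : World n n′} {σ s} k → Agree W σ s → Agree (extend W) (k ∷ σ) (k ∷ s)
  extend-agree k a .at-source zero    = refl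
  extend-agree k a .at-source (suc x) = a .at-source x
  extend-agree k a .at-held {suc y} h = a .at-held h

  extend-agree⁻ : ∀ {n n′} {W : World n n′} {k k′ σ s} →
    Agree (extend W) (k ∷ σ) (k′ ∷ s) → Agree W σ s
  extend-agree⁻ a .at-source x = a .at-source (suc x)
  extend-agree⁻ a .at-held h   = a .at-held {suc _} h

  allocate-agree : ∀ {n n′} {W : World n n′} {σ s} k → Agree W σ s → Agree (allocate k W) σ (k ∷ s)
  allocate-agree k a .at-source x         = a .at-source x
  allocate-agree k a .at-held {zero} refl = refl
  allocate-agree k a .at-held {suc y} h   = a .at-held h

  allocate-agree⁻ : ∀ {n n′ j} {W : World n n′} {σ k s} → Agree (allocate j W) σ (k ∷ s) → Agree W σ s
  allocate-agree⁻ a .at-source x = a .at-source x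
  allocate-agree⁻ a .at-held h   = a .at-held {suc _} h

  source-update : ∀ {n n′} {W : World n n′} {σ s} → Valid W → Agree W σ s → ∀ x k →
    Agree W (σ [ x ]≔ k) (s [ W .embed x ]≔ k)
  source-update {W = W} {σ} {s} v a x k .at-source y with x Fin.≟ y
  ... | yes refl = trans (lookup∘update (W .embed x) s k) (sym (lookup∘update x σ k))
  ... | no x≢y =
    trans (lookup∘update′ (role-≢ (v .role) (v .role-source y) (v .role-source x)
        λ eq → x≢y (sym (source-injective eq))) s k)
      (trans (a .at-source y) (sym (lookup∘update′ (x≢y ∘ sym) σ k)))
  source-update {s = s} v a x k .at-held h =
    trans (lookup∘update′ (role-≢ (v .role) (v .role-held h) (v .role-source x) λ ()) s k)
      (a .at-held h)

  reserved-update : ∀ {n n′} {W : World n n′} {σ s} (v : Valid W) {y i} → v .role y ≡ reserved i → ∀ k →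
    Agree W σ s → Agree W σ (s [ y ]≔ k)
  reserved-update {s = s} v p k a .at-source x =
    trans (lookup∘update′ (role-≢ (v .role) (v .role-source x) p λ ()) s k) (a .at-source x)
  reserved-update {s = s} v p k a .at-held h =
    trans (lookup∘update′ (role-≢ (v .role) (v .role-held h) p λ ()) s k) (a .at-held h)

  -- The predictions that remain, in a state in which the last access to a
  -- gadget passes its check.
  data Log {n} : Maybe (Device n) → Store n → List ℕ → Set where
    nothing : ∀ {s o} → Log nothing s o
    just    : ∀ {d s o} → lookup s (d .content) ≡ lookup s (d .expected) →
      drop (lookup s (d .counter)) (d .predictions) ≡ o → Log (just d) s o

  shift-log : ∀ {n k o} {D : Maybe (Device n)} {s : Store n} →
    Log D s o → Log (Maybe.map (mapDevice suc) D) (k ∷ s) o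
  shift-log nothing    = nothing
  shift-log (just p q) = just p q

  unshift-log : ∀ {n k o} D {s : Store n} → Log (Maybe.map (mapDevice suc) D) (k ∷ s) o → Log D s o
  unshift-log nothing  nothing    = nothing
  unshift-log (just _) (just p q) = just p q

  log-update : ∀ {n n′} {W : World n n′} {s o} → Valid W → ∀ x k →
    Log (W .machine) s o → Log (W .machine) (s [ W .embed x ]≔ k) o
  log-update {W = W} {s} v x k l with W .machine | v .role-machine
  log-update {W = W} {s} v x k nothing | nothing | _ = nothing
  log-update {W = W} {s} v x k (just eq next) | just d | just p q r = just
    (trans (kept q) (trans eq (sym (kept r))))
      (trans (cong (λ i → drop i (d .predictions)) (kept p)) next)
    where
    kept : ∀ {y i} → v .role y ≡ reserved i → lookup (s [ W .embed x ]≔ k) y ≡ lookup s y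
    kept p = lookup∘update′ (role-≢ (v .role) p (v .role-source x) λ ()) s k

  log-update⁻ : ∀ {n n′} {W : World n n′} {s o} → Valid W → ∀ x k →
    Log (W .machine) (s [ W .embed x ]≔ k) o → Log (W .machine) s o
  log-update⁻ {W = W} {s} v x k l with W .machine | v .role-machine
  log-update⁻ {W = W} {s} v x k nothing | nothing | _ = nothing
  log-update⁻ {W = W} {s} v x k (just eq next) | just d | just p q r = just
    (trans (sym (kept q)) (trans eq (kept r)))
      (trans (cong (λ i → drop i (d .predictions)) (sym (kept p))) next)
    where
    kept : ∀ {y i} → v .role y ≡ reserved i → lookup (s [ W .embed x ]≔ k) y ≡ lookup s y
    kept p = lookup∘update′ (role-≢ (v .role) p (v .role-source x) λ ()) s k

  -- The state when the gadget has returned its cell and the cell has not yet been used: a read will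
  -- be accepted only if `c` is 0, a write only if it writes `k`, and then for every `c`.
  record Armed {n} (d : Device n) (s : Store n) (o : List ℕ) (c k : ℕ) : Set where
    constructor armed
    field
      content-is  : lookup s (d .content) ≡ c + k
      expected-is : lookup s (d .expected) ≡ k
      remaining   : drop (lookup s (d .counter)) (d .predictions) ≡ o

  advance : ∀ {n} → Device n → Store n → Store n
  advance d s = s [ d .counter ]≔ suc (lookup s (d .counter))

  load : ∀ {n} → Device n → ℕ → ℕ → Store n → Store n
  load d c k s = (s [ d .content ]≔ (c + k)) [ d .expected ]≔ k

  readTail : ∀ {n} → Device n → Tm (suc n)
  readTail (device os g z e) =
    seq (arm zero (suc z) (suc e) (table os (! suc g))) (increment (suc g))

  ↦readTail : ∀ {n} {s : Store n} {k c o} d → Log (just d) s (c ∷ o) →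
    k ∷ s ∣ readTail d ↦ k ∷ advance d (load d c k s) ∣ skip
  ↦readTail (device os g z e) (just eq next) = ↦seq (↦arm eq (↦table os (↦! _) next)) (↦increment _)

  ↦writeTail : ∀ {n} {s : Store n} {k} d → lookup s (d .content) ≡ lookup s (d .expected) →
    k ∷ s ∣ arm zero (suc (d .content)) (suc (d .expected)) (num 1) ↦ k ∷ load d 1 k s ∣ skip
  ↦writeTail d eq = ↦arm eq ↦num

  read-gadget : ∀ {n} {s s′ : Store n} {P Q j k c o o′} d →
    Log (just d) s (0 ∷ o) → 0 ∷ advance d s ∣ Q ⇓ j ∷ s′ ∣ num k → Log (just d) s′ (c ∷ o′) →
    s ∣ gadget d P Q ⇓ advance d (load d c k s′) ∣ ident (d .content)
  read-gadget d@(device os g z e) (just _ next) q l = ⇓seq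
    (⇓new {V = skip} (⇓ifzero-zero (↦table os (↦! _) next .run)
      (⇓seq (↦increment _ .run) (⇓seq (⇓assign q (⇓value ident)) (↦readTail d l .run)))))
    (⇓value ident)

  ↦writeArgument : ∀ {n} {s : Store n} {k o} d →
    drop (lookup s (d .counter)) (d .predictions) ≡ suc k ∷ o →
    0 ∷ s ∣ assign (ident zero) (op minus (table (d .predictions) (! suc (d .counter))) (num 1))
      ↦ k ∷ s ∣ skip
  ↦writeArgument (device os g z e) next = ↦assign (↦op (⟦minus⟧ _ _) (↦table os (↦! _) next) ↦num)

  write-gadget : ∀ {n} {s s′ : Store n} {P Q k o} d →
    Log (just d) s (suc k ∷ o) → k ∷ advance d s ∣ app P (! zero) ⇓ k ∷ s′ ∣ skip →
    lookup s′ (d .content) ≡ lookup s′ (d .expected) →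
    s ∣ gadget d P Q ⇓ load d 1 k s′ ∣ ident (d .content)
  write-gadget d@(device os g z e) (just _ next) p eq = ⇓seq
    (⇓new {V = skip} (⇓ifzero-suc (↦table os (↦! _) next .run)
      (⇓seq (↦writeArgument d next .run) (⇓seq (↦increment _ .run) (⇓seq p (↦writeTail d eq .run))))))
    (⇓value ident)

  advanced : ∀ {n n′} {role : Fin n′ → Role n} {s : Store n′} {d c o} → Assigned role (just d) →
    Log (just d) s (c ∷ o) → Log (just d) (advance d s) o
  advanced {role = role} {s} {d} (just counts q r) (just eq next) = just
    (trans (kept q λ ()) (trans eq (sym (kept r λ ()))))
    (trans (cong (λ i → drop i (d .predictions)) (lookup∘update (d .counter) s _))
      (drop-suc (lookup s (d .counter)) next))
    where
    kept : ∀ {y i} → role y ≡ reserved i → reserved i ≢ reserved zero →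
      lookup (advance d s) y ≡ lookup s y
    kept p p≢ = lookup∘update′ (role-≢ role p counts p≢) s _

  load-armed : ∀ {n n′} {role : Fin n′ → Role n} {d} s c k → Assigned role (just d) →
    Armed d (load d c k s) (drop (lookup s (d .counter)) (d .predictions)) c k
  load-armed {role = role} {d} s c k (just p q r) = armed
    (trans (lookup∘update′ (role-≢ role q r λ ()) loaded k) (lookup∘update (d .content) s (c + k)))
    (lookup∘update (d .expected) loaded k)
    (cong (λ i → drop i (d .predictions))
      (trans (lookup∘update′ (role-≢ role p r λ ()) loaded k)
        (lookup∘update′ (role-≢ role p q λ ()) s (c + k))))
    where loaded = s [ d .content ]≔ (c + k)

  advance-armed : ∀ {n n′} {role : Fin n′ → Role n} {s : Store n′} {d a o c k} →
    Assigned role (just d) →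
    Armed d s (a ∷ o) c k → Armed d (advance d s) o c k
  advance-armed {role = role} {s} {d} (just p q r) (armed i j next) = armed
    (trans (lookup∘update′ (role-≢ role q p λ ()) s _) i)
    (trans (lookup∘update′ (role-≢ role r p λ ()) s _) j)
    (trans (cong (λ i → drop i (d .predictions)) (lookup∘update (d .counter) s _))
      (drop-suc (lookup s (d .counter)) next))

  read-armed : ∀ {n n′} {role : Fin n′ → Role n} {s : Store n′} {d c o} k → Assigned role (just d) →
    Log (just d) s (c ∷ o) → Armed d (advance d (load d c k s)) o c k
  read-armed {s = s} {d} {c} k r (just _ next) =
    advance-armed r (transport (λ o → Armed d (load d c k s) o c k) next (load-armed s c k r))

  advance-agree : ∀ {n n′} {W : World n n′} {σ s d} (v : Valid W) → Assigned (v .role) (just d) →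
    Agree W σ s → Agree W σ (advance d s)
  advance-agree v (just p _ _) = reserved-update v p _

  load-agree : ∀ {n n′} {W : World n n′} {σ s d} (v : Valid W) → Assigned (v .role) (just d) → ∀ c k →
    Agree W σ s → Agree W σ (load d c k s)
  load-agree v (just _ q r) c k a = reserved-update v r k (reserved-update v q (c + k) a)

  content-agree : ∀ {n n′} {W : World n n′} {σ s d} (v : Valid W) → Assigned (v .role) (just d) → ∀ k →
    Agree W σ s → Agree W σ (s [ d .content ]≔ k)
  content-agree v (just _ q _) k = reserved-update v q k

  write-armed : ∀ {n n′} {role : Fin n′ → Role n} {s : Store n′} {d c k o} → Assigned role (just d) →
    Armed d s o c k → Log (just d) (s [ d .content ]≔ k) o
  write-armed {role = role} {s} {d} {k = k} (just p q r) (armed _ j next) = just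
    (trans (lookup∘update (d .content) s k)
      (trans (sym j) (sym (lookup∘update′ (role-≢ role r q λ ()) s k))))
    (trans (cong (λ i → drop i (d .predictions)) (lookup∘update′ (role-≢ role p q λ ()) s k)) next)

  -- From runs to evaluations

  -- An actual `mkvar` always runs its first component when written to, so it leaves no room for
  -- cheating.
  Permits : ∀ {n} → Maybe (Device n) → Bool → Set
  Permits D cheating = D ≡ nothing → cheating ≡ false

  shift-permits : ∀ {n c} (D : Maybe (Device n)) → Permits D c → Permits (Maybe.map (mapDevice suc) D) c
  shift-permits nothing p _ = p refl

  -- V′ need not be a value: it is a gadget if V is marked.
  record Forward {n n′} (W : World n n′) Γ s t A o₁ σ₁ (V : Tm⁺ n) : Set where
    constructor forward
    field
      {s₁}   : Store n′
      {V′}   : Tm n′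
      sim    : Sim W Γ V V′ A
      agree  : Agree W σ₁ s₁
      log    : Log (W .machine) s₁ o₁
      resume : ∀ {s₂ U} → s₁ ∣ V′ ⇓ s₂ ∣ U → s ∣ t ⇓ s₂ ∣ U

  ⇓deref-as : ∀ {n} {s s′ : Store n} {M x k} → lookup s′ x ≡ k → s ∣ M ⇓ s′ ∣ ident x →
    s ∣ deref M ⇓ s′ ∣ num k
  ⇓deref-as refl d = ⇓deref d

  eval-num : ∀ {n n′} {W : World n n′} {Γ σ s k V A} → Agree W σ s → Sim W Γ (num⁺ k) V A →
    s ∣ V ⇓ s ∣ num k
  eval-num a ~num      = ⇓value num
  eval-num a (~held h) = ⇓deref-as (a .at-held h) (⇓value ident)

  as-numeral : ∀ {n n′ m m′} {W : World n n′} {W₁ : World m m′} {Γ Γ₁ k V A} →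
    Sim W Γ (num⁺ k) V A → Sim W₁ Γ₁ (num⁺ k) (num k) A
  as-numeral ~num      = ~num
  as-numeral (~held _) = ~num

  relog : ∀ {n} {D D′ : Maybe (Device n)} {s o} → D ≡ D′ → Log D s o → Log D′ s o
  relog refl l = l

  -- By induction on the run. To evaluate a gadget is to perform an access, so a gadget that
  -- simulates a marked value has to wait until that value is read or written; `resume` then inserts
  -- its evaluation into that of the whole term.
  simulate : ∀ {c n n′ o o₁ σ σ₁} {t V : Tm⁺ n} {W : World n n′} {Γ t′ A s} →
    Run c o σ t o₁ σ₁ V → Permits (W .machine) c → Valid W →
    Sim W Γ t t′ A → Agree W σ s → Log (W .machine) s o → Forward W Γ s t′ A o₁ σ₁ V
  simulate (⇓value _) c v m a l = forward m a l λ r → r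
  simulate ⇓marked    c v m a l = forward m a l λ r → r
  simulate (⇓app d e) c v (~app p q) a l
    with forward (~lam p) a l k ← simulate d c v p a l
    with forward m a l k′ ← simulate e c v (Sim-instantiate p q) a l
    = forward m a l λ r → ⇓app (k (⇓value lam)) (k′ r)
  simulate (⇓op d e) c v (~op p q) a l
    with forward m a l k ← simulate d c v p a l
    with forward m′ a′ l k′ ← simulate e c v q a l
    = forward ~num a′ l λ { (⇓value num) → ⇓op (k (eval-num a m)) (k′ (eval-num a′ m′)) }
  simulate (⇓assign {k = i} d e) c v (~assign p q) a l
    with forward m a l k ← simulate d c v q a l
    with forward (~ident {x = x} _) a′ l k′ ← simulate e c v p a l
    = forward ~skip (source-update v a′ x i) (log-update v x i l)
        λ { (⇓value skip) → ⇓assign (k (eval-num a m)) (k′ (⇓value ident)) }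
  simulate (⇓deref d) c v (~deref p) a l
    with forward (~ident {x = x} _) a l k ← simulate d c v p a l
    = forward ~num a l λ { (⇓value num) → ⇓deref-as (a .at-source x) (k (⇓value ident)) }
  simulate (⇓seq d e) c v (~seq p q) a l
    with forward ~skip a l k ← simulate d c v p a l
    with forward m a l k′ ← simulate e c v q a l
    = forward m a l λ r → ⇓seq (k (⇓value skip)) (k′ r)
  simulate (⇓while-exit d) c v (~while p q) a l
    with forward m a l k ← simulate d c v p a l
    = forward ~skip a l λ { (⇓value skip) → ⇓while-exit (k (eval-num a m)) }
  simulate (⇓while-loop d e f) c v (~while p q) a l
    with forward m a l k ← simulate d c v p a l
    with forward ~skip a′ l k′ ← simulate e c v q a l
    with forward ~skip a″ l k″ ← simulate f c v (~while p q) a′ l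
    = forward ~skip a″ l λ { (⇓value skip) →
        ⇓while-loop (k (eval-num a m)) (k′ (⇓value skip)) (k″ (⇓value skip)) }
  simulate (⇓ifzero-zero d e) c v (~ifzero p q q′) a l
    with forward m a l k ← simulate d c v p a l
    with forward m′ a′ l k′ ← simulate e c v q a l
    = forward m′ a′ l λ r → ⇓ifzero-zero (k (eval-num a m)) (k′ r)
  simulate (⇓ifzero-suc d e) c v (~ifzero p q q′) a l
    with forward m a l k ← simulate d c v p a l
    with forward m′ a′ l k′ ← simulate e c v q′ a l
    = forward m′ a′ l λ r → ⇓ifzero-suc (k (eval-num a m)) (k′ r)
  simulate {W = W} (⇓new-num d) c v (~new b p) a l
    with forward {_ ∷ _} m a l k ←
      simulate d (shift-permits (W .machine) c) (extend-valid v) p (extend-agree 0 a) (shift-log l)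
    = forward (as-numeral m) (extend-agree⁻ a) (unshift-log (W .machine) l)
        λ { (⇓value num) → ⇓new {V = num _} (k (eval-num a m)) }
  simulate {W = W} (⇓new-skip d) c v (~new b p) a l
    with forward {_ ∷ _} ~skip a l k ←
      simulate d (shift-permits (W .machine) c) (extend-valid v) p (extend-agree 0 a) (shift-log l)
    = forward ~skip (extend-agree⁻ a) (unshift-log (W .machine) l)
        λ { (⇓value skip) → ⇓new {V = skip} (k (⇓value skip)) }
  simulate (⇓assign-mkvar d e f) c v (~assign p q) a l
    with forward m a l k ← simulate d c v q a l
    with forward (~mkvar m′ _) a′ l k′ ← simulate e c v p a l
    with forward m″ a″ l k″ ← simulate f c v (~app m′ ~num) a′ l
    = forward m″ a″ l λ r → ⇓assign-mkvar (k (eval-num a m)) (k′ (⇓value mkvar)) (k″ r)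
  simulate (⇓deref-mkvar d e) c v (~deref p) a l
    with forward (~mkvar _ m) a l k ← simulate d c v p a l
    with forward m′ a l k′ ← simulate e c v m a l
    = forward m′ a l λ r → ⇓deref-mkvar (k (⇓value mkvar)) (k′ r)
  simulate {W = W} (⇓read {k = k₀} d e) c v (~deref p) a l with simulate d c v p a l
  ... | forward (~erased eq _ q′) a₁ _ k
    with forward m a l k′ ← simulate e c v q′ a₁ (relog (sym eq) nothing)
    = forward m a (relog (sym eq) nothing) λ r → ⇓deref-mkvar (k (⇓value mkvar)) (k′ r)
  ... | forward (~gadget {d = D} eq _ q′) a₁ l₁ k
    with l ← relog eq l₁ | R ← transport (Assigned (v .role)) eq (v .role-machine)
    with forward {_ ∷ s₂} m a l′ k′ ← simulate e (shift-permits (W .machine) c) (allocate-valid v)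
      (q′ 0)
      (allocate-agree 0 (advance-agree v R a₁)) (shift-log (relog (sym eq) (advanced R l)))
    with l′ ← relog eq (unshift-log (W .machine) l′)
    -- An honest read has 0 as its second prediction, so the cell returned contains exactly the
    -- value of `Q` and the read leaves it as expected.
    with armed i j r ← read-armed k₀ R l′
    = forward ~num (advance-agree v R (load-agree v R 0 k₀ (allocate-agree⁻ a)))
        (relog (sym eq) (just (trans i (sym j)) r))
        λ { (⇓value num) → ⇓deref-as i (k (read-gadget D l (k′ (eval-num a m)) l′)) }
  simulate {W = W} (⇓write {k = i} d e f) c v (~assign p q) a l
    with forward m₀ a₀ l₀ k₀ ← simulate d c v q a l
    with simulate e c v p a₀ l₀
  ... | forward (~erased eq p′ _) a′ _ k′
    with forward ~skip a″ l k″ ← simulate f c v (~app p′ ~num) a′ (relog (sym eq) nothing)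
    = forward ~skip a″ l λ { (⇓value skip) →
        ⇓assign-mkvar (k₀ (eval-num a₀ m₀)) (k′ (⇓value mkvar)) (k″ (⇓value skip)) }
  ... | forward (~gadget {d = D} eq p′ _) a′ l₁ k′
    with l ← relog eq l₁ | R ← transport (Assigned (v .role)) eq (v .role-machine)
    with forward {_ ∷ s₂} ~skip a″ l′ k″ ← simulate f (shift-permits (W .machine) c) (allocate-valid v)
      (~app (p′ i) (~held refl)) (allocate-agree i (advance-agree v R a′))
      (shift-log (relog (sym eq) (advanced R l)))
    -- The private cell has survived the run of `P`, so `arm` loads the predicted value.
    with refl ← a″ .at-held {zero} refl | just checked refl ← relog eq (unshift-log (W .machine) l′)
    = forward ~skip
        (content-agree v R i (load-agree v R 1 i (allocate-agree⁻ a″)))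
        (relog (sym eq) (write-armed R (load-armed s₂ 1 i R)))
        λ { (⇓value skip) →
          ⇓assign (k₀ (eval-num a₀ m₀)) (k′ (write-gadget D l (k″ (⇓value skip)) checked)) }
  -- The gadget is armed for a read, but the write stores the very value that is expected, which
  -- erases whatever offset had been loaded.
  simulate {true} {W = W} (⇓cheat {k = i} refl d e f) c v (~assign p q) a l
    with forward m₀ a₀ l₀ k₀ ← simulate d c v q a l
    with simulate e c v p a₀ l₀
  ... | forward (~erased eq _ _) _ _ _ with () ← c eq
  ... | forward (~gadget {d = D} eq _ q′) a′ l₁ k′
    with l ← relog eq l₁ | R ← transport (Assigned (v .role)) eq (v .role-machine)
    with forward {_ ∷ s₂} m′ a″ l′ k″ ← simulate f (shift-permits (W .machine) c) (allocate-valid v)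
      (q′ 0)
      (allocate-agree 0 (advance-agree v R a′)) (shift-log (relog (sym eq) (advanced R l)))
    with l′ ← relog eq (unshift-log (W .machine) l′)
    = forward ~skip
        (content-agree v R i (advance-agree v R (load-agree v R _ i (allocate-agree⁻ a″))))
        (relog (sym eq) (write-armed R (read-armed i R l′)))
        λ { (⇓value skip) →
          ⇓assign (k₀ (eval-num a₀ m₀)) (k′ (read-gadget D l (k″ (eval-num a″ m′)) l′)) }

  -- From evaluations to runs

  readTail-defined : ∀ {n} {s : Store n} {s′ k U} d → k ∷ s ∣ readTail d ⇓ s′ ∣ U →
    ∃[ c ] ∃[ o ] Log (just d) s (c ∷ o) × s′ ≡ k ∷ advance d (load d c k s)
  readTail-defined d@(device os g z e) r@(⇓seq (⇓seq t (⇓seq (⇓assign (⇓op t′ _) _) _)) _)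
    with refl , _ ← ↦check (check-passed t) .only t
    with c , o , next ← table-defined os (↦! (suc g)) t′
    = c , o , just (check-passed t) next , ↦readTail d (just (check-passed t) next) .only r .proj₁
  readTail-defined d (⇓seq (⇓seq t (⇓seq (⇓assign-mkvar _ () _) _)) _)

  writeTail-defined : ∀ {n} {s : Store n} {s′ k U} d →
    k ∷ s ∣ arm zero (suc (d .content)) (suc (d .expected)) (num 1) ⇓ s′ ∣ U →
    lookup s (d .content) ≡ lookup s (d .expected) × s′ ≡ k ∷ load d 1 k s
  writeTail-defined d r@(⇓seq t _) = check-passed t , ↦writeTail d (check-passed t) .only r .proj₁

  advanced⁻ : ∀ {n n′} {role : Fin n′ → Role n} {s : Store n′} {d c o o′} → Assigned role (just d) →
    drop (lookup s (d .counter)) (d .predictions) ≡ c ∷ o′ → Log (just d) (advance d s) o →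
      Log (just d) s (c ∷ o)
  advanced⁻ {role = role} {s} {d} {c} {o′ = o′} (just counts q r) next (just eq next′) = just
    (trans (sym (kept q λ ())) (trans eq (kept r λ ())))
    (trans next (cong (c ∷_) (trans (sym (drop-suc (lookup s (d .counter)) next))
      (trans (cong (λ i → drop i (d .predictions)) (sym (lookup∘update (d .counter) s _))) next′))))
    where
    kept : ∀ {y i} → role y ≡ reserved i → reserved i ≢ reserved zero →
      lookup (advance d s) y ≡ lookup s y
    kept p p≢ = lookup∘update′ (role-≢ role p counts p≢) s _

  armed-read : ∀ {n} {d} {s : Store n} {o o′ c k} → Armed d s o c k → Log (just d) s o′ →
    c ≡ 0 × o ≡ o′ × lookup s (d .content) ≡ k
  armed-read {c = c} {k} (armed i j next) (just eq next′) =
    +-cancelʳ-≡ k c 0 (trans (sym i) (trans eq j)) , trans (sym next) next′ , trans eq j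

  armed-write : ∀ {n n′} {role : Fin n′ → Role n} {d} {s : Store n′} {o o′ c j k} →
    Assigned role (just d) →
    Armed d s o c k → Log (just d) (s [ d .content ]≔ j) o′ → j ≡ k × o ≡ o′
  armed-write {role = role} {d} {s} {j = j} (just p q r) (armed _ i next) (just eq next′) =
    trans (sym (lookup∘update (d .content) s j))
      (trans eq (trans (lookup∘update′ (role-≢ role r q λ ()) s j) i)) ,
    trans (sym next)
      (trans (cong (λ i → drop i (d .predictions)) (sym (lookup∘update′ (role-≢ role p q λ ()) s j)))
        next′)

  -- The gadget has already run `Q` or `P` while the use of its cell is still open; the armed state
  -- will decide which use is accepted.
  data Access (c : Bool) {n n′} (d : Device n′) (σ : Store n) (P Q : Tm⁺ n) (s : Store n′)
    (σ′ : Store n) :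
    List ℕ → Set where
    reading : ∀ {o o′ a k} → Run c o σ Q (a ∷ o′) σ′ (num⁺ k) → Armed d s o′ a k →
      Access c d σ P Q s σ′ (0 ∷ o)
    writing : ∀ {o o′ k} → Run c o σ (app⁺ P (num⁺ k)) o′ σ′ skip⁺ → Armed d s o′ 1 k →
      Access c d σ P Q s σ′ (suc k ∷ o)

  -- What a run of a simulating term tells about the simulated term t. Whether
  -- the last access to a gadget was a predicted one is known only when its
  -- check is passed, hence the hypothesis on the log of the final store.
  data Outcome (c : Bool) {n n′} (W : World n n′) Γ (σ : Store n) (s : Store n′) (t : Tm⁺ n) :
    Ty → Store n′ → Tm n′ → Set where
    plain : ∀ {A s₁ U V σ₁} → Sim W Γ V U A → Value U → Agree W σ₁ s₁ →
      (∀ {o₁} → Log (W .machine) s₁ o₁ → ∃[ o ] Log (W .machine) s o × Run c o σ t o₁ σ₁ V) →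
      Outcome c W Γ σ s t A s₁ U
    accessed : ∀ {s₁ d P Q σ₀ σ₁ o o₀} → W .machine ≡ just d → Log (W .machine) s o →
      Run c o σ t o₀ σ₀ (marked P Q) → Agree W σ₁ s₁ → Access c d σ₀ P Q s₁ σ₁ o₀ →
      Outcome c W Γ σ s t var s₁ (ident (d .content))

  after : ∀ {c n n′} {W : World n n′} {Γ σ σ₁ s s₁ t t₁ A s₂ U} →
    (∀ {o₁ o₂ σ₂ V} → Log (W .machine) s₁ o₁ → Run c o₁ σ₁ t₁ o₂ σ₂ V →
      ∃[ o ] Log (W .machine) s o × Run c o σ t o₂ σ₂ V) →
    Outcome c W Γ σ₁ s₁ t₁ A s₂ U → Outcome c W Γ σ s t A s₂ U
  after f (plain m v a r) = plain m v a λ l → let _ , l , r = r l in f l r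
  after f (accessed eq l r a x) with _ , l , r ← f l r = accessed eq l r a x

  -- Evaluation enters no binder other than `new`, so every identifier it meets has type `var` and
  -- none can be a result of ground type.
  OnlyVars : ∀ {n} → Vec Ty n → Set
  OnlyVars Γ = ∀ x → lookup Γ x ≡ var

  extend-vars : ∀ {n} {Γ : Vec Ty n} → OnlyVars Γ → OnlyVars (var ∷ Γ)
  extend-vars Γv zero    = refl
  extend-vars Γv (suc x) = Γv x

  data Answer {n n′} : Tm⁺ n → Tm n′ → Ty → Set where
    num  : ∀ {k} → Answer (num⁺ k) (num k) nat
    skip : Answer skip⁺ skip comm

  answer : ∀ {n n′} {W : World n n′} {Γ V U B} → Ground B → OnlyVars Γ → Sim W Γ V U B → Value U →
    Answer V U B
  answer b Γv ~num v = num
  answer b Γv ~skip v = skip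
  answer nat Γv (~ident {x = x} eq) v with () ← trans (sym (Γv x)) eq
  answer comm Γv (~ident {x = x} eq) v with () ← trans (sym (Γv x)) eq

  answered : ∀ {c n n′} {W : World n n′} {Γ σ s t B s₁ U} →
    Ground B → OnlyVars Γ → Outcome c W Γ σ s t B s₁ U →
    Σ (Tm⁺ n) λ V → Σ (Store n) λ σ₁ → Answer V U B × Agree W σ₁ s₁ ×
      (∀ {o₁} → Log (W .machine) s₁ o₁ → ∃[ o ] Log (W .machine) s o × Run c o σ t o₁ σ₁ V)
  answered b Γv (plain m v a f) = _ , _ , answer b Γv m v , a , f
  answered () Γv (accessed _ _ _ _ _)

  strengthen : ∀ {n n′} {V : Tm⁺ (suc n)} {U : Tm n′} {U′ A} → U′ ≡ weaken U → Answer V U′ A →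
    Σ (Tm⁺ n) λ V′ → Answer V′ U A ×
      (∀ {c o σ o′ k σ′ t} → Run c o (0 ∷ σ) t o′ (k ∷ σ′) V → Run c o σ (new⁺ t) o′ σ′ V′)
  strengthen {U = num _} refl num = _ , num , ⇓new-num
  strengthen {U = skip} refl skip = _ , skip , ⇓new-skip

  answer-sim : ∀ {n n′} {W : World n n′} {Γ V U B} → Answer V U B → Sim W Γ V U B
  answer-sim num  = ~num
  answer-sim skip = ~skip

  answer-value : ∀ {n n′ B} {V : Tm⁺ n} {U : Tm n′} → Answer V U B → Value U
  answer-value num  = num
  answer-value skip = skip

  data Mode {n} : Maybe (Device n) → Bool → Set where
    honest   : Mode nothing false
    cheating : ∀ {d} → Mode (just d) true

  shift-mode : ∀ {n c} {D : Maybe (Device n)} → Mode D c → Mode (Maybe.map (mapDevice suc) D) c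
  shift-mode honest   = honest
  shift-mode cheating = cheating

  -- Here cheating enters: in the case `reading`, a write has passed a check that was prepared for a
  -- read, so it wrote the value of `Q`.
  write-run : ∀ {c n n′ o o₁ o₂ o₃} {σ σ₁ σ₂ σ₃ : Store n} {M N P Q k d role} {s : Store n′} {D} →
    D ≡ just d → Mode D c → Assigned {n} role D →
    Run c o σ N o₁ σ₁ (num⁺ k) → Run c o₁ σ₁ M o₂ σ₂ (marked P Q) → Access c d σ₂ P Q s σ₃ o₂ →
    Log D (s [ d .content ]≔ k) o₃ → Run c o σ (assign⁺ M N) o₃ σ₃ skip⁺
  write-run refl cheating R d e (reading r i) l with refl , refl ← armed-write R i l = ⇓cheat refl d e r
  write-run refl c R d e (writing r i) l with refl , refl ← armed-write R i l = ⇓write d e r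

  read-run : ∀ {c n n′ o o₁ o₂} {σ σ₁ σ₂ : Store n} {M P Q d} {s : Store n′} {D} → D ≡ just d →
    Run c o σ M o₁ σ₁ (marked P Q) → Access c d σ₁ P Q s σ₂ o₁ →
    Log D s o₂ → Run c o σ (deref⁺ M) o₂ σ₂ (num⁺ (lookup s (d .content)))
  read-run refl d (reading r i) l with refl , refl , refl ← armed-read i l = ⇓read d r
  read-run refl d (writing r i) l with () ← armed-read i l .proj₁

  ⇓deref⁺-as : ∀ {c n o o′} {σ σ′ : Store n} {M x k} → lookup σ′ x ≡ k →
    Run c o σ M o′ σ′ (ident⁺ x) → Run c o σ (deref⁺ M) o′ σ′ (num⁺ k)
  ⇓deref⁺-as refl d = ⇓deref d

  content-update : ∀ {n n′} {W : World n n′} {σ s d} (v : Valid W) → W .machine ≡ just d → ∀ k →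
    Agree W σ s → Agree W σ (s [ d .content ]≔ k)
  content-update v eq = content-agree v (transport (Assigned (v .role)) eq (v .role-machine))

  -- By induction on the evaluation. The run is assembled from its end, since what is left of the
  -- predictions afterwards determines what was there before. Without a device every final list is
  -- admissible, and each access puts the predictions that it fulfils in front: this is how a trace
  -- comes about.
  reflect : ∀ {c n n′ σ} {t : Tm⁺ n} {W : World n n′} {Γ t′ A s s₁ U} →
    s ∣ t′ ⇓ s₁ ∣ U → Mode (W .machine) c → Valid W → OnlyVars Γ →
    Sim W Γ t t′ A → Agree W σ s → Outcome c W Γ σ s t A s₁ U
  reflect (⇓value num) c v Γv ~num a = plain ~num num a λ l → _ , l , ⇓value num⁺
  reflect (⇓deref (⇓value ident)) c v Γv (~held h) a with refl ← a .at-held h =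
    plain ~num num a λ l → _ , l , ⇓value num⁺
  reflect (⇓deref-mkvar () _) c v Γv (~held h) a
  reflect (⇓op d e) c v Γv (~op p q) a
    with plain ~num _ a f ← reflect d c v Γv p a
    with plain ~num _ a g ← reflect e c v Γv q a
    = plain ~num num a λ l → let _ , l , e = g l ; _ , l , d = f l in _ , l , ⇓op d e
  reflect (⇓value skip) c v Γv ~skip a = plain ~skip skip a λ l → _ , l , ⇓value skip⁺
  reflect (⇓seq d e) c v Γv (~seq p q) a
    with plain ~skip _ a f ← reflect d c v Γv p a
    = after (λ l e → let _ , l , d = f l in _ , l , ⇓seq d e) (reflect e c v Γv q a)
  reflect {W = W} (⇓assign {k = k} d e) c v Γv (~assign p q) a
    with plain ~num _ a₁ f ← reflect d c v Γv q a
    with reflect e c v Γv p a₁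
  ... | plain (~ident {x = x} _) _ a₂ g = plain ~skip skip (source-update v a₂ x k)
    λ l → let _ , l , e = g (log-update⁻ v x k l) ; _ , l , d = f l in _ , l , ⇓assign d e
  ... | accessed eq l e a₂ x with _ , l , d ← f l =
    plain ~skip skip (content-update v eq k a₂)
      λ l′ → _ , l , write-run eq c (v .role-machine) d e x l′
  reflect (⇓assign-mkvar d e e′) c v Γv (~assign p q) a
    with plain ~num _ a₁ f ← reflect d c v Γv q a
    with reflect e c v Γv p a₁
  ... | plain (~mkvar m _) _ a₂ g =
    after (λ l e′ → let _ , l , e = g l ; _ , l , d = f l in _ , l , ⇓assign-mkvar d e e′)
      (reflect e′ c v Γv (~app m ~num) a₂)
  ... | plain (~erased eq m _) _ a₂ g
    with plain m′ w a₃ h ← reflect e′ c v Γv (~app m ~num) a₂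
    with skip ← answer comm Γv m′ w
    = plain ~skip skip a₃ λ l →
        let _ , _ , e′ = h l ; _ , l , e = g (relog (sym eq) nothing) ; _ , l , d = f l
        in _ , l , ⇓write d e e′
  reflect {s₁ = s₁} (⇓deref {x = y} d) c v Γv (~deref p) a with reflect d c v Γv p a
  ... | plain (~ident {x = x} _) _ a f =
    plain ~num num a λ l → let _ , l , d = f l in _ , l , ⇓deref⁺-as (sym (a .at-source x)) d
  ... | accessed eq l d a x = plain ~num num a λ l′ → _ , l , read-run eq d x l′
  reflect (⇓deref-mkvar d e) c v Γv (~deref p) a with reflect d c v Γv p a
  ... | plain (~mkvar _ m) _ a₁ f =
    after (λ l e → let _ , l , d = f l in _ , l , ⇓deref-mkvar d e) (reflect e c v Γv m a₁)
  ... | plain (~erased eq _ m) _ a₁ f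
    with plain m′ w a₂ g ← reflect e c v Γv m a₁
    with num ← answer nat Γv m′ w
    = plain ~num num a₂ λ l →
        let _ , _ , e = g (relog (sym eq) nothing) ; _ , l , d = f (relog (sym eq) nothing)
        in _ , l , ⇓read d e
  reflect (⇓while-exit d) c v Γv (~while p q) a
    with plain ~num _ a f ← reflect d c v Γv p a
    = plain ~skip skip a λ l → let _ , l , d = f l in _ , l , ⇓while-exit d
  reflect (⇓while-loop d e e′) c v Γv (~while p q) a
    with plain ~num _ a f ← reflect d c v Γv p a
    with plain ~skip _ a g ← reflect e c v Γv q a
    with plain ~skip _ a h ← reflect e′ c v Γv (~while p q) a
    = plain ~skip skip a λ l →
        let _ , l , e′ = h l ; _ , l , e = g l ; _ , l , d = f l in _ , l , ⇓while-loop d e e′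
  reflect (⇓ifzero-zero d e) c v Γv (~ifzero p q _) a
    with plain ~num _ a f ← reflect d c v Γv p a
    = after (λ l e → let _ , l , d = f l in _ , l , ⇓ifzero-zero d e) (reflect e c v Γv q a)
  reflect (⇓ifzero-suc d e) c v Γv (~ifzero p _ q) a
    with plain ~num _ a f ← reflect d c v Γv p a
    = after (λ l e → let _ , l , d = f l in _ , l , ⇓ifzero-suc d e) (reflect e c v Γv q a)
  reflect (⇓value ident) c v Γv m@(~ident _) a = plain m ident a λ l → _ , l , ⇓value ident⁺
  reflect (⇓value lam) c v Γv m@(~lam _) a = plain m lam a λ l → _ , l , ⇓value lam⁺
  reflect (⇓app d e) c v Γv (~app p q) a
    with plain (~lam m) _ a f ← reflect d c v Γv p a
    = after (λ l e → let _ , l , d = f l in _ , l , ⇓app d e) (reflect e c v Γv (Sim-instantiate m q) a)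
  reflect {W = W} (⇓new d) c v Γv (~new b p) a
    with _ , _ ∷ _ , u , a , f ← answered b (extend-vars Γv)
      (reflect d (shift-mode c) (extend-valid v) (extend-vars Γv) p (extend-agree 0 a))
    with _ , u , drop-new ← strengthen refl u
    = plain (answer-sim u) (answer-value u) (extend-agree⁻ a) λ l →
        let _ , l , d = f (shift-log l) in _ , unshift-log (W .machine) l , drop-new d
  reflect (⇓value mkvar) c v Γv m@(~mkvar _ _) a = plain m mkvar a λ l → _ , l , ⇓value mkvar⁺
  reflect (⇓value mkvar) c v Γv m@(~erased _ _ _) a = plain m mkvar a λ l → _ , l , ⇓marked
  reflect {W = W} {s = s}
    (⇓seq (⇓new (⇓ifzero-zero t (⇓seq i (⇓seq (⇓assign {σ″ = _ ∷ _} d (⇓value ident)) r))))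
          (⇓value ident))
    c v Γv (~gadget {d = D} eq p q) a
    with R ← transport (Assigned (v .role)) eq (v .role-machine)
    with _ , _ , next ← table-defined (D .predictions) (↦! _) t
    with refl , refl ← ↦table (D .predictions) (↦! _) next .only t
    with refl , _ ← ↦increment _ .only i
    with plain ~num _ a f ← reflect d (shift-mode c) (allocate-valid v) Γv (q 0)
      (allocate-agree 0 (advance-agree v R a))
    -- The check inside `arm` has been passed, which supplies the log that the outcome for `Q` asks
    -- for.
    with _ , _ , l , refl ← readTail-defined D r
    with _ , l₁ , d ← f (shift-log (relog (sym eq) l))
    = accessed eq (relog (sym eq) (advanced⁻ R next (relog eq (unshift-log (W .machine) l₁)))) ⇓marked
        (advance-agree v R (load-agree v R _ _ (allocate-agree⁻ a))) (reading d (read-armed _ R l))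
  reflect {W = W} {s = s}
    (⇓seq (⇓new (⇓ifzero-suc {k = k} t (⇓seq w (⇓seq i (⇓seq {σ′ = _ ∷ s′} d r))))) (⇓value ident))
    c v Γv (~gadget {d = D} eq p q) a
    with R ← transport (Assigned (v .role)) eq (v .role-machine)
    with _ , _ , next ← table-defined (D .predictions) (↦! _) t
    with refl , refl ← ↦table (D .predictions) (↦! _) next .only t
    with refl , _ ← ↦writeArgument D next .only w
    with refl , _ ← ↦increment _ .only i
    with plain ~skip _ a f ← reflect d (shift-mode c) (allocate-valid v) Γv (~app (p k) (~held refl))
      (allocate-agree k (advance-agree v R a))
    with refl ← a .at-held {zero} refl
    with passed , refl ← writeTail-defined D r
    with _ , l₁ , d ← f (shift-log (relog (sym eq) (just passed refl)))
    = accessed eq (relog (sym eq) (advanced⁻ R next (relog eq (unshift-log (W .machine) l₁)))) ⇓marked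
        (load-agree v R _ _ (allocate-agree⁻ a)) (writing d (load-armed s′ 1 k R))
  reflect (⇓seq (⇓new (⇓ifzero-zero t (⇓seq i (⇓seq (⇓assign-mkvar _ () _) _)))) _) c v Γv
    (~gadget eq p q) a

  -- Affine typing

  _▹ : ∀ {n} → (Fin n → Set) → Fin (suc n) → Set
  (U ▹) zero    = ⊤
  (U ▹) (suc x) = U x

  infix 4 _⨾_⊩_∶_

  -- Typing in SCImk of the terms whose identifiers satisfy U. In an application
  -- the colouring κ tells which of these belong to the function.
  data _⨾_⊩_∶_ {n} (Γ : Vec Ty n) (U : Fin n → Set) : Tm n → Ty → Set where

    ⊩num : ∀ {k} → Γ ⨾ U ⊩ num k ∶ nat

    ⊩skip : Γ ⨾ U ⊩ skip ∶ comm

    ⊩op : ∀ {o M N} → Γ ⨾ U ⊩ M ∶ nat → Γ ⨾ U ⊩ N ∶ nat → Γ ⨾ U ⊩ op o M N ∶ nat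

    ⊩seq : ∀ {B M N} → Base B → Γ ⨾ U ⊩ M ∶ comm → Γ ⨾ U ⊩ N ∶ B → Γ ⨾ U ⊩ seq M N ∶ B

    ⊩assign : ∀ {M N} → Γ ⨾ U ⊩ M ∶ var → Γ ⨾ U ⊩ N ∶ nat → Γ ⨾ U ⊩ assign M N ∶ comm

    ⊩deref : ∀ {M} → Γ ⨾ U ⊩ M ∶ var → Γ ⨾ U ⊩ deref M ∶ nat

    ⊩while : ∀ {M N} → Γ ⨾ U ⊩ M ∶ nat → Γ ⨾ U ⊩ N ∶ comm → Γ ⨾ U ⊩ while M N ∶ comm

    ⊩ifzero : ∀ {B M N₁ N₂} → Base B →
      Γ ⨾ U ⊩ M ∶ nat → Γ ⨾ U ⊩ N₁ ∶ B → Γ ⨾ U ⊩ N₂ ∶ B → Γ ⨾ U ⊩ ifzero M N₁ N₂ ∶ B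

    ⊩ident : ∀ {x A} → U x → lookup Γ x ≡ A → Γ ⨾ U ⊩ ident x ∶ A

    ⊩lam : ∀ {A B M} → A ∷ Γ ⨾ U ▹ ⊩ M ∶ B → Γ ⨾ U ⊩ lam A M ∶ A ⊸ B

    ⊩app : ∀ {A B M N} (κ : Fin n → Bool) →
      Γ ⨾ (λ x → U x × κ x ≡ true) ⊩ M ∶ A ⊸ B → Γ ⨾ (λ x → U x × κ x ≡ false) ⊩ N ∶ A →
      Γ ⨾ U ⊩ app M N ∶ B

    ⊩new : ∀ {B M} → Ground B → var ∷ Γ ⨾ U ▹ ⊩ M ∶ B → Γ ⨾ U ⊩ new M ∶ B

    ⊩mkvar : ∀ {M N} → Γ ⨾ U ⊩ M ∶ nat ⊸ comm → Γ ⨾ U ⊩ N ∶ nat → Γ ⨾ U ⊩ mkvar M N ∶ var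

  -- A partial inverse transports the colouring of an application along a renaming.
  lift⁻ : ∀ {m n} → (Fin n → Maybe (Fin m)) → Fin (suc n) → Maybe (Fin (suc m))
  lift⁻ r⁻ zero    = Maybe.just zero
  lift⁻ r⁻ (suc y) = Maybe.map suc (r⁻ y)

  _inverts_ : ∀ {m n} → (Fin n → Maybe (Fin m)) → (Fin m → Fin n) → Set
  r⁻ inverts r = ∀ x → r⁻ (r x) ≡ Maybe.just x

  lift-inverse : ∀ {m n} {r : Fin m → Fin n} {r⁻} → r⁻ inverts r → lift⁻ r⁻ inverts lift 1 r
  lift-inverse inv zero    = refl
  lift-inverse inv (suc x) = cong (Maybe.map suc) (inv x)

  lift-lookup : ∀ {m n A} {r : Fin m → Fin n} {Γ : Vec Ty m} {Γ₁ : Vec Ty n} →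
    (∀ x → lookup Γ₁ (r x) ≡ lookup Γ x) → ∀ x → lookup (A ∷ Γ₁) (lift 1 r x) ≡ lookup (A ∷ Γ) x
  lift-lookup Γr zero    = refl
  lift-lookup Γr (suc x) = Γr x

  lift-use : ∀ {m n} {r : Fin m → Fin n} {U U₁} → (∀ x → U x → U₁ (r x)) → ∀ x → (U ▹) x →
    (U₁ ▹) (lift 1 r x)
  lift-use u zero    _ = tt
  lift-use u (suc x) p = u x p

  ⊩-rename : ∀ {m n} {r : Fin m → Fin n} {r⁻ Γ Γ₁ U U₁ t A} → r⁻ inverts r →
    (∀ x → lookup Γ₁ (r x) ≡ lookup Γ x) → (∀ x → U x → U₁ (r x)) →
    Γ ⨾ U ⊩ t ∶ A → Γ₁ ⨾ U₁ ⊩ rename r t ∶ A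
  ⊩-rename i g u ⊩num = ⊩num
  ⊩-rename i g u ⊩skip = ⊩skip
  ⊩-rename {r⁻ = r⁻} i g u (⊩op p q) = ⊩op (⊩-rename {r⁻ = r⁻} i g u p) (⊩-rename {r⁻ = r⁻} i g u q)
  ⊩-rename {r⁻ = r⁻} i g u (⊩seq b p q) =
    ⊩seq b (⊩-rename {r⁻ = r⁻} i g u p) (⊩-rename {r⁻ = r⁻} i g u q)
  ⊩-rename {r⁻ = r⁻} i g u (⊩assign p q) =
    ⊩assign (⊩-rename {r⁻ = r⁻} i g u p) (⊩-rename {r⁻ = r⁻} i g u q)
  ⊩-rename {r⁻ = r⁻} i g u (⊩deref p) = ⊩deref (⊩-rename {r⁻ = r⁻} i g u p)
  ⊩-rename {r⁻ = r⁻} i g u (⊩while p q) =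
    ⊩while (⊩-rename {r⁻ = r⁻} i g u p) (⊩-rename {r⁻ = r⁻} i g u q)
  ⊩-rename {r⁻ = r⁻} i g u (⊩ifzero b p q s) =
    ⊩ifzero b (⊩-rename {r⁻ = r⁻} i g u p) (⊩-rename {r⁻ = r⁻} i g u q) (⊩-rename {r⁻ = r⁻} i g u s)
  ⊩-rename i g u (⊩ident p eq) = ⊩ident (u _ p) (trans (g _) eq)
  ⊩-rename {r⁻ = r⁻} i g u (⊩lam p) =
    ⊩lam (⊩-rename {r⁻ = lift⁻ r⁻} (lift-inverse {r⁻ = r⁻} i) (lift-lookup g) (lift-use u) p)
  -- Identifiers outside the image of the renaming do not occur in the renamed term; `true` is one
  -- possible colour for them.
  ⊩-rename {r⁻ = r⁻} i g u (⊩app κ p q) = ⊩app (λ y → Maybe.maybe′ κ true (r⁻ y))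
    (⊩-rename {r⁻ = r⁻} i g (λ x (p , eq) → u x p , trans (cong (Maybe.maybe′ κ true) (i x)) eq) p)
    (⊩-rename {r⁻ = r⁻} i g (λ x (p , eq) → u x p , trans (cong (Maybe.maybe′ κ true) (i x)) eq) q)
  ⊩-rename {r⁻ = r⁻} i g u (⊩new b p) =
    ⊩new b (⊩-rename {r⁻ = lift⁻ r⁻} (lift-inverse {r⁻ = r⁻} i) (lift-lookup g) (lift-use u) p)
  ⊩-rename {r⁻ = r⁻} i g u (⊩mkvar p q) =
    ⊩mkvar (⊩-rename {r⁻ = r⁻} i g u p) (⊩-rename {r⁻ = r⁻} i g u q)

  isLeft : ∀ m {n} → Fin (m + n) → Bool
  isLeft m x = [ (λ _ → true) , (λ _ → false) ]′ (splitAt m x)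

  fromLeft : ∀ m {n} → Fin (m + n) → Maybe (Fin m)
  fromLeft m x = [ Maybe.just , (λ _ → Maybe.nothing) ]′ (splitAt m x)

  fromRight : ∀ m {n} → Fin (m + n) → Maybe (Fin n)
  fromRight m x = [ (λ _ → Maybe.nothing) , Maybe.just ]′ (splitAt m x)

  -- Weakening, exchange and the splitting of contexts are absorbed by the use predicate and the
  -- colouring. One rule per term former remains, so that transformations of terms can be typed by
  -- induction.
  sound : ∀ {L n} {Γ : Vec Ty n} {U t A} → (∀ x → U x) → Γ ⊢[ L ] t ∶ A → Γ ⨾ U ⊩ t ∶ A
  sound u ⊢ident = ⊩ident (u _) refl
  sound u (⊢lam p) = ⊩lam (sound (λ { zero → tt ; (suc x) → u x }) p)
  sound u (⊢app {m = m} {n} {Γ = Γ} {Δ} p q) = ⊩app (isLeft m)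
    (⊩-rename {r⁻ = fromLeft m}
      (λ x → cong [ Maybe.just , (λ _ → Maybe.nothing) ]′ (splitAt-↑ˡ m x n)) (lookup-++ˡ Γ Δ)
      (λ x _ → u _ , cong [ (λ _ → true) , (λ _ → false) ]′ (splitAt-↑ˡ m x n))
      (sound {U = λ _ → ⊤} _ p))
    (⊩-rename {r⁻ = fromRight m}
      (λ x → cong [ (λ _ → Maybe.nothing) , Maybe.just ]′ (splitAt-↑ʳ m n x)) (lookup-++ʳ Γ Δ)
      (λ x _ → u _ , cong [ (λ _ → true) , (λ _ → false) ]′ (splitAt-↑ʳ m n x))
      (sound {U = λ _ → ⊤} _ q))
  sound u (⊢weakening p) =
    ⊩-rename {r⁻ = λ { zero → Maybe.nothing ; (suc x) → Maybe.just x }} (λ _ → refl) (λ _ → refl)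
      (λ _ _ → u _) (sound {U = λ _ → ⊤} _ p)
  sound u (⊢exchange π eq p) =
    ⊩-rename {r⁻ = λ x → Maybe.just (π ⟨$⟩ˡ x)} (λ x → cong Maybe.just (inverseˡ π)) eq (λ _ _ → u _)
      (sound {U = λ _ → ⊤} _ p)
  sound u ⊢num = ⊩num
  sound u ⊢skip = ⊩skip
  sound u (⊢op p q) = ⊩op (sound u p) (sound u q)
  sound u (⊢seq b p q) = ⊩seq b (sound u p) (sound u q)
  sound u (⊢assign p q) = ⊩assign (sound u p) (sound u q)
  sound u (⊢deref p) = ⊩deref (sound u p)
  sound u (⊢while p q) = ⊩while (sound u p) (sound u q)
  sound u (⊢ifzero b p q r) = ⊩ifzero b (sound u p) (sound u q) (sound u r)
  sound u (⊢new b p) = ⊩new b (sound (λ { zero → tt ; (suc x) → u x }) p)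
  sound u (⊢mkvar p q) = ⊩mkvar (sound u p) (sound u q)

  -- Back to the typing of SCI, for terms free of `mkvar`

  free : ∀ {n} → Tm n → Bool
  free (num k)        = true
  free (op o M N)     = free M ∧ free N
  free skip           = true
  free (seq M N)      = free M ∧ free N
  free (assign M N)   = free M ∧ free N
  free (deref M)      = free M
  free (while M N)    = free M ∧ free N
  free (ifzero M N P) = free M ∧ free N ∧ free P
  free (ident x)      = true
  free (lam A M)      = free M
  free (app M N)      = free M ∧ free N
  free (new M)        = free M
  free (mkvar M N)    = false

  classes : ∀ {m} (P : Fin m → Bool) → Σ ℕ λ a → Σ ℕ λ b → Σ ((Fin a ⊎ Fin b) ↔ Fin m) λ π →
    (∀ i → P (Inverse.to π (inj₁ i)) ≡ true) × (∀ j → P (Inverse.to π (inj₂ j)) ≡ false)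
  classes {zero} P =
    0 , 0 , mk↔ₛ′ (λ { (inj₁ ()) ; (inj₂ ()) }) (λ ()) (λ ()) (λ { (inj₁ ()) ; (inj₂ ()) }) ,
    (λ ()) , λ ()
  classes {suc m} P with P zero in eq | classes (P ∘ suc)
  ... | true | a , b , π , l , r = suc a , b , mk↔ₛ′ to from to-from from-to ,
    (λ { zero → eq ; (suc i) → l i }) , r
    where
    to : Fin (suc a) ⊎ Fin b → Fin (suc m)
    to (inj₁ zero)    = zero
    to (inj₁ (suc i)) = suc (Inverse.to π (inj₁ i))
    to (inj₂ j)       = suc (Inverse.to π (inj₂ j))
    from : Fin (suc m) → Fin (suc a) ⊎ Fin b
    from zero    = inj₁ zero
    from (suc x) = Sum.map₁ suc (Inverse.from π x)
    to-from : ∀ x → to (from x) ≡ x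
    to-from zero = refl
    to-from (suc x) with Inverse.from π x | Inverse.strictlyInverseˡ π x
    ... | inj₁ i | eq = cong suc eq
    ... | inj₂ j | eq = cong suc eq
    from-to : ∀ x → from (to x) ≡ x
    from-to (inj₁ zero) = refl
    from-to (inj₁ (suc i)) = cong (Sum.map₁ suc) (Inverse.strictlyInverseʳ π (inj₁ i))
    from-to (inj₂ j)       = cong (Sum.map₁ suc) (Inverse.strictlyInverseʳ π (inj₂ j))
  ... | false | a , b , π , l , r = a , suc b , mk↔ₛ′ to from to-from from-to ,
    l , (λ { zero → eq ; (suc i) → r i })
    where
    to : Fin a ⊎ Fin (suc b) → Fin (suc m)
    to (inj₁ i)       = suc (Inverse.to π (inj₁ i))
    to (inj₂ zero)    = zero
    to (inj₂ (suc j)) = suc (Inverse.to π (inj₂ j))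
    from : Fin (suc m) → Fin a ⊎ Fin (suc b)
    from zero    = inj₂ zero
    from (suc x) = Sum.map₂ suc (Inverse.from π x)
    to-from : ∀ x → to (from x) ≡ x
    to-from zero = refl
    to-from (suc x) with Inverse.from π x | Inverse.strictlyInverseˡ π x
    ... | inj₁ i | eq = cong suc eq
    ... | inj₂ j | eq = cong suc eq
    from-to : ∀ x → from (to x) ≡ x
    from-to (inj₁ i)       = cong (Sum.map₂ suc) (Inverse.strictlyInverseʳ π (inj₁ i))
    from-to (inj₂ zero)    = refl
    from-to (inj₂ (suc j)) = cong (Sum.map₂ suc) (Inverse.strictlyInverseʳ π (inj₂ j))

  partition : ∀ {m} (P : Fin m → Bool) → Σ ℕ λ a → Σ ℕ λ b → Σ (Permutation (a + b) m) λ π →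
    (∀ i → P (π ⟨$⟩ʳ (i ↑ˡ b)) ≡ true) × (∀ j → P (π ⟨$⟩ʳ (a ↑ʳ j)) ≡ false) ×
    (∀ y → P y ≡ true → ∃[ i ] π ⟨$⟩ʳ (i ↑ˡ b) ≡ y) × (∀ y → P y ≡ false → ∃[ j ] π ⟨$⟩ʳ (a ↑ʳ j) ≡ y)
  partition P with a , b , π , l , r ← classes P =
    a , b , π ↔-∘ +↔⊎ ,
    (λ i → trans (cong P (on-left i)) (l i)) , (λ j → trans (cong P (on-right j)) (r j)) , onto-left ,
      onto-right
    where
    on-left : ∀ i → Inverse.to (π ↔-∘ +↔⊎) (i ↑ˡ b) ≡ Inverse.to π (inj₁ i)
    on-left i = cong (Inverse.to π) (splitAt-↑ˡ a i b)
    on-right : ∀ j → Inverse.to (π ↔-∘ +↔⊎) (a ↑ʳ j) ≡ Inverse.to π (inj₂ j)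
    on-right j = cong (Inverse.to π) (splitAt-↑ʳ a b j)
    onto-left : ∀ y → P y ≡ true → ∃[ i ] Inverse.to (π ↔-∘ +↔⊎) (i ↑ˡ b) ≡ y
    onto-left y eq with Inverse.from π y | Inverse.strictlyInverseˡ π y
    ... | inj₁ i | refl = i , on-left i
    ... | inj₂ j | refl with () ← trans (sym eq) (r j)
    onto-right : ∀ y → P y ≡ false → ∃[ j ] Inverse.to (π ↔-∘ +↔⊎) (a ↑ʳ j) ≡ y
    onto-right y eq with Inverse.from π y | Inverse.strictlyInverseˡ π y
    ... | inj₁ i | refl with () ← trans (sym eq) (l i)
    ... | inj₂ j | refl = j , on-right j

  ⊢num-anywhere : ∀ {L n} (Γ : Vec Ty n) {k} → Γ ⊢[ L ] num k ∶ nat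
  ⊢num-anywhere []      = ⊢num
  ⊢num-anywhere (A ∷ Γ) = ⊢weakening (⊢num-anywhere Γ)

  ⊢skip-anywhere : ∀ {L n} (Γ : Vec Ty n) → Γ ⊢[ L ] skip ∶ comm
  ⊢skip-anywhere []      = ⊢skip
  ⊢skip-anywhere (A ∷ Γ) = ⊢weakening (⊢skip-anywhere Γ)

  ⊢zero : ∀ {L n A} (Γ : Vec Ty n) → A ∷ Γ ⊢[ L ] ident zero ∶ A
  ⊢zero []      = ⊢ident
  ⊢zero (B ∷ Γ) = ⊢exchange (transpose zero (suc zero))
    (λ { zero → refl ; (suc zero) → refl ; (suc (suc x)) → refl }) (⊢weakening (⊢zero Γ))

  ⊢ident-anywhere : ∀ {L n} (Γ : Vec Ty n) x → Γ ⊢[ L ] ident x ∶ lookup Γ x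
  ⊢ident-anywhere (A ∷ Γ) zero    = ⊢zero Γ
  ⊢ident-anywhere (A ∷ Γ) (suc x) = ⊢weakening (⊢ident-anywhere Γ x)

  ∧-true : ∀ {a b} → a ∧ b ≡ true → a ≡ true × b ≡ true
  ∧-true {true} eq = refl , eq

  record Covers {m n} (Γ : Vec Ty n) (U : Fin n → Set) (Γ₀ : Vec Ty m) (θ : Fin m → Fin n) : Set where
    field cover : ∀ x → U x → ∃[ y ] θ y ≡ x × lookup Γ₀ y ≡ lookup Γ x

  open Covers

  extend-covers : ∀ {m n A} {Γ : Vec Ty n} {U} {Γ₀ : Vec Ty m} {θ} →
    Covers Γ U Γ₀ θ → Covers (A ∷ Γ) (U ▹) (A ∷ Γ₀) (lift 1 θ)
  extend-covers c .cover zero    _ = zero , refl , refl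
  extend-covers c .cover (suc x) u = let y , p , q = c .cover x u in suc y , cong suc p , q

  restrict-covers : ∀ {l m n} {Γ : Vec Ty n} {U} {Γ₀ : Vec Ty m} {θ} {κ : Fin n → Bool} {v}
    (f : Fin l → Fin m) →
    (∀ y → κ (θ y) ≡ v → ∃[ i ] f i ≡ y) → Covers Γ U Γ₀ θ →
    Covers Γ (λ x → U x × κ x ≡ v) (tabulate (lookup Γ₀ ∘ f)) (θ ∘ f)
  restrict-covers {Γ₀ = Γ₀} f onto c .cover x (u , eq)
    with y , refl , q ← c .cover x u
      with i , refl ← onto y eq = i , refl , trans (lookup∘tabulate (lookup Γ₀ ∘ f) i) q

  -- In the original rule function and argument live in contexts of their own, so the term must be
  -- pulled back to a smaller context along `θ`. At an application the identifiers are sorted by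
  -- colour, each side is typed over its class, and an exchange restores the order.
  complete : ∀ {m n} {Γ : Vec Ty n} {U t A} {Γ₀ : Vec Ty m} {θ} → free t ≡ true → Covers Γ U Γ₀ θ →
    Γ ⨾ U ⊩ t ∶ A → ∃[ t₀ ] rename θ t₀ ≡ t × Γ₀ ⊢[ SCI ] t₀ ∶ A
  complete f c ⊩num = _ , refl , ⊢num-anywhere _
  complete f c ⊩skip = _ , refl , ⊢skip-anywhere _
  complete f c (⊩op p q) with f , g ← ∧-true f
    with _ , refl , p ← complete f c p with _ , refl , q ← complete g c q = _ , refl , ⊢op p q
  complete f c (⊩seq b p q) with f , g ← ∧-true f
    with _ , refl , p ← complete f c p with _ , refl , q ← complete g c q = _ , refl , ⊢seq b p q
  complete f c (⊩assign p q) with f , g ← ∧-true f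
    with _ , refl , p ← complete f c p with _ , refl , q ← complete g c q = _ , refl , ⊢assign p q
  complete f c (⊩deref p) with _ , refl , p ← complete f c p = _ , refl , ⊢deref p
  complete f c (⊩while p q) with f , g ← ∧-true f
    with _ , refl , p ← complete f c p with _ , refl , q ← complete g c q = _ , refl , ⊢while p q
  complete f c (⊩ifzero b p q r) with f , g ← ∧-true f with g , h ← ∧-true g
    with _ , refl , p ← complete f c p with _ , refl , q ← complete g c q
      with _ , refl , r ← complete h c r
    = _ , refl , ⊢ifzero b p q r
  complete {Γ₀ = Γ₀} f c (⊩ident u refl) with y , refl , eq ← c .cover _ u =
    ident y , refl , transport (Γ₀ ⊢[ SCI ] ident y ∶_) eq (⊢ident-anywhere Γ₀ y)
  complete f c (⊩lam p)
    with _ , refl , p ← complete f (extend-covers c) p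
    = _ , refl , ⊢lam p
  complete f c (⊩new b p)
    with _ , refl , p ← complete f (extend-covers c) p
    = _ , refl , ⊢new b p
  complete {Γ₀ = Γ₀} {θ} f c (⊩app κ p q)
    with a , b , π , l , r , onto-l , onto-r ← partition (κ ∘ θ)
    -- `⊢exchange` requires a permutation of one and the same `Fin`; a bijection forces the sizes to
    -- agree.
    with refl ← ↔⇒≡ π
    with f , g ← ∧-true f
    with M₀ , refl , p ← complete f (restrict-covers (λ i → π ⟨$⟩ʳ (i ↑ˡ b)) onto-l c) p
    with N₀ , refl , q ← complete g (restrict-covers (λ j → π ⟨$⟩ʳ (a ↑ʳ j)) onto-r c) q
    = _ , cong₂ app (trans (cong (rename θ) (rename-∘ (λ _ → refl) M₀)) (rename-∘ (λ _ → refl) M₀))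
                    (trans (cong (rename θ) (rename-∘ (λ _ → refl) N₀)) (rename-∘ (λ _ → refl) N₀)) ,
      ⊢exchange π (λ x → sym (lookup-halves {a} (lookup Γ₀ ∘ (π ⟨$⟩ʳ_)) x)) (⊢app p q)
    where
    lookup-halves : ∀ {a b} (f : Fin (a + b) → Ty) x →
      lookup (tabulate (λ i → f (i ↑ˡ b)) ++ tabulate (λ j → f (a ↑ʳ j))) x ≡ f x
    lookup-halves {zero}  f x       = lookup∘tabulate f x
    lookup-halves {suc a} f zero    = refl
    lookup-halves {suc a} f (suc x) = lookup-halves {a} (f ∘ suc) x

  -- Elimination of one mkvar

  -- mark b and implement b act on the first mkvar of a term if b holds, and on
  -- none otherwise.
  mark : ∀ {n} → Bool → Tm n → Tm⁺ n
  mark b     (num k)        = num⁺ k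
  mark b     (op o M N)     = op⁺ (just o) (mark b M) (mark (b ∧ free M) N)
  mark b     skip           = skip⁺
  mark b     (seq M N)      = seq⁺ (mark b M) (mark (b ∧ free M) N)
  mark b     (assign M N)   = assign⁺ (mark b M) (mark (b ∧ free M) N)
  mark b     (deref M)      = deref⁺ (mark b M)
  mark b     (while M N)    = while⁺ (mark b M) (mark (b ∧ free M) N)
  mark b     (ifzero M N P) = ifzero⁺ (mark b M) (mark (b ∧ free M) N) (mark ((b ∧ free M) ∧ free N) P)
  mark b     (ident x)      = ident⁺ x
  mark b     (lam A M)      = lam⁺ A (mark b M)
  mark b     (app M N)      = app⁺ (mark b M) (mark (b ∧ free M) N)
  mark b     (new M)        = new⁺ (mark b M)
  mark false (mkvar M N)    = mkvar⁺ (mark false M) (mark false N)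
  mark true  (mkvar M N)    = marked (mark false M) (mark false N)

  implement : ∀ {m n} → Bool → (Fin m → Fin n) → Device n → Tm m → Tm n
  implement b     ρ d (num k)        = num k
  implement b     ρ d (op o M N)     = op o (implement b ρ d M) (implement (b ∧ free M) ρ d N)
  implement b     ρ d skip           = skip
  implement b     ρ d (seq M N)      = seq (implement b ρ d M) (implement (b ∧ free M) ρ d N)
  implement b     ρ d (assign M N)   = assign (implement b ρ d M) (implement (b ∧ free M) ρ d N)
  implement b     ρ d (deref M)      = deref (implement b ρ d M)
  implement b     ρ d (while M N)    = while (implement b ρ d M) (implement (b ∧ free M) ρ d N)
  implement b     ρ d (ifzero M N P) =
    ifzero (implement b ρ d M) (implement (b ∧ free M) ρ d N) (implement ((b ∧ free M) ∧ free N) ρ d P)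
  implement b     ρ d (ident x)      = ident (ρ x)
  implement b     ρ d (lam A M)      = lam A (implement b (lift 1 ρ) (mapDevice suc d) M)
  implement b     ρ d (app M N)      = app (implement b ρ d M) (implement (b ∧ free M) ρ d N)
  implement b     ρ d (new M)        = new (implement b (lift 1 ρ) (mapDevice suc d) M)
  implement false ρ d (mkvar M N)    = mkvar (implement false ρ d M) (implement false ρ d N)
  -- The nodes inside `M` and `N` stay for later rounds, and `suc` makes room for the private cell.
  implement true  ρ d (mkvar M N)    =
    gadget d (implement false (suc ∘ ρ) (mapDevice suc d) M)
      (implement false (suc ∘ ρ) (mapDevice suc d) N)

  mark-sim : ∀ {n n′} {W : World n n′} {Γ U t A d} b → W .machine ≡ just d → Γ ⨾ U ⊩ t ∶ A →
    Sim W Γ (mark b t) (implement b (W .embed) d t) A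
  mark-sim b eq ⊩num = ~num
  mark-sim b eq ⊩skip = ~skip
  mark-sim b eq (⊩op p q) = ~op (mark-sim b eq p) (mark-sim _ eq q)
  mark-sim b eq (⊩seq _ p q) = ~seq (mark-sim b eq p) (mark-sim _ eq q)
  mark-sim b eq (⊩assign p q) = ~assign (mark-sim b eq p) (mark-sim _ eq q)
  mark-sim b eq (⊩deref p) = ~deref (mark-sim b eq p)
  mark-sim b eq (⊩while p q) = ~while (mark-sim b eq p) (mark-sim _ eq q)
  mark-sim b eq (⊩ifzero _ p q r) = ~ifzero (mark-sim b eq p) (mark-sim _ eq q) (mark-sim _ eq r)
  mark-sim b eq (⊩ident _ e) = ~ident e
  mark-sim b eq (⊩lam p) = ~lam (mark-sim b (cong (Maybe.map _) eq) p)
  mark-sim b eq (⊩app _ p q) = ~app (mark-sim b eq p) (mark-sim _ eq q)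
  mark-sim b eq (⊩new g p) = ~new g (mark-sim b (cong (Maybe.map _) eq) p)
  mark-sim false eq (⊩mkvar p q) = ~mkvar (mark-sim false eq p) (mark-sim false eq q)
  mark-sim {W = W} true eq (⊩mkvar p q) = ~gadget eq
    (λ j → mark-sim {W = allocate j W} false (cong (Maybe.map _) eq) p)
    (λ j → mark-sim {W = allocate j W} false (cong (Maybe.map _) eq) q)

  -- The marked term that `mark-sim` relates to the instrumented term is related here to the
  -- original one, so its runs mediate between the two.
  unmark-sim : ∀ {n} {W : World n n} {Γ U t A} b → W .machine ≡ nothing → (∀ x → W .embed x ≡ x) →
    Γ ⨾ U ⊩ t ∶ A → Sim W Γ (mark b t) t A
  unmark-sim b eq i ⊩num = ~num
  unmark-sim b eq i ⊩skip = ~skip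
  unmark-sim b eq i (⊩op p q) = ~op (unmark-sim b eq i p) (unmark-sim _ eq i q)
  unmark-sim b eq i (⊩seq _ p q) = ~seq (unmark-sim b eq i p) (unmark-sim _ eq i q)
  unmark-sim b eq i (⊩assign p q) = ~assign (unmark-sim b eq i p) (unmark-sim _ eq i q)
  unmark-sim b eq i (⊩deref p) = ~deref (unmark-sim b eq i p)
  unmark-sim b eq i (⊩while p q) = ~while (unmark-sim b eq i p) (unmark-sim _ eq i q)
  unmark-sim b eq i (⊩ifzero _ p q r) =
    ~ifzero (unmark-sim b eq i p) (unmark-sim _ eq i q) (unmark-sim _ eq i r)
  unmark-sim {W = W} {Γ} b eq i (⊩ident {x = x} _ e) =
    transport (λ y → Sim W Γ (ident⁺ x) (ident y) _) (i x) (~ident e)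
  unmark-sim b eq i (⊩lam p) = ~lam (unmark-sim b (cong (Maybe.map _) eq) (lift-id i) p)
  unmark-sim b eq i (⊩app _ p q) = ~app (unmark-sim b eq i p) (unmark-sim _ eq i q)
  unmark-sim b eq i (⊩new g p) = ~new g (unmark-sim b (cong (Maybe.map _) eq) (lift-id i) p)
  unmark-sim false eq i (⊩mkvar p q) = ~mkvar (unmark-sim false eq i p) (unmark-sim false eq i q)
  unmark-sim true eq i (⊩mkvar p q) = ~erased eq (unmark-sim false eq i p) (unmark-sim false eq i q)

  -- Elimination inside a context

  liftInjection : ∀ {m n} → Fin m ↣ Fin n → Fin (suc m) ↣ Fin (suc n)
  liftInjection ρ = mk↣ {to = lift 1 (Injection.to ρ)} injective
    where
    injective : ∀ {x y} → lift 1 (Injection.to ρ) x ≡ lift 1 (Injection.to ρ) y → x ≡ y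
    injective {zero}  {zero}  _  = refl
    injective {suc x} {suc y} eq = cong suc (Injection.injective ρ (Fin.suc-injective eq))

  sucInjection : ∀ {m n} → Fin m ↣ Fin n → Fin m ↣ Fin (suc n)
  sucInjection ρ = mk↣ {to = suc ∘ Injection.to ρ} (Injection.injective ρ ∘ Fin.suc-injective)

  -- The gadget with the hole in its first component. A single hole is enough because the gadget
  -- contains each component once; plugging gives back `gadget` by computation.
  gadget₁ : ∀ {n k} → Device k → Ctx n (suc k) → Tm (suc k) → Ctx n k
  gadget₁ (device os g z e) C Q =
    seq₁ (new₁ (ifzero₃ (table os (! suc g)) (readArm (device os (suc g) (suc z) (suc e)) zero Q)
    (seq₂ (assign (ident zero) (op minus (table os (! suc g)) (num 1)))
      (seq₂ (increment (suc g)) (seq₁ (app₁ C (! zero)) (arm zero (suc z) (suc e) (num 1)))))))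
        (ident z)

  gadget₂ : ∀ {n k} → Device k → Tm (suc k) → Ctx n (suc k) → Ctx n k
  gadget₂ (device os g z e) P C = seq₁ (new₁ (ifzero₂ (table os (! suc g))
    (seq₂ (increment (suc g))
      (seq₁ (assign₂ (ident zero) C)
      (seq (arm zero (suc z) (suc e) (table os (! suc g))) (increment (suc g)))))
    (writeArm (device os (suc g) (suc z) (suc e)) zero P))) (ident z)

  -- Whether the hole is free of mkvar is decided with skip in it: all the terms
  -- that it is going to receive are.
  implementCtx : ∀ {n k k′} → Bool → Fin k ↣ Fin k′ → Device k′ → Ctx n k → Ctx n k′
  implementCtx b ρ d (hole ι)        = hole (ρ ↣-∘ ι)
  implementCtx b ρ d (op₁ o C N)     =
    op₁ o (implementCtx b ρ d C) (implement (b ∧ free (C ⟨ skip ⟩)) (Injection.to ρ) d N)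
  implementCtx b ρ d (op₂ o N C)     =
    op₂ o (implement b (Injection.to ρ) d N) (implementCtx (b ∧ free N) ρ d C)
  implementCtx b ρ d (seq₁ C N)      =
    seq₁ (implementCtx b ρ d C) (implement (b ∧ free (C ⟨ skip ⟩)) (Injection.to ρ) d N)
  implementCtx b ρ d (seq₂ N C)      =
    seq₂ (implement b (Injection.to ρ) d N) (implementCtx (b ∧ free N) ρ d C)
  implementCtx b ρ d (assign₁ C N)   =
    assign₁ (implementCtx b ρ d C) (implement (b ∧ free (C ⟨ skip ⟩)) (Injection.to ρ) d N)
  implementCtx b ρ d (assign₂ N C)   =
    assign₂ (implement b (Injection.to ρ) d N) (implementCtx (b ∧ free N) ρ d C)
  implementCtx b ρ d (deref₁ C)      = deref₁ (implementCtx b ρ d C)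
  implementCtx b ρ d (while₁ C N)    =
    while₁ (implementCtx b ρ d C) (implement (b ∧ free (C ⟨ skip ⟩)) (Injection.to ρ) d N)
  implementCtx b ρ d (while₂ N C)    =
    while₂ (implement b (Injection.to ρ) d N) (implementCtx (b ∧ free N) ρ d C)
  implementCtx b ρ d (ifzero₁ C N P) = ifzero₁ (implementCtx b ρ d C)
    (implement (b ∧ free (C ⟨ skip ⟩)) (Injection.to ρ) d N)
    (implement ((b ∧ free (C ⟨ skip ⟩)) ∧ free N) (Injection.to ρ) d P)
  implementCtx b ρ d (ifzero₂ N C P) = ifzero₂ (implement b (Injection.to ρ) d N)
    (implementCtx (b ∧ free N) ρ d C)
    (implement ((b ∧ free N) ∧ free (C ⟨ skip ⟩)) (Injection.to ρ) d P)
  implementCtx b ρ d (ifzero₃ N P C) = ifzero₃ (implement b (Injection.to ρ) d N)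
    (implement (b ∧ free N) (Injection.to ρ) d P) (implementCtx ((b ∧ free N) ∧ free P) ρ d C)
  implementCtx b ρ d (lam₁ A C)      = lam₁ A (implementCtx b (liftInjection ρ) (mapDevice suc d) C)
  implementCtx b ρ d (app₁ C N)      =
    app₁ (implementCtx b ρ d C) (implement (b ∧ free (C ⟨ skip ⟩)) (Injection.to ρ) d N)
  implementCtx b ρ d (app₂ N C)      =
    app₂ (implement b (Injection.to ρ) d N) (implementCtx (b ∧ free N) ρ d C)
  implementCtx b ρ d (new₁ C)        = new₁ (implementCtx b (liftInjection ρ) (mapDevice suc d) C)
  implementCtx false ρ d (mkvar₁ C N) =
    mkvar₁ (implementCtx false ρ d C) (implement false (Injection.to ρ) d N)
  implementCtx true  ρ d (mkvar₁ C N) =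
    gadget₁ d (implementCtx false (sucInjection ρ) (mapDevice suc d) C)
      (implement false (suc ∘ Injection.to ρ) (mapDevice suc d) N)
  implementCtx false ρ d (mkvar₂ N C) =
    mkvar₂ (implement false (Injection.to ρ) d N) (implementCtx false ρ d C)
  implementCtx true  ρ d (mkvar₂ N C) =
    gadget₂ d (implement false (suc ∘ Injection.to ρ) (mapDevice suc d) N)
      (implementCtx false (sucInjection ρ) (mapDevice suc d) C)

  implement-rename : ∀ {l m n} b {ρ : Fin m → Fin n} {ι : Fin l → Fin m} {κ d} M →
    (∀ x → ρ (ι x) ≡ κ x) →
    free M ≡ true → implement b ρ d (rename ι M) ≡ rename κ M
  implement-rename b (num k) i f = refl
  implement-rename b (op o M N) i f with f , g ← ∧-true f =
    cong₂ (op o) (implement-rename b M i f) (implement-rename _ N i g)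
  implement-rename b skip i f = refl
  implement-rename b (seq M N) i f with f , g ← ∧-true f =
    cong₂ seq (implement-rename b M i f) (implement-rename _ N i g)
  implement-rename b (assign M N) i f with f , g ← ∧-true f =
    cong₂ assign (implement-rename b M i f) (implement-rename _ N i g)
  implement-rename b (deref M) i f = cong deref (implement-rename b M i f)
  implement-rename b (while M N) i f with f , g ← ∧-true f =
    cong₂ while (implement-rename b M i f) (implement-rename _ N i g)
  implement-rename b (ifzero M N P) i f with f , g ← ∧-true f with g , h ← ∧-true g =
    cong₂ (λ F → F) (cong₂ ifzero (implement-rename b M i f) (implement-rename _ N i g))
      (implement-rename _ P i h)
  implement-rename b (ident x) i f = cong ident (i x)
  implement-rename b (lam A M) i f = cong (lam A) (implement-rename b M (lift-∘ i) f)
  implement-rename b (app M N) i f with f , g ← ∧-true f =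
    cong₂ app (implement-rename b M i f) (implement-rename _ N i g)
  implement-rename b (new M) i f = cong new (implement-rename b M (lift-∘ i) f)

  free-rename : ∀ {m n} {r : Fin m → Fin n} t → free (rename r t) ≡ free t
  free-rename (num k)        = refl
  free-rename (op o M N)     = cong₂ _∧_ (free-rename M) (free-rename N)
  free-rename skip           = refl
  free-rename (seq M N)      = cong₂ _∧_ (free-rename M) (free-rename N)
  free-rename (assign M N)   = cong₂ _∧_ (free-rename M) (free-rename N)
  free-rename (deref M)      = free-rename M
  free-rename (while M N)    = cong₂ _∧_ (free-rename M) (free-rename N)
  free-rename (ifzero M N P) = cong₂ _∧_ (free-rename M) (cong₂ _∧_ (free-rename N) (free-rename P))
  free-rename (ident x)      = refl
  free-rename (lam A M)      = free-rename M
  free-rename (app M N)      = cong₂ _∧_ (free-rename M) (free-rename N)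
  free-rename (new M)        = free-rename M
  free-rename (mkvar M N)    = refl

  SCI-free : ∀ {n} {Γ : Vec Ty n} {t A} → Γ ⊢[ SCI ] t ∶ A → free t ≡ true
  SCI-free ⊢ident = refl
  SCI-free (⊢lam p) = SCI-free p
  SCI-free (⊢app {M = M} {N} p q) =
    cong₂ _∧_ (trans (free-rename M) (SCI-free p)) (trans (free-rename N) (SCI-free q))
  SCI-free (⊢weakening {M = M} p) = trans (free-rename M) (SCI-free p)
  SCI-free (⊢exchange {M = M} _ _ p) = trans (free-rename M) (SCI-free p)
  SCI-free ⊢num = refl
  SCI-free ⊢skip = refl
  SCI-free (⊢op p q) = cong₂ _∧_ (SCI-free p) (SCI-free q)
  SCI-free (⊢seq _ p q) = cong₂ _∧_ (SCI-free p) (SCI-free q)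
  SCI-free (⊢assign p q) = cong₂ _∧_ (SCI-free p) (SCI-free q)
  SCI-free (⊢deref p) = SCI-free p
  SCI-free (⊢while p q) = cong₂ _∧_ (SCI-free p) (SCI-free q)
  SCI-free (⊢ifzero _ p q r) = cong₂ _∧_ (SCI-free p) (cong₂ _∧_ (SCI-free q) (SCI-free r))
  SCI-free (⊢new _ p) = SCI-free p

  free-plug : ∀ {n k} (C : Ctx n k) {M} → free M ≡ true → free (C ⟨ M ⟩) ≡ free (C ⟨ skip ⟩)
  free-plug (hole ι) {M} f      = trans (free-rename M) f
  free-plug (op₁ o C N) f       = cong (_∧ free N) (free-plug C f)
  free-plug (op₂ o N C) f       = cong (free N ∧_) (free-plug C f)
  free-plug (seq₁ C N) f        = cong (_∧ free N) (free-plug C f)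
  free-plug (seq₂ N C) f        = cong (free N ∧_) (free-plug C f)
  free-plug (assign₁ C N) f     = cong (_∧ free N) (free-plug C f)
  free-plug (assign₂ N C) f     = cong (free N ∧_) (free-plug C f)
  free-plug (deref₁ C) f        = free-plug C f
  free-plug (while₁ C N) f      = cong (_∧ free N) (free-plug C f)
  free-plug (while₂ N C) f      = cong (free N ∧_) (free-plug C f)
  free-plug (ifzero₁ C N P) f   = cong (_∧ free N ∧ free P) (free-plug C f)
  free-plug (ifzero₂ N C P) f   = cong (λ b → free N ∧ b ∧ free P) (free-plug C f)
  free-plug (ifzero₃ N P C) f   = cong (λ b → free N ∧ free P ∧ b) (free-plug C f)
  free-plug (lam₁ A C) f        = free-plug C f
  free-plug (app₁ C N) f        = cong (_∧ free N) (free-plug C f)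
  free-plug (app₂ N C) f        = cong (free N ∧_) (free-plug C f)
  free-plug (new₁ C) f          = free-plug C f
  free-plug (mkvar₁ C N) f      = refl
  free-plug (mkvar₂ N C) f      = refl

  module _ {n} {M : Tm n} (f : free M ≡ true) where

    implement-plug : ∀ {k k′} b (ρ : Fin k ↣ Fin k′) d (C : Ctx n k) →
      implement b (Injection.to ρ) d (C ⟨ M ⟩) ≡ implementCtx b ρ d C ⟨ M ⟩
    implement-plug b ρ d (hole ι)        = implement-rename b M (λ _ → refl) f
    implement-plug b ρ d (op₁ o C N)     =
      cong₂ (λ P c → op o P (implement (b ∧ c) _ d N)) (implement-plug b ρ d C) (free-plug C f)
    implement-plug b ρ d (op₂ o N C)     = cong (op o _) (implement-plug _ ρ d C)
    implement-plug b ρ d (seq₁ C N)      =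
      cong₂ (λ P c → seq P (implement (b ∧ c) _ d N)) (implement-plug b ρ d C) (free-plug C f)
    implement-plug b ρ d (seq₂ N C)      = cong (seq _) (implement-plug _ ρ d C)
    implement-plug b ρ d (assign₁ C N)   =
      cong₂ (λ P c → assign P (implement (b ∧ c) _ d N)) (implement-plug b ρ d C) (free-plug C f)
    implement-plug b ρ d (assign₂ N C)   = cong (assign _) (implement-plug _ ρ d C)
    implement-plug b ρ d (deref₁ C)      = cong deref (implement-plug b ρ d C)
    implement-plug b ρ d (while₁ C N)    =
      cong₂ (λ P c → while P (implement (b ∧ c) _ d N)) (implement-plug b ρ d C) (free-plug C f)
    implement-plug b ρ d (while₂ N C)    = cong (while _) (implement-plug _ ρ d C)
    implement-plug b ρ d (ifzero₁ C N P) =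
      cong₂ (λ Q c → ifzero Q (implement (b ∧ c) _ d N) (implement ((b ∧ c) ∧ free N) _ d P))
        (implement-plug b ρ d C) (free-plug C f)
    implement-plug b ρ d (ifzero₂ N C P) =
      cong₂ (λ Q c → ifzero _ Q (implement ((b ∧ free N) ∧ c) _ d P)) (implement-plug _ ρ d C)
        (free-plug C f)
    implement-plug b ρ d (ifzero₃ N P C) = cong (ifzero _ _) (implement-plug _ ρ d C)
    implement-plug b ρ d (lam₁ A C)      = cong (lam A) (implement-plug b (liftInjection ρ) _ C)
    implement-plug b ρ d (app₁ C N)      =
      cong₂ (λ P c → app P (implement (b ∧ c) _ d N)) (implement-plug b ρ d C) (free-plug C f)
    implement-plug b ρ d (app₂ N C)      = cong (app _) (implement-plug _ ρ d C)
    implement-plug b ρ d (new₁ C)        = cong new (implement-plug b (liftInjection ρ) _ C)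
    implement-plug false ρ d (mkvar₁ C N) = cong (λ P → mkvar P _) (implement-plug false ρ d C)
    implement-plug true  ρ d (mkvar₁ C N) =
      cong (λ P → gadget d P _) (implement-plug false (sucInjection ρ) _ C)
    implement-plug false ρ d (mkvar₂ N C) = cong (mkvar _) (implement-plug false ρ d C)
    implement-plug true  ρ d (mkvar₂ N C) =
      cong (gadget d _) (implement-plug false (sucInjection ρ) _ C)

  -- Typing of the instrumented term

  Cells : ∀ {n} → (Fin n → Set) → Device n → Set
  Cells P (device _ g z e) = P g × P z × P e

  shift-outside : ∀ {m n} (r⁻ : Fin n → Maybe (Fin m)) d → Cells (λ y → r⁻ y ≡ Maybe.nothing) d →
    Cells (λ y → lift⁻ r⁻ y ≡ Maybe.nothing) (mapDevice suc d)
  shift-outside r⁻ d (p , q , r) =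
    cong (Maybe.map suc) p , cong (Maybe.map suc) q , cong (Maybe.map suc) r

  -- The colouring of `app P (! w)`: the private cell goes to the argument, everything else to `P`.
  aboveZero : ∀ {n} → Fin (suc n) → Bool
  aboveZero zero    = false
  aboveZero (suc _) = true

  module _ {n} {Γ : Vec Ty n} {U : Fin n → Set} where

    ⊩! : ∀ {x} → U x → lookup Γ x ≡ var → Γ ⨾ U ⊩ ! x ∶ nat
    ⊩! u eq = ⊩deref (⊩ident u eq)

    ⊩table : ∀ {X} os → Γ ⨾ U ⊩ X ∶ nat → Γ ⨾ U ⊩ table os X ∶ nat
    ⊩table []       p = ⊩seq nat (⊩while ⊩num ⊩skip) ⊩num
    ⊩table (c ∷ os) p = ⊩ifzero nat p ⊩num (⊩table os (⊩op p ⊩num))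

    ⊩check : ∀ {z e} → U z → lookup Γ z ≡ var → U e → lookup Γ e ≡ var → Γ ⨾ U ⊩ check z e ∶ comm
    ⊩check u p w q = ⊩while
      (⊩op ⊩num (⊩op (⊩op (⊩! u p) (⊩! w q)) (⊩op (⊩! w q) (⊩! u p)))) ⊩skip

    ⊩increment : ∀ {g} → U g → lookup Γ g ≡ var → Γ ⨾ U ⊩ increment g ∶ comm
    ⊩increment u p = ⊩assign (⊩ident u p) (⊩op ⊩num (⊩! u p))

  ⊩gadget : ∀ {n} {Γ : Vec Ty n} {U d P Q} → Cells (λ y → lookup Γ y ≡ var) d → Cells U d →
    var ∷ Γ ⨾ (λ x → (U ▹) x × aboveZero x ≡ true) ⊩ P ∶ nat ⊸ comm → var ∷ Γ ⨾ U ▹ ⊩ Q ∶ nat →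
    Γ ⨾ U ⊩ gadget d P Q ∶ var
  ⊩gadget {Γ = Γ} {U} {device os g z e} (pg , pz , pe) (ug , uz , ue) p q =
    ⊩seq var (⊩new comm (⊩ifzero comm table′ (⊩seq comm (⊩increment ug pg)
        (⊩seq comm (⊩assign w q) (⊩seq comm (arm′ table′) (⊩increment ug pg))))
      (⊩seq comm (⊩assign w (⊩op table′ ⊩num)) (⊩seq comm (⊩increment ug pg)
        (⊩seq comm (⊩app aboveZero p (⊩! (tt , refl) refl)) (arm′ ⊩num))))))
      (⊩ident uz pz)
    where
    w : var ∷ Γ ⨾ U ▹ ⊩ ident zero ∶ var
    w = ⊩ident tt refl
    table′ : var ∷ Γ ⨾ U ▹ ⊩ table os (! suc g) ∶ nat
    table′ = ⊩table os (⊩! ug pg)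
    arm′ : ∀ {C} → var ∷ Γ ⨾ U ▹ ⊩ C ∶ nat → var ∷ Γ ⨾ U ▹ ⊩ arm zero (suc z) (suc e) C ∶ comm
    arm′ c = ⊩seq comm (⊩check uz pz ue pe)
      (⊩seq comm (⊩assign (⊩ident uz pz) (⊩op c (⊩! tt refl))) (⊩assign (⊩ident ue pe) (⊩! tt refl)))

  -- The cells must be available only in the subterm that receives the gadget. To require them
  -- everywhere would fail at applications, where only one side can own them.
  Uses : Bool → Bool → Set → Set
  Uses b f X = b ≡ true → f ≡ false → X

  uses-left : ∀ {b f X} g → Uses b (f ∧ g) X → Uses b f X
  uses-left g u b refl = u b refl

  uses-right : ∀ {b f X g} → Uses b (f ∧ g) X → Uses (b ∧ f) g X
  uses-right {true} {true} u _ g = u refl g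

  ⊩-implement : ∀ {m n} {ρ : Fin m → Fin n} {r⁻ Γ Γ₁ U U₁ t A d} b → r⁻ inverts ρ →
    (∀ x → lookup Γ₁ (ρ x) ≡ lookup Γ x) → (∀ x → U x → U₁ (ρ x)) →
    Cells (λ y → lookup Γ₁ y ≡ var) d → Cells (λ y → r⁻ y ≡ Maybe.nothing) d →
      Uses b (free t) (Cells U₁ d) →
    Γ ⨾ U ⊩ t ∶ A → Γ₁ ⨾ U₁ ⊩ implement b ρ d t ∶ A
  ⊩-implement b i g u v o w ⊩num = ⊩num
  ⊩-implement b i g u v o w ⊩skip = ⊩skip
  ⊩-implement {r⁻ = r⁻} b i g u v o w (⊩op {N = N} p q) = ⊩op
    (⊩-implement {r⁻ = r⁻} b i g u v o (uses-left (free N) w) p)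
    (⊩-implement {r⁻ = r⁻} _ i g u v o (uses-right w) q)
  ⊩-implement {r⁻ = r⁻} b i g u v o w (⊩seq {N = N} c p q) = ⊩seq c
    (⊩-implement {r⁻ = r⁻} b i g u v o (uses-left (free N) w) p)
    (⊩-implement {r⁻ = r⁻} _ i g u v o (uses-right w) q)
  ⊩-implement {r⁻ = r⁻} b i g u v o w (⊩assign {N = N} p q) = ⊩assign
    (⊩-implement {r⁻ = r⁻} b i g u v o (uses-left (free N) w) p)
    (⊩-implement {r⁻ = r⁻} _ i g u v o (uses-right w) q)
  ⊩-implement {r⁻ = r⁻} b i g u v o w (⊩deref p) = ⊩deref (⊩-implement {r⁻ = r⁻} b i g u v o w p)
  ⊩-implement {r⁻ = r⁻} b i g u v o w (⊩while {N = N} p q) = ⊩while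
    (⊩-implement {r⁻ = r⁻} b i g u v o (uses-left (free N) w) p)
    (⊩-implement {r⁻ = r⁻} _ i g u v o (uses-right w) q)
  ⊩-implement {r⁻ = r⁻} b i g u v o w (⊩ifzero {N₁ = N₁} {N₂} c p q s) = ⊩ifzero c
    (⊩-implement {r⁻ = r⁻} b i g u v o (uses-left (free N₁ ∧ free N₂) w) p)
    (⊩-implement {r⁻ = r⁻} _ i g u v o (uses-left (free N₂) (uses-right w)) q)
    (⊩-implement {r⁻ = r⁻} _ i g u v o (uses-right (uses-right w)) s)
  ⊩-implement b i g u v o w (⊩ident p eq) = ⊩ident (u _ p) (trans (g _) eq)
  ⊩-implement {r⁻ = r⁻} {d = d} b i g u v o w (⊩lam p) = ⊩lam
    (⊩-implement {r⁻ = lift⁻ r⁻} b (lift-inverse {r⁻ = r⁻} i) (lift-lookup g) (lift-use u) v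
      (shift-outside r⁻ d o) w p)
  ⊩-implement {r⁻ = r⁻} {U₁ = U₁} {d = d} b i g u v o w (⊩app {M = M} {N} κ p q) = ⊩app κ₁
    (⊩-implement {r⁻ = r⁻} b i g (λ x (p , eq) → u x p , trans (cong choose (i x)) eq) v o left p)
    (⊩-implement {r⁻ = r⁻} _ i g (λ x (p , eq) → u x p , trans (cong choose (i x)) eq) v o right q)
    where
    -- The default is the colour of the cells, which lie outside the image of `ρ`: they go to the
    -- function if it receives the gadget, and otherwise to the argument.
    choose = Maybe.maybe′ κ (b ∧ not (free M))
    κ₁ = λ y → choose (r⁻ y)
    left : Uses b (free M) (Cells (λ y → U₁ y × κ₁ y ≡ true) d)
    left bt Mf = let ug , uz , ue = uses-left (free N) w bt Mf ; og , oz , oe = o in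
      (ug , claim og) , (uz , claim oz) , (ue , claim oe)
      where
      claim : ∀ {y} → r⁻ y ≡ Maybe.nothing → κ₁ y ≡ true
      claim eq = trans (cong choose eq) (cong₂ (λ b f → b ∧ not f) bt Mf)
    right : Uses (b ∧ free M) (free N) (Cells (λ y → U₁ y × κ₁ y ≡ false) d)
    right bt Nf = let ug , uz , ue = uses-right w bt Nf ; og , oz , oe = o in
      (ug , claim og) , (uz , claim oz) , (ue , claim oe)
      where
      claim : ∀ {y} → r⁻ y ≡ Maybe.nothing → κ₁ y ≡ false
      claim eq = trans (cong choose eq)
        (cong₂ (λ b f → b ∧ not f) (∧-true {b} bt .proj₁) (∧-true {b} bt .proj₂))
  ⊩-implement {r⁻ = r⁻} {d = d} b i g u v o w (⊩new c p) = ⊩new c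
    (⊩-implement {r⁻ = lift⁻ r⁻} b (lift-inverse {r⁻ = r⁻} i) (lift-lookup g) (lift-use u) v
      (shift-outside r⁻ d o) w p)
  ⊩-implement {r⁻ = r⁻} false i g u v o w (⊩mkvar p q) = ⊩mkvar
    (⊩-implement {r⁻ = r⁻} false i g u v o (λ ()) p) (⊩-implement {r⁻ = r⁻} false i g u v o (λ ()) q)
  ⊩-implement {n = n} {r⁻ = r⁻} true i g u v o w (⊩mkvar p q) = ⊩gadget v (w refl refl)
    (⊩-implement {r⁻ = r⁻₁} false i g (λ x p → u x p , refl) v o (λ ()) p)
    (⊩-implement {r⁻ = r⁻₁} false i g u v o (λ ()) q)
    where
    r⁻₁ : Fin (suc n) → Maybe _
    r⁻₁ zero    = Maybe.nothing
    r⁻₁ (suc y) = r⁻ y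

  -- The number of `mkvar` nodes

  mkvars : ∀ {n} → Tm n → ℕ
  mkvars (num k)        = 0
  mkvars (op o M N)     = mkvars M + mkvars N
  mkvars skip           = 0
  mkvars (seq M N)      = mkvars M + mkvars N
  mkvars (assign M N)   = mkvars M + mkvars N
  mkvars (deref M)      = mkvars M
  mkvars (while M N)    = mkvars M + mkvars N
  mkvars (ifzero M N P) = mkvars M + (mkvars N + mkvars P)
  mkvars (ident x)      = 0
  mkvars (lam A M)      = mkvars M
  mkvars (app M N)      = mkvars M + mkvars N
  mkvars (new M)        = mkvars M
  mkvars (mkvar M N)    = suc (mkvars M + mkvars N)

  mkvars-table : ∀ {n} {X : Tm n} os → mkvars X ≡ 0 → mkvars (table os X) ≡ 0
  mkvars-table []       eq = refl
  mkvars-table (c ∷ os) eq = cong₂ _+_ eq (mkvars-table os (cong (_+ 0) eq))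

  mkvars-gadget : ∀ {n} d (P Q : Tm (suc n)) → mkvars (gadget d P Q) ≡ mkvars P + mkvars Q
  mkvars-gadget (device os g z e) P Q rewrite mkvars-table {X = ! suc g} os refl =
    arithmetic (mkvars P) (mkvars Q)
    where
    arithmetic : ∀ p q → q + 0 + (p + 0 + 0) + 0 ≡ p + q
    arithmetic = solve-∀

  eliminated : Bool → Bool → ℕ
  eliminated true false = 1
  eliminated _    _     = 0

  eliminated-∧ : ∀ b f g → eliminated b (f ∧ g) ≡ eliminated b f + eliminated (b ∧ f) g
  eliminated-∧ false _     _ = refl
  eliminated-∧ true  false _ = refl
  eliminated-∧ true  true  _ = refl

  eliminate-both : ∀ b f g {m m′ n n′} → eliminated b f + m′ ≡ m → eliminated (b ∧ f) g + n′ ≡ n →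
    eliminated b (f ∧ g) + (m′ + n′) ≡ m + n
  eliminate-both b f g {m′ = m′} {n′ = n′} refl refl =
    trans (cong (_+ (m′ + n′)) (eliminated-∧ b f g)) (interchange (eliminated b f) _ m′ n′)
    where
    interchange : ∀ a b c d → a + b + (c + d) ≡ a + c + (b + d)
    interchange = solve-∀

  mkvars-implement : ∀ {m n} b (ρ : Fin m → Fin n) d t →
    eliminated b (free t) + mkvars (implement b ρ d t) ≡ mkvars t
  mkvars-implement true ρ d (num k) = refl
  mkvars-implement false ρ d (num k) = refl
  mkvars-implement b ρ d (op o M N) =
    eliminate-both b _ _ (mkvars-implement b ρ d M) (mkvars-implement _ ρ d N)
  mkvars-implement true ρ d skip = refl
  mkvars-implement false ρ d skip = refl
  mkvars-implement b ρ d (seq M N) =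
    eliminate-both b _ _ (mkvars-implement b ρ d M) (mkvars-implement _ ρ d N)
  mkvars-implement b ρ d (assign M N) =
    eliminate-both b _ _ (mkvars-implement b ρ d M) (mkvars-implement _ ρ d N)
  mkvars-implement b ρ d (deref M) = mkvars-implement b ρ d M
  mkvars-implement b ρ d (while M N) =
    eliminate-both b _ _ (mkvars-implement b ρ d M) (mkvars-implement _ ρ d N)
  mkvars-implement b ρ d (ifzero M N P) = eliminate-both b _ _ (mkvars-implement b ρ d M)
    (eliminate-both (b ∧ free M) _ _ (mkvars-implement _ ρ d N) (mkvars-implement _ ρ d P))
  mkvars-implement true ρ d (ident x) = refl
  mkvars-implement false ρ d (ident x) = refl
  mkvars-implement b ρ d (lam A M) = mkvars-implement b _ _ M
  mkvars-implement b ρ d (app M N) =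
    eliminate-both b _ _ (mkvars-implement b ρ d M) (mkvars-implement _ ρ d N)
  mkvars-implement b ρ d (new M) = mkvars-implement b _ _ M
  mkvars-implement false ρ d (mkvar M N) =
    cong suc (cong₂ _+_ (mkvars-implement false ρ d M) (mkvars-implement false ρ d N))
  mkvars-implement {n = n} true ρ d (mkvar M N) = cong suc
    (trans (mkvars-gadget d (implement false ρ₁ (mapDevice suc d) M)
      (implement false ρ₁ (mapDevice suc d) N))
      (cong₂ _+_ (mkvars-implement false ρ₁ (mapDevice suc d) M)
        (mkvars-implement false ρ₁ (mapDevice suc d) N)))
    where
    ρ₁ : _ → Fin (suc n)
    ρ₁ x = suc (ρ x)

  -- The harness and the transfer of results

  predict : List ℕ → Device 3
  predict o = device o zero (suc zero) (suc (suc zero))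

  finalCheck : Tm 3
  finalCheck = check (suc zero) (suc (suc zero))

  allocated : Store 3
  allocated = 0 ∷ 0 ∷ 0 ∷ []

  -- No later access checks the last one, so `finalCheck` does. At type `nat` the check has to come
  -- after `t` without losing its value: operands are evaluated from left to right, and the second
  -- one checks and then contributes 0.
  harness : ∀ {B} → Ground B → Tm 3 → Tm 0
  harness comm t = new (new (new (seq t finalCheck)))
  harness nat  t = new (new (new (op plus t (seq finalCheck (num 0)))))

  harnessCtx : ∀ {B n} → Ground B → Ctx n 3 → Ctx n 0
  harnessCtx comm C = new₁ (new₁ (new₁ (seq₁ C finalCheck)))
  harnessCtx nat  C = new₁ (new₁ (new₁ (op₁ plus C (seq finalCheck (num 0)))))

  harness-plug : ∀ {B n} (b : Ground B) (C : Ctx n 3) {M} → harnessCtx b C ⟨ M ⟩ ≡ harness b (C ⟨ M ⟩)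
  harness-plug comm C = refl
  harness-plug nat  C = refl

  data Result : Ty → Set where
    number : ℕ → Result nat
    done   : Result comm

  ⌜_⌝ : ∀ {B n} → Result B → Tm n
  ⌜ number k ⌝ = num k
  ⌜ done ⌝     = skip

  ⌜_⌝⁺ : ∀ {B n} → Result B → Tm⁺ n
  ⌜ number k ⌝⁺ = num⁺ k
  ⌜ done ⌝⁺     = skip⁺

  result-ground : ∀ {B} → Result B → Ground B
  result-ground (number _) = nat
  result-ground done       = comm

  result-⊢ : ∀ {L B} (v : Result B) → [] ⊢[ L ] ⌜ v ⌝ ∶ B
  result-⊢ (number k) = ⊢num
  result-⊢ done       = ⊢skip

  result-value : ∀ {B n} (v : Result B) → Value {n} ⌜ v ⌝
  result-value (number k) = num
  result-value done       = skip

  result : ∀ {U V B} → Ground B → Value V → [] ⨾ U ⊩ V ∶ B → Σ (Result B) λ v → V ≡ ⌜ v ⌝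
  result b v ⊩num   = number _ , refl
  result b v ⊩skip  = done , refl

  harness-run : ∀ {B t s} (v : Result B) → allocated ∣ t ⇓ s ∣ ⌜ v ⌝ →
    lookup s (suc zero) ≡ lookup s (suc (suc zero)) → harness (result-ground v) t ⇓ ⌜ v ⌝
  harness-run {s = _ ∷ _ ∷ _ ∷ []} done d eq =
    ⇓new {V = skip} (⇓new {V = skip} (⇓new {V = skip} (⇓seq d (↦check eq .run))))
  harness-run {t = t} {s = _ ∷ _ ∷ _ ∷ []} (number k) d eq =
    transport (λ j → harness nat t ⇓ num j) (trans (⟦plus⟧ k 0) (+-identityʳ k))
      (⇓new {V = num _} (⇓new {V = num _} (⇓new {V = num _}
        (⇓op d (⇓seq (↦check eq .run) (⇓value num))))))

  harness-ran : ∀ {B t} (v : Result B) → harness (result-ground v) t ⇓ ⌜ v ⌝ →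
    Σ (Store 3) λ s → lookup s (suc zero) ≡ lookup s (suc (suc zero)) × allocated ∣ t ⇓ s ∣ ⌜ v ⌝
  harness-ran done (⇓new (⇓new (⇓new (⇓seq d e)))) = _ , check-passed e , d
  harness-ran {t = t} (number k) (⇓new (⇓new (⇓new d))) = ran refl d
    where
    -- The rule for operations returns `⟦ plus ⟧ j i`, which does not unify with `k`, hence the
    -- equation on `U`.
    ran : ∀ {s U} → U ≡ num k → allocated ∣ op plus t (seq finalCheck (num 0)) ⇓ s ∣ U →
      Σ (Store 3) λ s → lookup s (suc zero) ≡ lookup s (suc (suc zero)) × allocated ∣ t ⇓ s ∣ num k
    ran eq (⇓op {k₁ = j} d (⇓seq e (⇓value num))) with refl ← eq =
      _ , check-passed e , transport (λ i → allocated ∣ t ⇓ _ ∣ num i)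
        (sym (trans (⟦plus⟧ j 0) (+-identityʳ j))) d

  embedding : Fin 0 ↣ Fin 3
  embedding = mk↣ {to = λ ()} λ { {()} }

  gadgetWorld : List ℕ → World 0 3
  gadgetWorld o .embed     = Injection.to embedding
  gadgetWorld o .Holds _ _ = ⊥
  gadgetWorld o .machine   = just (predict o)

  gadgetWorld-valid : ∀ {o} → Valid (gadgetWorld o)
  gadgetWorld-valid .role           = reserved
  gadgetWorld-valid .role-source ()
  gadgetWorld-valid .role-held ()
  gadgetWorld-valid .role-machine   = just refl refl refl

  gadgetWorld-agree : ∀ {o s} → Agree (gadgetWorld o) [] s
  gadgetWorld-agree .at-source ()
  gadgetWorld-agree .at-held ()

  plainWorld : World 0 0
  plainWorld .embed x     = x
  plainWorld .Holds _ _ = ⊥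
  plainWorld .machine   = nothing

  plainWorld-valid : Valid plainWorld
  plainWorld-valid .role           = source
  plainWorld-valid .role-source _  = refl
  plainWorld-valid .role-held ()
  plainWorld-valid .role-machine   = nothing

  plainWorld-agree : Agree plainWorld [] []
  plainWorld-agree .at-source _ = refl
  plainWorld-agree .at-held ()

  instrumented : List ℕ → Tm 0 → Tm 3
  instrumented o = implement true (Injection.to embedding) (predict o)

  MarkedRun : Bool → List ℕ → Tm 0 → List ℕ → ∀ {B} → Result B → Set
  MarkedRun c o t o′ v = Run c o [] (mark true t) o′ [] ⌜ v ⌝⁺

  resume-result : ∀ {n n′} {W : World n n′} {Γ σ s V B} (v : Result B) → Agree W σ s →
    Sim W Γ ⌜ v ⌝⁺ V B → s ∣ V ⇓ s ∣ ⌜ v ⌝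
  resume-result (number k) a m     = eval-num a m
  resume-result done       a ~skip = ⇓value skip

  reflect-result : ∀ {c n n′ σ} {t : Tm⁺ n} {W : World n n′} {Γ s s₁ U B} (v : Result B) → U ≡ ⌜ v ⌝ →
    OnlyVars Γ →
    Outcome c W Γ σ s t B s₁ U → Σ (Store n) λ σ₁ →
      ∀ {o₁} → Log (W .machine) s₁ o₁ → ∃[ o ] Log (W .machine) s o × Run c o σ t o₁ σ₁ ⌜ v ⌝⁺
  reflect-result (number _) eq Γv out
    with _ , σ₁ , num  , _ , f ← answered nat Γv out | refl ← eq = σ₁ , f
  reflect-result done       eq Γv out with _ , σ₁ , skip , _ , f ← answered comm Γv out = σ₁ , f

  module _ {t U B} (v : Result B) (p : [] ⨾ U ⊩ t ∶ B) where

    -- An honest run may be reconstructed from any final list; with `[]` the trace holds no more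
    -- predictions than are consumed.
    trace : t ⇓ ⌜ v ⌝ → ∃[ o ] MarkedRun false o t [] v
    trace d with [] , f ← reflect-result v refl (λ ())
        (reflect d honest plainWorld-valid (λ ())
          (unmark-sim true refl (λ _ → refl) p) plainWorld-agree)
      with o , _ , r ← f nothing = o , r

    replay : ∀ {o o′} → MarkedRun false o t o′ v → t ⇓ ⌜ v ⌝
    replay r with forward {[]} m a _ k ←
        simulate r (λ _ → refl) plainWorld-valid
          (unmark-sim true refl (λ _ → refl) p) plainWorld-agree nothing
      = k (resume-result v a m)

    execute : ∀ {c o o′} → MarkedRun c o t o′ v → harness (result-ground v) (instrumented o t) ⇓ ⌜ v ⌝
    execute {o = o} r with forward m a (just eq _) k ←
        simulate {W = gadgetWorld o} {s = allocated} r (λ ()) gadgetWorld-valid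
          -- New cells contain 0: the counter stands at the first prediction, and content and
          -- expected value agree before any access.
          (mark-sim true refl p) gadgetWorld-agree (just refl refl)
      = harness-run v (k (resume-result v a m)) eq

    observe : ∀ {o} → harness (result-ground v) (instrumented o t) ⇓ ⌜ v ⌝ →
      ∃[ o′ ] MarkedRun true o t o′ v
    observe {o} d with _ , eq , d ← harness-ran v d
      with [] , f ← reflect-result v refl (λ ())
        (reflect {σ = []} {W = gadgetWorld o} d cheating gadgetWorld-valid (λ ())
          (mark-sim true refl p) gadgetWorld-agree)
      with _ , just _ refl , r ← f (just eq refl) = _ , r

  -- If u cheats on the predictions that t follows honestly, then it also follows
  -- altered ones, hence so does t, which honest-deterministic excludes.
  transfer : ∀ {t u U B} (v : Result B) → [] ⨾ U ⊩ t ∶ B → [] ⨾ U ⊩ u ∶ B →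
    (∀ o → harness (result-ground v) (instrumented o t) ⇓ ⌜ v ⌝ ⇔
           harness (result-ground v) (instrumented o u) ⇓ ⌜ v ⌝) →
    t ⇓ ⌜ v ⌝ → u ⇓ ⌜ v ⌝
  transfer v p q same d
    with o , r ← trace v p d
    with _ , r′ ← observe v q (Equivalence.to (same o) (execute v p r))
    with honest-or-altered r′
  ... | inj₁ h = replay v q h
  ... | inj₂ (o* , alt , r″)
    with _ , r‴ ← observe v p (Equivalence.from (same o*) (execute v q r″))
    -- The trace was consumed to the end, and the empty list has no alteration.
    with () ← honest-deterministic r r‴ alt .proj₁

  ⊩-harness : ∀ {B U t} (b : Ground B) → var ∷ var ∷ var ∷ [] ⨾ U ▹ ▹ ▹ ⊩ t ∶ B →
    [] ⨾ U ⊩ harness b t ∶ B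
  ⊩-harness comm p = ⊩new comm (⊩new comm (⊩new comm (⊩seq comm p (⊩check tt refl tt refl))))
  ⊩-harness nat  p = ⊩new nat (⊩new nat (⊩new nat (⊩op p (⊩seq nat (⊩check tt refl tt refl) ⊩num))))

  ⊩-instrumented : ∀ {B U t} o → [] ⨾ U ⊩ t ∶ B → var ∷ var ∷ var ∷ [] ⨾ U ▹ ▹ ▹ ⊩ instrumented o t ∶ B
  ⊩-instrumented o p = ⊩-implement {r⁻ = λ _ → Maybe.nothing} true (λ ()) (λ ()) (λ ())
    (refl , refl , refl) (refl , refl , refl) (λ _ _ → tt , tt , tt) p

  mkvars-instrumented : ∀ t → free t ≡ false → ∀ o → suc (mkvars (instrumented o t)) ≡ mkvars t
  mkvars-instrumented t f o =
    trans (cong (λ b → eliminated true b + mkvars (instrumented o t)) (sym f))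
      (mkvars-implement true _ _ t)

  mkvars-harness : ∀ {B} (b : Ground B) t → mkvars (harness b t) ≡ mkvars t
  mkvars-harness comm t = +-identityʳ (mkvars t)
  mkvars-harness nat  t = +-identityʳ (mkvars t)

  module _ {n} {M N : Tm n} (M≅N : M ≅ N) (Mf : free M ≡ true) (Nf : free N ≡ true) where

    ⊢SCI : ∀ {t B} → free t ≡ true → [] ⨾ (λ _ → ⊤) ⊩ t ∶ B → [] ⊢[ SCI ] t ∶ B
    ⊢SCI f p with _ , refl , p ← complete {θ = λ x → x} f (record { cover = λ () }) p =
      transport ([] ⊢[ SCI ]_∶ _) (sym (rename-id (λ _ → refl) _)) p

    instrumentedCtx : List ℕ → Ctx n 0 → ∀ {B} → Ground B → Ctx n 0
    instrumentedCtx o C b = harnessCtx b (implementCtx true embedding (predict o) C)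

    plug : ∀ {P B} o (C : Ctx n 0) (b : Ground B) → free P ≡ true →
      instrumentedCtx o C b ⟨ P ⟩ ≡ harness b (instrumented o (C ⟨ P ⟩))
    plug o C b f =
      trans (harness-plug b _) (cong (harness b) (sym (implement-plug f true embedding (predict o) C)))

    -- By induction on the number of `mkvar`, for all contexts and results: for every list of
    -- predictions, the harness turns an instrumented context into a closed one with one node less
    -- and the same result. Types are kept in the affine form and converted only in the base case,
    -- where `M≅N` applies.
    conservative : ∀ k (C : Ctx n 0) {B} (v : Result B) → mkvars (C ⟨ M ⟩) ≡ k →
      [] ⨾ (λ _ → ⊤) ⊩ C ⟨ M ⟩ ∶ B → [] ⨾ (λ _ → ⊤) ⊩ C ⟨ N ⟩ ∶ B → C ⟨ M ⟩ ⇓ ⌜ v ⌝ ⇔ C ⟨ N ⟩ ⇓ ⌜ v ⌝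
    conservative k C v eq p q with free (C ⟨ skip ⟩) in f
    ... | true = M≅N C (result-ground v)
      (⊢SCI (trans (free-plug C Mf) f) p) (⊢SCI (trans (free-plug C Nf) f) q) (result-value v)
        (result-⊢ v)
    conservative k C v eq p q | false
      with eliminates ← mkvars-instrumented (C ⟨ M ⟩) (trans (free-plug C Mf) f)
      with k
    ... | zero with () ← trans (eliminates []) eq
    ... | suc k = mk⇔ (transfer v p q same) (transfer v q p (⇔-sym ∘ same))
      where
      same : ∀ o → harness (result-ground v) (instrumented o (C ⟨ M ⟩)) ⇓ ⌜ v ⌝ ⇔
                   harness (result-ground v) (instrumented o (C ⟨ N ⟩)) ⇓ ⌜ v ⌝
      same o = transport₂ (λ t u → t ⇓ ⌜ v ⌝ ⇔ u ⇓ ⌜ v ⌝) (plug o C b Mf) (plug o C b Nf)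
        (conservative k (instrumentedCtx o C b) v
          (trans (cong mkvars (plug o C b Mf))
            (trans (mkvars-harness b _) (suc-injective (trans (eliminates o) eq))))
          (transport ([] ⨾ _ ⊩_∶ _) (sym (plug o C b Mf)) (⊩-harness b (⊩-instrumented o p)))
          (transport ([] ⨾ _ ⊩_∶ _) (sym (plug o C b Nf)) (⊩-harness b (⊩-instrumented o q))))
        where b = result-ground v

lemma9p5 : (𝒪 : Operations) → let open Language 𝒪 in
    ∀ {n : ℕ} {Γ : Vec Ty n} {A : Ty} {M N : Tm n} →
    Γ ⊢[ SCI ] M ∶ A →
    Γ ⊢[ SCI ] N ∶ A →
    M ≅ N →
    M ≅mk N
lemma9p5 𝒪 {M = M} p q M≅N C b r s v w
  with u , refl ← Conservativity.result 𝒪 b v (Conservativity.sound 𝒪 {U = λ _ → ⊤} _ w) =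
  Conservativity.conservative 𝒪 M≅N (Conservativity.SCI-free 𝒪 p)
    (Conservativity.SCI-free 𝒪 q) _ C u refl (Conservativity.sound 𝒪 _ r) (Conservativity.sound 𝒪 _ s)
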